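{- Let $\mathfrak T$ be the class of closed triangles in $[0,1]^2$, where the degenerate cases of line segments and single points are included. Then $\mathrm{XC}_2|_{\mathfrak T}\not\le_{\mathrm W}\mathrm{XC}_1\times\mathrm{XC}_1$.
   Context: A represented space $\mathbf X$ is a set $X$ with a partial surjection $\delta_{\mathbf X}:\subseteq\mathbb N^{\mathbb N}\to X$ (a $p$ with $\delta_{\mathbf X}(p)=x$ is a name of $x$). A realizer of a (partial) multivalued function $f:\subseteq\mathbf X\rightrightarrows\mathbf Y$ is a partial $F:\subseteq\mathbb N^{\mathbb N}\to\mathbb N^{\mathbb N}$ with $\delta_{\mathbf Y}(F(p))\in f(\delta_{\mathbf X}(p))$ for all names $p$ of points of $\mathrm{dom}(f)$; write $F\vdash f$. Weihrauch reducibility: $f\le_{\mathrm W}g$ iff there are computable $H,K:\subseteq\mathbb N^{\mathbb N}\to\mathbb N^{\mathbb N}$ such that $(p\mapsto K\langle p,GH(p)\rangle)\vdash f$ for every $G\vdash g$. The product is $(f\times g)(x,u)=f(x)\times g(u)$. $\mathcal A(\mathbf X)$ is the represented space of closed subsets of $\mathbf X$ with negative information: a name of $A$ is a name of the open set $X\setminus A$ (its continuous characteristic function into Sierpiński space). Closed choice $\mathrm C_{\mathbf X}:\subseteq\mathcal A(\mathbf X)\rightrightarrows\mathbf X$ maps a non-empty closed set $A$ to an arbitrary point of $A$. $\mathrm{XC}_n$ is the restriction of $\mathrm C_{[0,1]^n}$ to (non-empty closed) convex sets, and $\mathrm{XC}_2|_{\mathfrak T}$ is its further restriction (for $n=2$)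 to inputs belonging to $\mathfrak T$. -}

module Defs where

open import Data.Bool.Base using (Bool; true; false)
open import Data.Fin.Base using (Fin; zero; suc)
open import Data.Integer.Base as ℤ using (+_)
import Data.Integer.Properties as ℤ
open import Data.List.Base using (List; []; _∷_; applyUpTo)
open import Data.Nat.Base as ℕ using (ℕ; zero; suc; _⊔_)
import Data.Nat.Properties as ℕ
open import Data.Product.Base using (Σ-syntax; ∃-syntax; _×_; _,_; proj₁; proj₂)
open import Data.Rational.Base using (ℚ; 0ℚ; 1ℚ; ½; ∣_∣; Positive; 1/_; positive; nonNegative)
  renaming (_+_ to _+ℚ_; _*_ to _*ℚ_; -_ to -ℚ_; _-_ to _-ℚ_; _≤_ to _≤ℚ_; _<_ to _<ℚ_)
open import Data.Rational.Base as ℚ using ()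
open import Data.Rational.Literals using (fromℤ)
import Data.Rational.Properties as ℚ
import Data.Rational.Solver as ℚS
import Data.Rational.Unnormalised.Base as ℚᵘ
import Data.Rational.Unnormalised.Properties as ℚᵘ
open import Data.Sum.Base using (inj₁; inj₂)
open import Data.Unit.Base using (⊤; tt)
open import Data.Vec.Base as Vec using (Vec; []; _∷_)
open import Data.Vec.Relation.Binary.Pointwise.Inductive using (Pointwise)
open import Function.Base using (_∘_; const)
open import Function.Bundles using (_⇔_; mk⇔; Equivalence)
open import Level using (0ℓ)
open import Relation.Binary.Core using (Rel)
open import Relation.Binary.Definitions using (tri<; tri≈; tri>)
open import Relation.Binary.PropositionalEquality
  using (_≡_; _≢_; _≗_; refl; sym; trans; cong; cong₂; subst)
open import Relation.Binary.Structures using (IsEquivalence)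
open import Relation.Nullary.Negation using (contradiction)
open import Relation.Nullary.Decidable.Core using (yes; no)

Baire : Set
Baire = ℕ → ℕ

-- ⟨ p , q ⟩ = p 0, q 0, p 1, q 1, …
⟨_,_⟩ : Baire → Baire → Baire
⟨ p , q ⟩ zero    = p zero
⟨ p , q ⟩ (suc n) = ⟨ q , p ∘ suc ⟩ n

⟨,⟩-cong : ∀ {p p′ q q′} → p ≗ p′ → q ≗ q′ → ⟨ p , q ⟩ ≗ ⟨ p′ , q′ ⟩
⟨,⟩-cong p≗ q≗ zero    = p≗ zero
⟨,⟩-cong p≗ q≗ (suc n) = ⟨,⟩-cong q≗ (p≗ ∘ suc) n

⟨,⟩-even : ∀ p q n → ⟨ p , q ⟩ (n ℕ.+ n) ≡ p n
⟨,⟩-even p q zero    = refl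
⟨,⟩-even p q (suc n) rewrite ℕ.+-suc n n = ⟨,⟩-even (p ∘ suc) (q ∘ suc) n

⟨,⟩-odd : ∀ p q n → ⟨ p , q ⟩ (suc (n ℕ.+ n)) ≡ q n
⟨,⟩-odd p q n = ⟨,⟩-even q (p ∘ suc) n

⟨,⟩-injective : ∀ {p p′ q q′} → ⟨ p , q ⟩ ≗ ⟨ p′ , q′ ⟩ → p ≗ p′ × q ≗ q′
⟨,⟩-injective {p} {p′} {q} {q′} eq =
  (λ n → trans (sym (⟨,⟩-even p q n)) (trans (eq (n ℕ.+ n)) (⟨,⟩-even p′ q′ n))) ,
  (λ n → trans (sym (⟨,⟩-odd p q n)) (trans (eq (suc (n ℕ.+ n))) (⟨,⟩-odd p′ q′ n)))

-- Graphs of partial functions; equality on Baire space is pointwise.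
record PartialFunction : Set₁ where
  infix 4 _↦_
  field
    _↦_        : Baire → Baire → Set
    ↦-resp     : ∀ {p p′ q q′} → p ≗ p′ → q ≗ q′ → p ↦ q → p′ ↦ q′
    functional : ∀ {p q q′} → p ↦ q → p ↦ q′ → q ≗ q′

open PartialFunction using (_↦_; ↦-resp; functional)

-- Programs of partial recursive functions relative to an oracle.  A
-- functional F is computable when one program, run with oracle p on
-- input n, outputs entry n of F(p), for every p in the domain of F.
data Code : ℕ → Set where
  zeroᶜ   : ∀ {k} → Code k
  sucᶜ    : Code 1
  oracleᶜ : Code 1
  projᶜ   : ∀ {k} → Fin k → Code k
  compᶜ   : ∀ {k m} → Code m → Vec (Code k) m → Code k
  recᶜ    : ∀ {k} → Code k → Code (2 ℕ.+ k) → Code (suc k)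
  minᶜ    : ∀ {k} → Code (suc k) → Code k

data Eval (p : Baire) : ∀ {k} → Code k → Vec ℕ k → ℕ → Set where
  zero   : ∀ {k} {xs : Vec ℕ k} → Eval p zeroᶜ xs 0
  suc    : ∀ {x} → Eval p sucᶜ (x ∷ []) (suc x)
  oracle : ∀ {x} → Eval p oracleᶜ (x ∷ []) (p x)
  proj   : ∀ {k} {xs : Vec ℕ k} (i : Fin k) → Eval p (projᶜ i) xs (Vec.lookup xs i)
  comp   : ∀ {k m} {c : Code m} {cs : Vec (Code k) m} {xs ys z} →
           Pointwise (λ d y → Eval p d xs y) cs ys → Eval p c ys z →
           Eval p (compᶜ c cs) xs z
  rec-0  : ∀ {k} {c : Code k} {d xs z} → Eval p c xs z →
           Eval p (recᶜ c d) (0 ∷ xs) z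
  rec-s  : ∀ {k} {c : Code k} {d n xs y z} → Eval p (recᶜ c d) (n ∷ xs) y →
           Eval p d (n ∷ y ∷ xs) z → Eval p (recᶜ c d) (suc n ∷ xs) z
  min    : ∀ {k} {c : Code (suc k)} {xs y} →
           (∀ i → i ℕ.< y → ∃[ v ] Eval p c (i ∷ xs) (suc v)) →
           Eval p c (y ∷ xs) 0 → Eval p (minᶜ c) xs y

Computable : PartialFunction → Set
Computable F = Σ[ c ∈ Code 1 ] (∀ p q → (F ↦ p) q → ∀ n → Eval p c (n ∷ []) (q n))

record RepresentedSpace : Set₁ where
  infix 4 _≈_ _names_
  field
    Carrier       : Set
    _≈_           : Rel Carrier 0ℓ
    isEquivalence : IsEquivalence _≈_
    _names_       : Baire → Carrier → Set
    names-resp    : ∀ {p p′ x x′} → p ≗ p′ → x ≈ x′ → p names x → p′ names x′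
    names-unique  : ∀ {p x x′} → p names x → p names x′ → x ≈ x′
    surjective    : ∀ x → ∃[ p ] p names x

  module Eq = IsEquivalence isEquivalence

open RepresentedSpace using (Carrier)

module _ (X Y : RepresentedSpace) where
  private
    module X = RepresentedSpace X
    module Y = RepresentedSpace Y

  infix 4 _⇉_

  -- Graph f x y stands for y ∈ f(x); f(x) is empty off the domain.
  record _⇉_ : Set₁ where
    field
      Graph      : X.Carrier → Y.Carrier → Set
      Graph-resp : ∀ {x x′ y y′} → x X.≈ x′ → y Y.≈ y′ → Graph x y → Graph x′ y′

    Dom : X.Carrier → Set
    Dom x = ∃[ y ] Graph x y

open _⇉_ using (Graph; Graph-resp; Dom)

infix 4 _⊢_
_⊢_ : ∀ {X Y} → PartialFunction → X ⇉ Y → Set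
_⊢_ {X} {Y} F f =
  ∀ p x → p X.names x → Dom f x → ∃[ q ] ((F ↦ p) q × ∃[ y ] (q Y.names y × Graph f x y))
  where
    module X = RepresentedSpace X
    module Y = RepresentedSpace Y

wrap : PartialFunction → PartialFunction → PartialFunction → PartialFunction
wrap H G K = record
  { _↦_        = λ p r → ∃[ h ] ∃[ g ] ((H ↦ p) h × (G ↦ h) g × (K ↦ ⟨ p , g ⟩) r)
  ; ↦-resp     = λ p≗ r≗ (h , g , Hp , Gh , Kg) →
      h , g , ↦-resp H p≗ (λ _ → refl) Hp , Gh , ↦-resp K (⟨,⟩-cong p≗ (λ _ → refl)) r≗ Kg
  ; functional = λ (h , g , Hp , Gh , Kg) (h′ , g′ , Hp′ , Gh′ , Kg′) →
      let h≗ = functional H Hp Hp′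
          g≗ = functional G (↦-resp G h≗ (λ _ → refl) Gh) Gh′
      in functional K (↦-resp K (⟨,⟩-cong (λ _ → refl) g≗) (λ _ → refl) Kg) Kg′
  }

-- Realizers G are single-valued, so that a multivalued g has any at all
-- is in general a matter of classical logic and choice.  Without them
-- the quantification over G may be vacuous; ExcludedMiddle, whose Dec
-- is untruncated, supplies both.
infix 4 _≤W_
_≤W_ : ∀ {X Y Z W} → X ⇉ Y → Z ⇉ W → Set₁
f ≤W g = Σ[ H ∈ PartialFunction ] Σ[ K ∈ PartialFunction ]
  (Computable H × Computable K × (∀ G → G ⊢ g → wrap H G K ⊢ f))

restrict : ∀ {X Y} → X ⇉ Y → (P : Carrier X → Set) →
           (∀ {x x′} → RepresentedSpace._≈_ X x x′ → P x → P x′) → X ⇉ Y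
restrict f P P-resp = record
  { Graph      = λ x y → P x × Graph f x y
  ; Graph-resp = λ x≈ y≈ (Px , fxy) → P-resp x≈ Px , Graph-resp f x≈ y≈ fxy
  }

single : ∀ {X Y} (f : Carrier X → Carrier Y) →
         (∀ {x x′} → RepresentedSpace._≈_ X x x′ → RepresentedSpace._≈_ Y (f x) (f x′)) → X ⇉ Y
single {X} {Y} f f-cong = record
  { Graph      = λ x y → f x Y.≈ y
  ; Graph-resp = λ x≈ y≈ fx≈y → Y.Eq.trans (Y.Eq.sym (f-cong x≈)) (Y.Eq.trans fx≈y y≈)
  }
  where module Y = RepresentedSpace Y

infixr 6 _×ʳ_
_×ʳ_ : RepresentedSpace → RepresentedSpace → RepresentedSpace
X ×ʳ Y = record
  { Carrier       = X.Carrier × Y.Carrier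
  ; _≈_           = λ (x , y) (x′ , y′) → x X.≈ x′ × y Y.≈ y′
  ; isEquivalence = record
      { refl  = X.Eq.refl , Y.Eq.refl
      ; sym   = λ (a , b) → X.Eq.sym a , Y.Eq.sym b
      ; trans = λ (a , b) (c , d) → X.Eq.trans a c , Y.Eq.trans b d
      }
  ; _names_       = λ r (x , y) → ∃[ p ] ∃[ q ] (r ≗ ⟨ p , q ⟩ × p X.names x × q Y.names y)
  ; names-resp    = λ r≗ (x≈ , y≈) (p , q , r≗pq , px , qy) →
      p , q , (λ n → trans (sym (r≗ n)) (r≗pq n)) ,
      X.names-resp (λ _ → refl) x≈ px , Y.names-resp (λ _ → refl) y≈ qy
  ; names-unique  = λ (p , q , e , px , qy) (p′ , q′ , e′ , px′ , qy′) →
      let (p≗ , q≗) = ⟨,⟩-injective (λ n → trans (sym (e n)) (e′ n))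
      in X.names-unique (X.names-resp p≗ X.Eq.refl px) px′ ,
         Y.names-unique (Y.names-resp q≗ Y.Eq.refl qy) qy′
  ; surjective    = λ (x , y) →
      let (p , px) = X.surjective x
          (q , qy) = Y.surjective y
      in ⟨ p , q ⟩ , p , q , (λ _ → refl) , px , qy
  }
  where
    module X = RepresentedSpace X
    module Y = RepresentedSpace Y

𝟙 : RepresentedSpace
𝟙 = record
  { Carrier       = ⊤
  ; _≈_           = λ _ _ → ⊤
  ; isEquivalence = record { refl = tt ; sym = λ _ → tt ; trans = λ _ _ → tt }
  ; _names_       = λ _ _ → ⊤
  ; names-resp    = λ _ _ _ → tt
  ; names-unique  = λ _ _ → tt
  ; surjective    = λ _ → const 0 , tt
  }

infix 8 _^ʳ_
_^ʳ_ : RepresentedSpace → ℕ → RepresentedSpace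
X ^ʳ 0           = 𝟙
X ^ʳ 1           = X
X ^ʳ suc (suc n) = X ×ʳ X ^ʳ suc n

infixr 6 _×ᵐ_
_×ᵐ_ : ∀ {X Y Z W} → X ⇉ Y → Z ⇉ W → X ×ʳ Z ⇉ Y ×ʳ W
f ×ᵐ g = record
  { Graph      = λ (x , u) (y , v) → Graph f x y × Graph g u v
  ; Graph-resp = λ (x≈ , u≈) (y≈ , v≈) (fxy , guv) →
      Graph-resp f x≈ y≈ fxy , Graph-resp g u≈ v≈ guv
  }

-- A bijection between finite sequences and natural numbers.
encode : List ℕ → ℕ
encode []       = 0
encode (x ∷ xs) = 2 ℕ.^ x ℕ.* suc (2 ℕ.* encode xs)

-- Function spaces are represented by Kleene's associates: p·q at n is
-- m if p answers suc m at the first prefix of q for which it answers at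
-- all; the answer 0 means "more input is needed".
record AppliesAt (p q : Baire) (n m : ℕ) : Set where
  constructor appliesAt
  field
    use     : ℕ
    answer  : p (encode (n ∷ applyUpTo q use)) ≡ suc m
    waiting : ∀ j → j ℕ.< use → p (encode (n ∷ applyUpTo q j)) ≡ 0

applyUpTo-cong : ∀ {q q′ : Baire} → q ≗ q′ → ∀ k → applyUpTo q k ≡ applyUpTo q′ k
applyUpTo-cong q≗ zero    = refl
applyUpTo-cong q≗ (suc k) = cong₂ _∷_ (q≗ 0) (applyUpTo-cong (q≗ ∘ suc) k)

AppliesAt-resp : ∀ {p p′ q q′ n m m′} → p ≗ p′ → q ≗ q′ → m ≡ m′ →
                 AppliesAt p q n m → AppliesAt p′ q′ n m′
AppliesAt-resp {p} {p′} {q} {q′} {n} p≗ q≗ refl (appliesAt k a w) =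
  appliesAt k (trans (step k) a) (λ j j<k → trans (step j) (w j j<k))
  where
  step : ∀ j → p′ (encode (n ∷ applyUpTo q′ j)) ≡ p (encode (n ∷ applyUpTo q j))
  step j = trans (sym (p≗ _)) (cong (λ l → p (encode (n ∷ l))) (sym (applyUpTo-cong q≗ j)))

AppliesAt-unique : ∀ {p q n m m′} → AppliesAt p q n m → AppliesAt p q n m′ → m ≡ m′
AppliesAt-unique (appliesAt k a w) (appliesAt k′ a′ w′) with ℕ.<-cmp k k′
... | tri< k<k′ _ _ = contradiction (trans (sym a) (w′ k k<k′)) λ ()
... | tri≈ _ refl _ = ℕ.suc-injective (trans (sym a) a′)
... | tri> _ _ k′<k = contradiction (trans (sym a′) (w k′ k′<k)) λ ()

infix 9 _·
_· : Baire → PartialFunction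
p · = record
  { _↦_        = λ q r → ∀ n → AppliesAt p q n (r n)
  ; ↦-resp     = λ q≗ r≗ A n → AppliesAt-resp (λ _ → refl) q≗ (r≗ n) (A n)
  ; functional = λ A A′ n → AppliesAt-unique (A n) (A′ n)
  }

-- The total functions that have a continuous realizer.
record Continuous (X Y : RepresentedSpace) : Set where
  private
    module X = RepresentedSpace X
    module Y = RepresentedSpace Y
  field
    to      : X.Carrier → Y.Carrier
    to-cong : ∀ {x x′} → x X.≈ x′ → to x Y.≈ to x′

  graph : X ⇉ Y
  graph = single {X} {Y} to to-cong

  field
    continuous : ∃[ p ] p · ⊢ graph

open Continuous using (to; graph; continuous)

𝒞 : RepresentedSpace → RepresentedSpace → RepresentedSpace
𝒞 X Y = record
  { Carrier       = Continuous X Y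
  ; _≈_           = λ f g → ∀ x → to f x Y.≈ to g x
  ; isEquivalence = record
      { refl  = λ _ → Y.Eq.refl
      ; sym   = λ f≈g x → Y.Eq.sym (f≈g x)
      ; trans = λ f≈g g≈h x → Y.Eq.trans (f≈g x) (g≈h x)
      }
  ; _names_       = λ p f → p · ⊢ graph f
  ; names-resp    = λ p≗ f≈g pf q x qx _ →
      let (r , pqr , y , ry , fx≈y) = pf q x qx (_ , Y.Eq.refl)
      in r , (λ n → AppliesAt-resp p≗ (λ _ → refl) refl (pqr n)) , y , ry ,
         Y.Eq.trans (Y.Eq.sym (f≈g x)) fx≈y
  ; names-unique  = λ {p} {f} {g} pf pg x →
      let (q , qx) = X.surjective x
          (r  , pqr  , y  , ry  , fx≈y)  = pf q x qx (_ , Y.Eq.refl)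
          (r′ , pqr′ , y′ , ry′ , gx≈y′) = pg q x qx (_ , Y.Eq.refl)
          y≈y′ = Y.names-unique (Y.names-resp (functional (p ·) pqr pqr′) Y.Eq.refl ry) ry′
      in Y.Eq.trans fx≈y (Y.Eq.trans y≈y′ (Y.Eq.sym gx≈y′))
  ; surjective    = continuous
  }
  where
    module X = RepresentedSpace X
    module Y = RepresentedSpace Y

SierpińskiName : Baire → Bool → Set
SierpińskiName p false = ∀ n → p n ≡ 0
SierpińskiName p true  = ∃[ n ] p n ≢ 0

𝕊 : RepresentedSpace
𝕊 = record
  { Carrier       = Bool
  ; _≈_           = _≡_
  ; isEquivalence = Relation.Binary.PropositionalEquality.isEquivalence
  ; _names_       = SierpińskiName
  ; names-resp    = λ { p≗ refl → resp p≗ _ }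
  ; names-unique  = λ {p} → unique p _ _
  ; surjective    = λ { false → const 0 , (λ _ → refl) ; true → const 1 , 0 , λ () }
  }
  where
  resp : ∀ {p p′} → p ≗ p′ → ∀ b → SierpińskiName p b → SierpińskiName p′ b
  resp p≗ false z       n = trans (sym (p≗ n)) (z n)
  resp p≗ true  (n , z)   = n , λ e → z (trans (p≗ n) e)
  unique : ∀ p b b′ → SierpińskiName p b → SierpińskiName p b′ → b ≡ b′
  unique p false false _       _       = refl
  unique p false true  z       (n , e) = contradiction (z n) e
  unique p true  false (n , e) z       = contradiction (z n) e
  unique p true  true  _       _       = refl

-- A closed set is the zero set of a continuous map into 𝕊, namely the
-- characteristic function of its complement.
𝒜 : RepresentedSpace → RepresentedSpace
𝒜 X = 𝒞 X 𝕊

infix 4 _∈_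
_∈_ : ∀ {X} → Carrier X → Carrier (𝒜 X) → Set
x ∈ A = to A x ≡ false

C : ∀ X → 𝒜 X ⇉ X
C X = record
  { Graph      = λ A x → _∈_ {X} x A
  ; Graph-resp = λ {A} {B} A≈B x≈y x∈A →
      trans (sym (A≈B _)) (trans (sym (Continuous.to-cong A x≈y)) x∈A)
  }

Eventually : (ℕ → Set) → Set
Eventually P = ∃[ N ] (∀ n → N ℕ.≤ n → P n)

Ev-zip : ∀ {P Q R : ℕ → Set} → (∀ {n} → P n → Q n → R n) →
         Eventually P → Eventually Q → Eventually R
Ev-zip f (N , p) (M , q) =
  N ⊔ M , λ n N⊔M≤n → f (p n (ℕ.≤-trans (ℕ.m≤m⊔n N M) N⊔M≤n)) (q n (ℕ.≤-trans (ℕ.m≤n⊔m N M) N⊔M≤n))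

Cauchy : (ℕ → ℚ) → Set
Cauchy x = ∀ ε → 0ℚ <ℚ ε →
  ∃[ N ] (∀ m n → N ℕ.≤ m → N ℕ.≤ n → ∣ x m -ℚ x n ∣ ≤ℚ ε)

-- Cauchy sequences of rationals, up to _≃_.
record ℝ : Set where
  constructor real
  field
    seq    : ℕ → ℚ
    cauchy : Cauchy seq

open ℝ

infix 4 _≤_ _≃_

_≤_ : ℝ → ℝ → Set
x ≤ y = ∀ ε → 0ℚ <ℚ ε → Eventually (λ n → seq x n ≤ℚ seq y n +ℚ ε)

_≃_ : ℝ → ℝ → Set
x ≃ y = x ≤ y × y ≤ x

private
  module S = ℚS.+-*-Solver
  open S using (_:=_; _:+_; _:*_; :-_; _:-_; con)

  lin : ∀ {a b c d} → a ≤ℚ b → a ≡ c → b ≡ d → c ≤ℚ d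
  lin p refl refl = p

  0<half : ∀ {ε} → 0ℚ <ℚ ε → 0ℚ <ℚ ½ *ℚ ε
  0<half {ε} 0<ε = subst (_<ℚ ½ *ℚ ε) (ℚ.*-zeroʳ ½) (ℚ.*-monoʳ-<-pos ½ 0<ε)

  half+half : ∀ ε → ½ *ℚ ε +ℚ ½ *ℚ ε ≡ ε
  half+half = S.solve 1 (λ e → con ½ :* e :+ con ½ :* e := e) refl

≤-refl : ∀ {x} → x ≤ x
≤-refl {x} ε 0<ε = 0 , λ n _ →
  lin (ℚ.+-monoʳ-≤ (seq x n) (ℚ.<⇒≤ 0<ε)) (ℚ.+-identityʳ _) refl

≤-trans : ∀ {x y z} → x ≤ y → y ≤ z → x ≤ z
≤-trans {x} {y} {z} x≤y y≤z ε 0<ε = Ev-zip step (x≤y _ (0<half 0<ε)) (y≤z _ (0<half 0<ε))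
  where
  step : ∀ {n} → seq x n ≤ℚ seq y n +ℚ ½ *ℚ ε → seq y n ≤ℚ seq z n +ℚ ½ *ℚ ε →
         seq x n ≤ℚ seq z n +ℚ ε
  step {n} a b = ℚ.≤-trans a (lin (ℚ.+-monoˡ-≤ (½ *ℚ ε) b) refl
    (trans (ℚ.+-assoc (seq z n) _ _) (cong (seq z n +ℚ_) (half+half ε))))

≃-isEquivalence : IsEquivalence _≃_
≃-isEquivalence = record
  { refl  = λ {x} → ≤-refl {x} , ≤-refl {x}
  ; sym   = λ (a , b) → b , a
  ; trans = λ {x} {y} {z} (a , b) (c , d) → ≤-trans {x} {y} {z} a c , ≤-trans {z} {y} {x} d b
  }

fromℚ : ℚ → ℝ
fromℚ q = real (const q) λ ε 0<ε → 0 , λ _ _ _ _ →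
  subst (_≤ℚ ε) (cong ∣_∣ (sym (ℚ.+-inverseʳ q))) (ℚ.<⇒≤ 0<ε)

infixl 6 _+_
infixl 7 _*_

_+_ : ℝ → ℝ → ℝ
x + y = real (λ n → seq x n +ℚ seq y n) λ ε 0<ε →
  let (N , p) = cauchy x _ (0<half 0<ε)
      (M , q) = cauchy y _ (0<half 0<ε)
  in N ⊔ M , λ m n m≥ n≥ →
    bound {ε} {seq x m} {seq x n} {seq y m} {seq y n}
          (p m n (ℕ.≤-trans (ℕ.m≤m⊔n N M) m≥) (ℕ.≤-trans (ℕ.m≤m⊔n N M) n≥))
          (q m n (ℕ.≤-trans (ℕ.m≤n⊔m N M) m≥) (ℕ.≤-trans (ℕ.m≤n⊔m N M) n≥))
  where
  regroup : ∀ a b c d → (a -ℚ b) +ℚ (c -ℚ d) ≡ (a +ℚ c) -ℚ (b +ℚ d)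
  regroup = S.solve 4 (λ a b c d → (a :- b) :+ (c :- d) := (a :+ c) :- (b :+ d)) refl
  bound : ∀ {ε a b c d} → ∣ a -ℚ b ∣ ≤ℚ ½ *ℚ ε → ∣ c -ℚ d ∣ ≤ℚ ½ *ℚ ε →
          ∣ (a +ℚ c) -ℚ (b +ℚ d) ∣ ≤ℚ ε
  bound {ε} {a} {b} {c} {d} h k =
    lin (ℚ.≤-trans (ℚ.∣p+q∣≤∣p∣+∣q∣ (a -ℚ b) (c -ℚ d)) (ℚ.+-mono-≤ h k))
        (cong ∣_∣ (regroup a b c d)) (half+half ε)

private
  bounded : ∀ x → ∃[ B ] (0ℚ <ℚ B × Eventually (λ n → ∣ seq x n ∣ ≤ℚ B))
  bounded x =
    let (N , p) = cauchy x 1ℚ (ℚ.positive⁻¹ 1ℚ)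
    in 1ℚ +ℚ ∣ seq x N ∣ ,
       lt (ℚ.0≤∣p∣ (seq x N)) ,
       N , λ n N≤n →
         lin (ℚ.≤-trans (ℚ.∣p+q∣≤∣p∣+∣q∣ (seq x n -ℚ seq x N) (seq x N))
                        (ℚ.+-monoˡ-≤ _ (p n N N≤n ℕ.≤-refl)))
             (cong ∣_∣ (cancel (seq x n) (seq x N))) refl
    where
    cancel : ∀ a b → (a -ℚ b) +ℚ b ≡ a
    cancel = S.solve 2 (λ a b → (a :- b) :+ b := a) refl
    lt : ∀ {b} → 0ℚ ≤ℚ b → 0ℚ <ℚ 1ℚ +ℚ b
    lt 0≤b = ℚ.+-mono-<-≤ (ℚ.positive⁻¹ 1ℚ) 0≤b

  divide : ∀ B ε → 0ℚ <ℚ B → 0ℚ <ℚ ε → ∃[ δ ] (0ℚ <ℚ δ × B *ℚ δ ≡ ε)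
  divide B ε 0<B 0<ε = ε *ℚ r ,
    ℚ.positive⁻¹ _ {{ℚ.pos*pos⇒pos ε {{positive 0<ε}} r {{ℚ.1/pos⇒pos B}}}} ,
    trans (swap B ε r) (trans (cong (ε *ℚ_) (ℚ.*-inverseʳ B)) (ℚ.*-identityʳ ε))
    where
    instance
      B-pos : Positive B
      B-pos = positive 0<B
      B≢0 : ℚ.NonZero B
      B≢0 = ℚ.pos⇒nonZero B
    r = 1/ B
    swap : ∀ a b c → a *ℚ (b *ℚ c) ≡ b *ℚ (a *ℚ c)
    swap = S.solve 3 (λ a b c → a :* (b :* c) := b :* (a :* c)) refl

_*_ : ℝ → ℝ → ℝ
x * y = real (λ n → seq x n *ℚ seq y n) cau
  where
  split : ∀ a b c d → a *ℚ (c -ℚ d) +ℚ d *ℚ (a -ℚ b) ≡ a *ℚ c -ℚ b *ℚ d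
  split = S.solve 4 (λ a b c d → a :* (c :- d) :+ d :* (a :- b) := a :* c :- b :* d) refl
  mul : ∀ {a b A δ} → 0ℚ <ℚ A → ∣ a ∣ ≤ℚ A → ∣ b ∣ ≤ℚ δ → ∣ a *ℚ b ∣ ≤ℚ A *ℚ δ
  mul {a} {b} {A} {δ} 0<A a≤ b≤ =
    subst (_≤ℚ A *ℚ δ) (sym (ℚ.∣p*q∣≡∣p∣*∣q∣ a b))
      (ℚ.≤-trans (ℚ.*-monoʳ-≤-nonNeg ∣ b ∣ {{ℚ.∣-∣-nonNeg b}} a≤)
                 (ℚ.*-monoˡ-≤-nonNeg A {{nonNegative (ℚ.<⇒≤ 0<A)}} b≤))
  cau : Cauchy (λ n → seq x n *ℚ seq y n)
  cau ε 0<ε =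
    let (A , 0<A , N₁ , xA) = bounded x
        (B , 0<B , N₂ , yB) = bounded y
        (δ , 0<δ , eq) = divide (A +ℚ B) ε (ℚ.+-mono-< 0<A 0<B) 0<ε
        (N₃ , p) = cauchy x δ 0<δ
        (N₄ , q) = cauchy y δ 0<δ
        N = (N₁ ⊔ N₂) ⊔ (N₃ ⊔ N₄)
        i₁ = ℕ.≤-trans (ℕ.m≤m⊔n N₁ N₂) (ℕ.m≤m⊔n (N₁ ⊔ N₂) (N₃ ⊔ N₄))
        i₂ = ℕ.≤-trans (ℕ.m≤n⊔m N₁ N₂) (ℕ.m≤m⊔n (N₁ ⊔ N₂) (N₃ ⊔ N₄))
        i₃ = ℕ.≤-trans (ℕ.m≤m⊔n N₃ N₄) (ℕ.m≤n⊔m (N₁ ⊔ N₂) (N₃ ⊔ N₄))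
        i₄ = ℕ.≤-trans (ℕ.m≤n⊔m N₃ N₄) (ℕ.m≤n⊔m (N₁ ⊔ N₂) (N₃ ⊔ N₄))
    in N , λ m n m≥ n≥ →
      lin (ℚ.≤-trans (ℚ.∣p+q∣≤∣p∣+∣q∣ (seq x m *ℚ (seq y m -ℚ seq y n)) (seq y n *ℚ (seq x m -ℚ seq x n)))
            (ℚ.+-mono-≤
              (mul {seq x m} 0<A (xA m (ℕ.≤-trans i₁ m≥)) (q m n (ℕ.≤-trans i₄ m≥) (ℕ.≤-trans i₄ n≥)))
              (mul {seq y n} 0<B (yB n (ℕ.≤-trans i₂ n≥)) (p m n (ℕ.≤-trans i₃ m≥) (ℕ.≤-trans i₃ n≥)))))
          (cong ∣_∣ (split (seq x m) (seq x n) (seq y m) (seq y n)))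
          (trans (sym (ℚ.*-distribʳ-+ δ A B)) eq)

record UnitInterval : Set where
  constructor unit
  field
    value : ℝ
    0≤    : fromℚ 0ℚ ≤ value
    ≤1    : value ≤ fromℚ 1ℚ

open UnitInterval using (value; 0≤; ≤1)

2⁻_ : ℕ → ℚ
2⁻ zero  = 1ℚ
2⁻ suc n = ½ *ℚ 2⁻ n

-- The n-th entry of a name is a dyadic approximation p(n)/2ⁿ up to 2⁻ⁿ.
dyadic : ℕ → ℕ → ℚ
dyadic m n = fromℤ (+ m) *ℚ 2⁻ n

IntervalName : Baire → ℝ → Set
IntervalName p x = ∀ n →
  fromℚ (dyadic (p n) n -ℚ 2⁻ n) ≤ x × x ≤ fromℚ (dyadic (p n) n +ℚ 2⁻ n)

private
  0<2⁻ : ∀ n → 0ℚ <ℚ 2⁻ n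
  0<2⁻ zero    = ℚ.positive⁻¹ 1ℚ
  0<2⁻ (suc n) = 0<half (0<2⁻ n)

  2⁻≤1 : ∀ n → 2⁻ n ≤ℚ 1ℚ
  2⁻≤1 zero    = ℚ.≤-refl
  2⁻≤1 (suc n) = ℚ.≤-trans (ℚ.*-monoˡ-≤-nonNeg ½ (2⁻≤1 n))
    (ℚ.<⇒≤ (ℚ.*<* (ℤ.+<+ (ℕ.s≤s (ℕ.s≤s ℕ.z≤n)))))

  fromℤ-suc : ∀ m → fromℤ (+ suc m) ≡ fromℤ (+ m) +ℚ 1ℚ
  fromℤ-suc m = ℚ.toℚᵘ-injective (ℚᵘ.≃-trans
    (ℚᵘ.*≡* (cong (ℤ._* + 1) (sym (trans (cong (ℤ._+ + 1) (ℤ.*-identityʳ (+ m)))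
                                          (cong +_ (ℕ.+-comm m 1))))))
    (ℚᵘ.≃-sym (ℚ.toℚᵘ-homo-+ (fromℤ (+ m)) 1ℚ)))

  dyadic≤1 : ∀ n → dyadic n n ≤ℚ 1ℚ
  dyadic≤1 zero    = lin (ℚ.<⇒≤ (ℚ.positive⁻¹ 1ℚ)) (sym (ℚ.*-zeroˡ 1ℚ)) refl
  dyadic≤1 (suc n) = lin
    (ℚ.+-mono-≤ (ℚ.*-monoˡ-≤-nonNeg ½ (dyadic≤1 n)) (ℚ.*-monoˡ-≤-nonNeg ½ (2⁻≤1 n)))
    (trans (expand (fromℤ (+ n)) (2⁻ n)) (cong (_*ℚ 2⁻ suc n) (sym (fromℤ-suc n))))
    refl
    where
    expand : ∀ a h → ½ *ℚ (a *ℚ h) +ℚ ½ *ℚ h ≡ (a +ℚ 1ℚ) *ℚ (½ *ℚ h)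
    expand = S.solve 2 (λ a h → con ½ :* (a :* h) :+ con ½ :* h := (a :+ con 1ℚ) :* (con ½ :* h)) refl

  below-ℕ : ∀ r → ∃[ n ] r ≤ℚ fromℤ (+ n)
  below-ℕ r@(ℚ.mkℚ (+ a) d _) = a , ℚ.*≤* (ℤ.*-monoˡ-≤-nonNeg (+ a) (ℤ.+≤+ (ℕ.s≤s ℕ.z≤n)))
  below-ℕ r@(ℚ.mkℚ (ℤ.-[1+ a ]) d _) = 0 , ℚ.*≤* ℤ.-≤+

  2⁻-small : ∀ ε → 0ℚ <ℚ ε → ∃[ n ] 2⁻ n ≤ℚ ε
  2⁻-small ε 0<ε =
    let (r , _ , εr≡1) = divide ε 1ℚ 0<ε (ℚ.positive⁻¹ 1ℚ)
        (n , r≤n) = below-ℕ r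
        ε≥0 = nonNegative (ℚ.<⇒≤ 0<ε)
        h≥0 = nonNegative (ℚ.<⇒≤ (0<2⁻ n))
    in n , ℚ.≤-trans
      (lin (ℚ.*-monoˡ-≤-nonNeg ε {{ε≥0}} (ℚ.*-monoʳ-≤-nonNeg (2⁻ n) {{h≥0}} r≤n))
        (trans (sym (ℚ.*-assoc ε r (2⁻ n))) (trans (cong (_*ℚ 2⁻ n) εr≡1) (ℚ.*-identityˡ _))) refl)
      (lin (ℚ.*-monoˡ-≤-nonNeg ε {{ε≥0}} (dyadic≤1 n)) refl (ℚ.*-identityʳ ε))

  name-≤ : ∀ {p x y} → IntervalName p x → IntervalName p y → x ≤ y
  name-≤ {p} {x} {y} px py ε 0<ε =
    let (k , h≤) = 2⁻-small _ (0<half (0<half 0<ε))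
        e = ½ *ℚ (½ *ℚ ε)
    in Ev-zip (λ {i} → step (dyadic (p k) k) (2⁻ k) {seq x i} {seq y i} h≤)
        (proj₂ (px k) e (0<half (0<half 0<ε))) (proj₁ (py k) e (0<half (0<half 0<ε)))
    where
    shift : ∀ d h e → (d -ℚ h) +ℚ ((h +ℚ h) +ℚ e) ≡ (d +ℚ h) +ℚ e
    shift = S.solve 3 (λ d h e → (d :- h) :+ ((h :+ h) :+ e) := (d :+ h) :+ e) refl
    total : ∀ a ε → let e = ½ *ℚ (½ *ℚ ε) in (a +ℚ e) +ℚ ((e +ℚ e) +ℚ e) ≡ a +ℚ ε
    total = S.solve 2 (λ a ε → let e = con ½ :* (con ½ :* ε) in
      (a :+ e) :+ ((e :+ e) :+ e) := a :+ ε) refl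
    step : ∀ d h {a b} → let e = ½ *ℚ (½ *ℚ ε) in h ≤ℚ e →
           a ≤ℚ (d +ℚ h) +ℚ e → d -ℚ h ≤ℚ b +ℚ e → a ≤ℚ b +ℚ ε
    step d h {a} {b} h≤e a≤ ≤b = ℚ.≤-trans a≤ (lin
      (ℚ.+-mono-≤ ≤b (ℚ.+-monoˡ-≤ (½ *ℚ (½ *ℚ ε)) (ℚ.+-mono-≤ h≤e h≤e)))
      (shift d h _) (total b ε))

  nearest : ∀ h y k → y ≤ℚ fromℤ (+ k) *ℚ h +ℚ ½ *ℚ h → -ℚ (½ *ℚ h) ≤ℚ y →
            ∃[ m ] (fromℤ (+ m) *ℚ h -ℚ ½ *ℚ h ≤ℚ y × y ≤ℚ fromℤ (+ m) *ℚ h +ℚ ½ *ℚ h)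
  nearest h y zero    hi lo = 0 ,
    lin lo (trans (sym (ℚ.+-identityˡ _)) (cong (_+ℚ -ℚ (½ *ℚ h)) (sym (ℚ.*-zeroˡ h)))) refl , hi
  nearest h y (suc k) hi lo with y ℚ.≤? fromℤ (+ k) *ℚ h +ℚ ½ *ℚ h
  ... | yes p = nearest h y k p lo
  ... | no ¬p = suc k ,
    lin (ℚ.<⇒≤ (ℚ.≰⇒> ¬p))
      (trans (step (fromℤ (+ k)) h) (cong (λ z → z *ℚ h -ℚ ½ *ℚ h) (sym (fromℤ-suc k)))) refl ,
    hi
    where
    step : ∀ a h → a *ℚ h +ℚ ½ *ℚ h ≡ (a +ℚ 1ℚ) *ℚ h -ℚ ½ *ℚ h
    step = S.solve 2 (λ a h → a :* h :+ con ½ :* h := (a :+ con 1ℚ) :* h :- con ½ :* h) refl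

  one : ∀ n → ∃[ k ] fromℤ (+ k) *ℚ 2⁻ n ≡ 1ℚ
  one zero    = 1 , refl
  one (suc n) =
    let (k , eq) = one n
    in k ℕ.+ k , trans (cong (_*ℚ (½ *ℚ 2⁻ n)) (dbl k k))
         (trans (halve (fromℤ (+ k)) (2⁻ n)) eq)
    where
    dbl : ∀ k j → fromℤ (+ (k ℕ.+ j)) ≡ fromℤ (+ k) +ℚ fromℤ (+ j)
    dbl zero    j = sym (ℚ.+-identityˡ _)
    dbl (suc k) j = trans (fromℤ-suc (k ℕ.+ j)) (trans (cong (_+ℚ 1ℚ) (dbl k j))
      (trans (comm (fromℤ (+ k)) (fromℤ (+ j))) (cong (_+ℚ fromℤ (+ j)) (sym (fromℤ-suc k)))))
      where
      comm : ∀ a b → (a +ℚ b) +ℚ 1ℚ ≡ (a +ℚ 1ℚ) +ℚ b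
      comm = S.solve 2 (λ a b → (a :+ b) :+ con 1ℚ := (a :+ con 1ℚ) :+ b) refl
    halve : ∀ a h → (a +ℚ a) *ℚ (½ *ℚ h) ≡ a *ℚ h
    halve = S.solve 2 (λ a h → (a :+ a) :* (con ½ :* h) := a :* h) refl

  abs-≤ : ∀ {a b e} → ∣ a -ℚ b ∣ ≤ℚ e → a ≤ℚ b +ℚ e × b -ℚ e ≤ℚ a
  abs-≤ {a} {b} {e} h =
    lin (ℚ.+-monoʳ-≤ b (ℚ.≤-trans (self (a -ℚ b)) h)) (back b a) refl ,
    lin (ℚ.+-monoʳ-≤ b (ℚ.≤-trans (ℚ.neg-antimono-≤ h) (low (a -ℚ b)))) refl (back b a)
    where
    back : ∀ b a → b +ℚ (a -ℚ b) ≡ a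
    back = S.solve 2 (λ b a → b :+ (a :- b) := a) refl
    self : ∀ c → c ≤ℚ ∣ c ∣
    self c with ℚ.∣p∣≡p∨∣p∣≡-p c
    ... | inj₁ eq = ℚ.≤-reflexive (sym eq)
    ... | inj₂ eq with ℚ.≤-total 0ℚ c
    ...   | inj₁ 0≤c = ℚ.≤-reflexive (sym (ℚ.0≤p⇒∣p∣≡p 0≤c))
    ...   | inj₂ c≤0 = ℚ.≤-trans c≤0 (ℚ.0≤∣p∣ c)
    low : ∀ c → -ℚ ∣ c ∣ ≤ℚ c
    low c = lin (ℚ.neg-antimono-≤ (self (-ℚ c)))
      (cong -ℚ_ (ℚ.∣-p∣≡∣p∣ c)) (negneg c)
      where
      negneg : ∀ c → -ℚ (-ℚ c) ≡ c
      negneg = S.solve 1 (λ c → :- (:- c) := c) refl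

  approximate : ∀ x → fromℚ 0ℚ ≤ x → x ≤ fromℚ 1ℚ → ∀ n →
    ∃[ m ] (fromℚ (dyadic m n -ℚ 2⁻ n) ≤ x × x ≤ fromℚ (dyadic m n +ℚ 2⁻ n))
  approximate x 0≤x x≤1 n = m ,
    (λ ε 0<ε → N , λ i N≤i → lower ε 0<ε (proj₂ (near i N≤i))) ,
    (λ ε 0<ε → N , λ i N≤i → upper ε 0<ε (proj₁ (near i N≤i)))
    where
    h = 2⁻ n
    e = ½ *ℚ (½ *ℚ h)
    0<e = 0<half (0<half (0<2⁻ n))
    N = proj₁ (cauchy x e 0<e)
    y = seq x N
    near : ∀ i → N ℕ.≤ i → seq x i ≤ℚ y +ℚ e × y -ℚ e ≤ℚ seq x i
    near i N≤i = abs-≤ (proj₂ (cauchy x e 0<e) i N N≤i ℕ.≤-refl)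
    k = proj₁ (one n)
    y≤1 : y ≤ℚ fromℤ (+ k) *ℚ h +ℚ ½ *ℚ h
    y≤1 =
      let (M , p) = x≤1 e 0<e
          i = N ⊔ M
          a = p i (ℕ.m≤n⊔m N M)
          b = proj₂ (near i (ℕ.m≤m⊔n N M))
      in lin (ℚ.+-monoˡ-≤ e (ℚ.≤-trans b a)) (c₁ y e)
             (trans (c₂ 1ℚ h) (cong (_+ℚ ½ *ℚ h) (sym (proj₂ (one n)))))
      where
      c₁ : ∀ y e → (y -ℚ e) +ℚ e ≡ y
      c₁ = S.solve 2 (λ y e → (y :- e) :+ e := y) refl
      c₂ : ∀ a h → let e = ½ *ℚ (½ *ℚ h) in (a +ℚ e) +ℚ e ≡ a +ℚ ½ *ℚ h
      c₂ = S.solve 2 (λ a h → let e = con ½ :* (con ½ :* h) in (a :+ e) :+ e := a :+ con ½ :* h) refl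
    0≤y : -ℚ (½ *ℚ h) ≤ℚ y
    0≤y =
      let (M , p) = 0≤x e 0<e
          i = N ⊔ M
          a = p i (ℕ.m≤n⊔m N M)
          b = proj₁ (near i (ℕ.m≤m⊔n N M))
      in lin (ℚ.+-monoˡ-≤ (-ℚ (½ *ℚ h)) (ℚ.≤-trans a (ℚ.+-monoˡ-≤ e b)))
             (ℚ.+-identityˡ _) (c y h)
      where
      c : ∀ y h → let e = ½ *ℚ (½ *ℚ h) in ((y +ℚ e) +ℚ e) +ℚ -ℚ (½ *ℚ h) ≡ y
      c = S.solve 2 (λ y h → let e = con ½ :* (con ½ :* h) in
        ((y :+ e) :+ e) :+ (:- (con ½ :* h)) := y) refl
    found = nearest h y k y≤1 0≤y
    m = proj₁ found
    d = dyadic m n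
    slack : ∀ ε → 0ℚ <ℚ ε → e ≤ℚ ½ *ℚ h +ℚ ε
    slack ε 0<ε = lin (ℚ.+-mono-≤ (ℚ.≤-refl {e}) (ℚ.+-mono-≤ (ℚ.<⇒≤ 0<e) (ℚ.<⇒≤ 0<ε)))
      (trans (cong (e +ℚ_) (ℚ.+-identityˡ 0ℚ)) (ℚ.+-identityʳ e))
      (trans (sym (ℚ.+-assoc e e ε)) (cong (_+ℚ ε) (half+half (½ *ℚ h))))
    lower : ∀ ε → 0ℚ <ℚ ε → ∀ {a} → y -ℚ e ≤ℚ a → d -ℚ h ≤ℚ a +ℚ ε
    lower ε 0<ε {a} y≤a = lin
      (ℚ.+-mono-≤ (ℚ.≤-trans (ℚ.+-monoˡ-≤ (-ℚ e) (proj₁ (proj₂ found))) y≤a)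
                  (ℚ.+-monoˡ-≤ (-ℚ (½ *ℚ h)) (slack ε 0<ε)))
      (c₁ d h e) (c₂ a (½ *ℚ h) ε)
      where
      c₁ : ∀ d h e → ((d -ℚ ½ *ℚ h) -ℚ e) +ℚ (e +ℚ -ℚ (½ *ℚ h)) ≡ d -ℚ h
      c₁ = S.solve 3 (λ d h e → ((d :- con ½ :* h) :- e) :+ (e :+ (:- (con ½ :* h))) := d :- h) refl
      c₂ : ∀ a b ε → a +ℚ ((b +ℚ ε) +ℚ -ℚ b) ≡ a +ℚ ε
      c₂ = S.solve 3 (λ a b ε → a :+ ((b :+ ε) :+ (:- b)) := a :+ ε) refl
    upper : ∀ ε → 0ℚ <ℚ ε → ∀ {a} → a ≤ℚ y +ℚ e → a ≤ℚ (d +ℚ h) +ℚ ε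
    upper ε 0<ε {a} a≤y = ℚ.≤-trans a≤y (lin
      (ℚ.+-mono-≤ (proj₂ (proj₂ found)) (slack ε 0<ε)) refl (c d h ε))
      where
      c : ∀ d h ε → (d +ℚ ½ *ℚ h) +ℚ (½ *ℚ h +ℚ ε) ≡ (d +ℚ h) +ℚ ε
      c = S.solve 3 (λ d h ε → (d :+ con ½ :* h) :+ (con ½ :* h :+ ε) := (d :+ h) :+ ε) refl

𝕀 : RepresentedSpace
𝕀 = record
  { Carrier       = UnitInterval
  ; _≈_           = λ x y → value x ≃ value y
  ; isEquivalence = record
      { refl  = λ {x} → ≃.refl {value x}
      ; sym   = λ {x} {y} → ≃.sym {value x} {value y}
      ; trans = λ {x} {y} {z} → ≃.trans {value x} {value y} {value z}
      }
  ; _names_       = λ p x → IntervalName p (value x)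
  ; names-resp    = λ {p} {p′} {x} {y} p≗ (x≤y , y≤x) px n →
      subst (λ m → fromℚ (dyadic m n -ℚ 2⁻ n) ≤ value y × value y ≤ fromℚ (dyadic m n +ℚ 2⁻ n)) (p≗ n)
        ( ≤-trans {fromℚ (dyadic (p n) n -ℚ 2⁻ n)} {value x} {value y} (proj₁ (px n)) x≤y
        , ≤-trans {value y} {value x} {fromℚ (dyadic (p n) n +ℚ 2⁻ n)} y≤x (proj₂ (px n)) )
  ; names-unique  = λ {p} {x} {y} px py →
      name-≤ {p} {value x} {value y} px py , name-≤ {p} {value y} {value x} py px
  ; surjective    = λ x →
      (λ n → proj₁ (approximate (value x) (0≤ x) (≤1 x) n)) ,
      (λ n → proj₂ (approximate (value x) (0≤ x) (≤1 x) n))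
  }
  where module ≃ = IsEquivalence ≃-isEquivalence

Cube : ℕ → RepresentedSpace
Cube n = 𝕀 ^ʳ n

coord : ∀ {n} → Carrier (Cube n) → Fin n → ℝ
coord {1}           x       zero    = value x
coord {suc (suc n)} (x , _) zero    = value x
coord {suc (suc n)} (_ , x) (suc i) = coord {suc n} x i

Convex : ∀ {n} → Carrier (𝒜 (Cube n)) → Set
Convex {n} A = ∀ (x y z : Carrier (Cube n)) (s t : ℝ) →
  fromℚ 0ℚ ≤ s → fromℚ 0ℚ ≤ t → s + t ≃ fromℚ 1ℚ →
  (∀ i → coord {n} z i ≃ s * coord {n} x i + t * coord {n} y i) →
  x ∈[ A ] → y ∈[ A ] → z ∈[ A ]
  where
  _∈[_] : Carrier (Cube n) → Carrier (𝒜 (Cube n)) → Set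
  x ∈[ A ] = _∈_ {Cube n} x A

InTriangle : (a b c x : Carrier (Cube 2)) → Set
InTriangle a b c x = ∃[ r ] ∃[ s ] ∃[ t ]
  (fromℚ 0ℚ ≤ r × fromℚ 0ℚ ≤ s × fromℚ 0ℚ ≤ t × r + s + t ≃ fromℚ 1ℚ ×
   (∀ i → coord {2} x i ≃ r * coord {2} a i + s * coord {2} b i + t * coord {2} c i))

-- The vertices may coincide or be collinear.
𝔗 : Carrier (𝒜 (Cube 2)) → Set
𝔗 A = ∃[ a ] ∃[ b ] ∃[ c ] (∀ x → _∈_ {Cube 2} x A ⇔ InTriangle a b c x)

XC : ∀ n → 𝒜 (Cube n) ⇉ Cube n
XC n = restrict (C (Cube n)) (Convex {n}) λ A≈B cvx x y z s t 0≤s 0≤t s+t≃1 z≃ x∈B y∈B →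
  trans (sym (A≈B z)) (cvx x y z s t 0≤s 0≤t s+t≃1 z≃ (trans (A≈B x) x∈B) (trans (A≈B y) y∈B))

XC₂∣𝔗 : 𝒜 (Cube 2) ⇉ Cube 2
XC₂∣𝔗 = restrict (XC 2) 𝔗 λ A≈B (a , b , c , A⇔) → a , b , c , λ x → mk⇔
  (λ x∈B → Equivalence.to (A⇔ x) (trans (A≈B x) x∈B))
  (λ x∈T → trans (sym (A≈B x)) (Equivalence.from (A⇔ x) x∈T))

{-# OPTIONS --safe #-}

-- The realizer H turns names of a triangle T into a rectangle R, and K turns
-- names of points of R into points of T; both see finite prefixes only, so
-- T may be shrunk after any prefix, and R then stays close to or inside the
-- old R.
--
-- T is chosen generic among the members T_y of a nested family: for y′ > y,
-- close to y, all long prefixes of the name of T_y can be continued towards any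
-- triangle between T_y′ and T_y without R losing a given rational point of
-- its factors, unless already R(T_y) has lost it.
--
-- Between T_y′ and T_y there is a chain of six triangles, T = C₀ ⊃ … ⊃ C₅,
-- each obtained by moving one vertex a little towards another one, and there
-- are boundary points x₀ , … , x₄ of T with xⱼ ∈ Cⱼ and xⱼ ∉ Cⱼ₊₁ however
-- small the moves are.  Shrinking to Cⱼ and then to {xⱼ} shows, by
-- compactness, that K maps some z ∈ R to xⱼ and that z is off the sides of R
-- that have been moved on the way to Cⱼ.  Shrinking to Cⱼ₊₁ instead excludes
-- a neighbourhood of z from R.  By genericity and convexity this is possible
-- only by moving a side on which z lies, hence a new one; but R has only
-- four sides.
module Submission where

open import Algebra.Bundles using (CommutativeRing)
import Algebra.Solver.Ring as RingSolver
import Algebra.Solver.Ring.AlmostCommutativeRing as ACR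
open import Axiom.ExcludedMiddle using (ExcludedMiddle)
open import Data.Bool.Base using (Bool; false; true)
open import Data.Fin.Base using (Fin; suc; zero)
import Data.Fin.Base as Fin
import Data.Fin.Properties as Fin
open import Data.Integer.Base as ℤ using (+_; -[1+_])
import Data.Integer.Properties as ℤ
open import Data.List.Base using (List; []; _∷_; applyUpTo; length; lookup; map)
import Data.List.Properties as List
open import Data.List.Relation.Unary.All as All using (All; []; _∷_)
open import Data.List.Relation.Unary.AllPairs using ([]; _∷_)
open import Data.List.Relation.Unary.Unique.Propositional using (Unique)
open import Data.Maybe.Base using (just; nothing)
open import Data.Nat.Base as ℕ using (_⊔_; suc; zero; ℕ)
import Data.Nat.DivMod as ℕ
import Data.Nat.Properties as ℕ
open import Data.Product.Base using (_,_; _×_; proj₁; proj₂; Σ-syntax; ∃-syntax)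
open import Data.Rational.Base as ℚ using (0ℚ; 1/_; 1ℚ; nonNegative; positive; ½; ℚ; ∣_∣)
  renaming (-_ to -ℚ_; _*_ to _*ℚ_; _+_ to _+ℚ_; _-_ to _-ℚ_; _<_ to _<ℚ_; _≤_ to _≤ℚ_)
open import Data.Rational.Literals using (fromℤ)
import Data.Rational.Properties as ℚ
import Data.Rational.Solver as ℚS
import Data.Rational.Unnormalised.Base as ℚᵘ
import Data.Rational.Unnormalised.Properties as ℚᵘ
open import Data.Sum.Base using ([_,_]′; _⊎_; inj₁; inj₂)
open import Data.Unit.Base using (tt; ⊤)
open import Data.Vec.Base as Vec using (Vec; []; _∷_)
open import Data.Vec.N-ary using (N-ary; _$ⁿ_)
open import Data.Vec.Relation.Binary.Pointwise.Inductive using (Pointwise; []; _∷_)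
open import Function.Base using (_∘_; const)
open import Function.Bundles using (Equivalence; _⇔_; mk⇔)
open import Level using (0ℓ)
open import Relation.Binary.Definitions using (WeaklyDecidable; tri<; tri>; tri≈)
open import Relation.Binary.PropositionalEquality
  using (_≗_; _≡_; _≢_; cong; cong₂; refl; subst; subst₂; sym; trans)
open import Relation.Nullary.Decidable.Core using (Dec; no; toWitness; yes)
open import Relation.Nullary.Negation using (contradiction; ¬_)
open import Defs
open PartialFunction using (_↦_; ↦-resp; functional)
open RepresentedSpace using (Carrier)
open UnitInterval
open ℝ

-- Continuity of oracle computations

-- Without genericity `H` could answer every shrinking of the triangle by giving up inner parts of
-- the rectangle, and counting sides would prove nothing. As in a Baire category argument, it is
-- decided in turn for each rational point of each factor whether some continuation that still
-- contains a slightly smaller triangle loses the point. If so, such a continuation is adopted; if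
-- not, the limit triangle is kept strictly larger than the smaller one, so that the point is safe
-- near the limit. The order of choices shapes the rest. How small the moves must be depends on how
-- near the limit the points beside `z` are safe, hence on `z`, so `z` has to be found before the
-- size of the moves. Therefore the boundary points are those of the generic triangle itself, and
-- the loss of sides is asserted for infinitely many sizes, the pigeonhole principle selecting one
-- side for infinitely many of them. Moreover a lost side comes with a rational cut that does not
-- depend on how late the shrinking begins: only this keeps the limit point `z` strictly off that
-- side.

Agree : ∀ {a} {A : Set a} → ℕ → (ℕ → A) → (ℕ → A) → Set a
Agree N p q = ∀ i → i ℕ.< N → p i ≡ q i

module _ {a} {A : Set a} where

  agree-refl : ∀ {N} {p : ℕ → A} → Agree N p p
  agree-refl _ _ = refl

  agree-sym : ∀ {N} {p q : ℕ → A} → Agree N p q → Agree N q p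
  agree-sym e i i<N = sym (e i i<N)

  agree-trans : ∀ {N} {p q r : ℕ → A} → Agree N p q → Agree N q r → Agree N p r
  agree-trans e f i i<N = trans (e i i<N) (f i i<N)

  agree-≤ : ∀ {M N} {p q : ℕ → A} → M ℕ.≤ N → Agree N p q → Agree M p q
  agree-≤ M≤N e i i<M = e i (ℕ.<-≤-trans i<M M≤N)

  agree-≗ : ∀ {N} {p q : ℕ → A} → p ≗ q → Agree N p q
  agree-≗ e i _ = e i

agree-⟨⟩ : ∀ {N p p′ q q′} → Agree N p p′ → Agree N q q′ → Agree N ⟨ p , q ⟩ ⟨ p′ , q′ ⟩
agree-⟨⟩ e f zero    0<N = e 0 0<N
agree-⟨⟩ {suc N} {p} {p′} {q} {q′} e f (suc i) (ℕ.s≤s i<N) =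
  agree-⟨⟩ {N} {q} {q′} {p ∘ suc} {p′ ∘ suc}
    (λ j j<N → f j (ℕ.<-trans j<N (ℕ.n<1+n N))) (λ j j<N → e (suc j) (ℕ.s≤s j<N)) i i<N

agree-⟨⟩⁻ : ∀ {N p p′ q q′} → Agree (N ℕ.+ N) ⟨ p , q ⟩ ⟨ p′ , q′ ⟩ → Agree N p p′ × Agree N q q′
agree-⟨⟩⁻ {N} {p} {p′} {q} {q′} e =
  (λ i i<N → trans (sym (⟨,⟩-even p q i)) (trans (e _ (ℕ.+-mono-< i<N i<N)) (⟨,⟩-even p′ q′ i))) ,
  (λ i i<N → trans (sym (⟨,⟩-odd p q i)) (trans (e _ (odd i<N)) (⟨,⟩-odd p′ q′ i)))
  where
  odd : ∀ {i} → i ℕ.< N → suc (i ℕ.+ i) ℕ.< N ℕ.+ N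
  odd {i} i<N = ℕ.≤-trans (ℕ.s≤s (ℕ.≤-reflexive (sym (ℕ.+-suc i i)))) (ℕ.+-mono-≤ i<N i<N)

uniform : ∀ {P : ℕ → ℕ → Set} → (∀ {i M N} → M ℕ.≤ N → P i M → P i N) →
          ∀ y → (∀ i → i ℕ.< y → ∃[ N ] P i N) → ∃[ N ] (∀ i → i ℕ.< y → P i N)
uniform mono zero    f = 0 , λ _ ()
uniform {P} mono (suc y) f =
  let (N , g) = uniform {P} mono y (λ i i<y → f i (ℕ.<-trans i<y (ℕ.n<1+n y)))
      (M , h) = f y (ℕ.n<1+n y)
  in N ⊔ M , λ i i<1+y → [ (λ i<y → mono (ℕ.m≤m⊔n N M) (g i i<y))
                         , (λ { refl → mono (ℕ.m≤n⊔m N M) h }) ]′ (ℕ.m≤n⇒m<n∨m≡n (ℕ.s≤s⁻¹ i<1+y))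

mutual
  -- A derivation is a finite tree up to the finitely many searches below `y` in `min`, so it
  -- consults finitely many oracle entries, and `N` exceeds all of them.
  eval-continuous : ∀ {p k} {c : Code k} {xs y} → Eval p c xs y →
                    ∃[ N ] (∀ p′ → Agree N p p′ → Eval p′ c xs y)
  eval-continuous zero     = 0 , λ _ _ → zero
  eval-continuous suc      = 0 , λ _ _ → suc
  eval-continuous {p} (oracle {x}) = suc x , λ p′ e →
    subst (Eval p′ oracleᶜ (x ∷ [])) (sym (e x (ℕ.n<1+n x))) oracle
  eval-continuous (proj i) = 0 , λ _ _ → proj i
  eval-continuous (comp es e) =
    let (N , f) = evals-continuous es
        (M , g) = eval-continuous e
    in N ⊔ M , λ p′ a → comp (f p′ (agree-≤ (ℕ.m≤m⊔n N M) a)) (g p′ (agree-≤ (ℕ.m≤n⊔m N M) a))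
  eval-continuous (rec-0 e) =
    let (N , f) = eval-continuous e in N , λ p′ a → rec-0 (f p′ a)
  eval-continuous (rec-s d e) =
    let (N , f) = eval-continuous d
        (M , g) = eval-continuous e
    in N ⊔ M , λ p′ a → rec-s (f p′ (agree-≤ (ℕ.m≤m⊔n N M) a)) (g p′ (agree-≤ (ℕ.m≤n⊔m N M) a))
  eval-continuous {p} {xs = xs} (min {c = c} {y = y} before e) =
    let (N , f) = eval-continuous e
        (M , g) = below y before
    in N ⊔ M , λ p′ a → min (λ i i<y → g i i<y p′ (agree-≤ (ℕ.m≤n⊔m N M) a))
                            (f p′ (agree-≤ (ℕ.m≤m⊔n N M) a))
    where
    below : ∀ n → (∀ i → i ℕ.< n → ∃[ v ] Eval p c (i ∷ xs) (suc v)) →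
            ∃[ M ] (∀ i → i ℕ.< n → ∀ p′ → Agree M p p′ → ∃[ v ] Eval p′ c (i ∷ xs) (suc v))
    below zero    h = 0 , λ _ ()
    below (suc n) h =
      let (N , g) = below n (λ i i<n → h i (ℕ.<-trans i<n (ℕ.n<1+n n)))
          (M , k) = eval-continuous (proj₂ (h n (ℕ.n<1+n n)))
      in N ⊔ M , λ i i<1+n p′ a →
        [ (λ i<n → g i i<n p′ (agree-≤ (ℕ.m≤m⊔n N M) a))
        , (λ { refl → _ , k p′ (agree-≤ (ℕ.m≤n⊔m N M) a) }) ]′ (ℕ.m≤n⇒m<n∨m≡n (ℕ.s≤s⁻¹ i<1+n))

  evals-continuous : ∀ {p k m} {cs : Vec (Code k) m} {xs ys} →
                     Pointwise (λ d y → Eval p d xs y) cs ys →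
                     ∃[ N ] (∀ p′ → Agree N p p′ → Pointwise (λ d y → Eval p′ d xs y) cs ys)
  evals-continuous []       = 0 , λ _ _ → []
  evals-continuous (e ∷ es) =
    let (N , f) = eval-continuous e
        (M , g) = evals-continuous es
    in N ⊔ M , λ p′ a → f p′ (agree-≤ (ℕ.m≤m⊔n N M) a) ∷ g p′ (agree-≤ (ℕ.m≤n⊔m N M) a)

mutual
  eval-deterministic : ∀ {p k} {c : Code k} {xs y z} → Eval p c xs y → Eval p c xs z → y ≡ z
  eval-deterministic zero     zero     = refl
  eval-deterministic suc      suc      = refl
  eval-deterministic oracle   oracle   = refl
  eval-deterministic (proj i) (proj .i) = refl
  eval-deterministic (comp ds d) (comp es e) with evals-deterministic ds es
  ... | refl = eval-deterministic d e
  eval-deterministic (rec-0 d) (rec-0 e) = eval-deterministic d e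
  eval-deterministic (rec-s d d′) (rec-s e e′) with eval-deterministic d e
  ... | refl = eval-deterministic d′ e′
  eval-deterministic (min {y = y} b d) (min {y = z} c e) with ℕ.<-cmp y z
  ... | tri≈ _ y≡z _ = y≡z
  ... | tri< y<z _ _ = contradiction (eval-deterministic d (proj₂ (c y y<z))) λ ()
  ... | tri> _ _ z<y = contradiction (eval-deterministic e (proj₂ (b z z<y))) λ ()

  evals-deterministic : ∀ {p k m} {cs : Vec (Code k) m} {xs ys zs} →
                        Pointwise (λ d y → Eval p d xs y) cs ys →
                        Pointwise (λ d y → Eval p d xs y) cs zs → ys ≡ zs
  evals-deterministic []       []       = refl
  evals-deterministic (d ∷ ds) (e ∷ es) =
    cong₂ _∷_ (eval-deterministic d e) (evals-deterministic ds es)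

-- The program is only known to compute `F` on its domain, so `p′` is required to have a value as
-- well; determinism of `Eval` identifies the output transported from `p` with that value.
computable-continuous : ∀ {F p q} → Computable F → PartialFunction._↦_ F p q → ∀ m →
  ∃[ N ] (∀ p′ q′ → Agree N p p′ → PartialFunction._↦_ F p′ q′ → Agree m q q′)
computable-continuous {F} {p} {q} (c , run) Fpq m =
  let (N , f) = uniform {λ n N → ∀ p′ → Agree N p p′ → Eval p′ c (n ∷ []) (q n)}
                  (λ M≤N f p′ a → f p′ (agree-≤ M≤N a)) m (λ n _ → eval-continuous (run p q Fpq n))
  in N , λ p′ q′ a Fpq′ n n<m → eval-deterministic (f n n<m p′ a) (run p′ q′ Fpq′ n)

-- Infinitely recurring events and compactness

Often : (ℕ → Set) → Set
Often P = ∀ N → ∃[ n ] (N ℕ.≤ n × P n)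

often-map : ∀ {P Q : ℕ → Set} → (∀ n → P n → Q n) → Often P → Often Q
often-map f o N = let (n , N≤n , p) = o N in n , N≤n , f n p

often-≥ : ∀ {P : ℕ → Set} M → Often P → Often (λ n → M ℕ.≤ n × P n)
often-≥ M o N =
  let (n , N⊔M≤n , p) = o (N ⊔ M)
  in n , ℕ.≤-trans (ℕ.m≤m⊔n N M) N⊔M≤n , ℕ.≤-trans (ℕ.m≤n⊔m N M) N⊔M≤n , p

module Classical (em : ExcludedMiddle 0ℓ) where

  by-contradiction : {P : Set} → ¬ ¬ P → P
  by-contradiction {P} ¬¬p with em {P}
  ... | yes p = p
  ... | no ¬p = contradiction ¬p ¬¬p

  ¬∀⇒∃¬ : {A : Set} {P : A → Set} → ¬ (∀ x → P x) → ∃[ x ] ¬ P x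
  ¬∀⇒∃¬ ¬∀ = by-contradiction λ ¬∃ → ¬∀ λ x → by-contradiction λ ¬p → ¬∃ (x , ¬p)

  ¬often : {P : ℕ → Set} → ¬ Often P → ∃[ N ] (∀ n → N ℕ.≤ n → ¬ P n)
  ¬often ¬o = let (N , h) = ¬∀⇒∃¬ ¬o in N , λ n N≤n p → h (n , N≤n , p)

  -- The infinite pigeonhole principle: if `P` stops at some `M`, all later occurrences are due to
  -- `Q`.
  often-⊎ : {P Q : ℕ → Set} → Often (λ n → P n ⊎ Q n) → Often P ⊎ Often Q
  often-⊎ {P} {Q} o with em {Often P}
  ... | yes oP = inj₁ oP
  ... | no ¬oP = inj₂ λ N →
    let (M , h) = ¬often ¬oP
        (n , N≤n , M≤n , pq) = often-≥ M o N
    in n , N≤n , [ (λ p → contradiction p (h n M≤n)) , (λ q → q) ]′ pq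

  often-≤ : {P : ℕ → ℕ → Set} → ∀ b → Often (λ n → ∃[ v ] (v ℕ.≤ b × P v n)) →
            ∃[ v ] Often (P v)
  often-≤ {P} zero    o = 0 , often-map (λ { n (.0 , ℕ.z≤n , p) → p }) o
  often-≤ {P} (suc b) o with often-⊎ (often-map split o)
    where
    split : ∀ n → ∃[ v ] (v ℕ.≤ suc b × P v n) → P (suc b) n ⊎ ∃[ v ] (v ℕ.≤ b × P v n)
    split n (v , v≤ , p) with ℕ.m≤n⇒m<n∨m≡n v≤
    ... | inj₁ v<  = inj₂ (v , ℕ.s≤s⁻¹ v< , p)
    ... | inj₂ refl = inj₁ p
  ... | inj₁ o₁ = suc b , o₁
  ... | inj₂ o₂ = often-≤ b o₂

  often-Fin : ∀ {m} {P : Fin m → ℕ → Set} → Often (λ n → ∃[ s ] P s n) → ∃[ s ] Often (P s)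
  often-Fin {zero}  o = let (_ , _ , s , _) = o 0 in contradiction s λ ()
  often-Fin {suc m} {P} o with often-⊎ (often-map split o)
    where
    split : ∀ n → ∃[ s ] P s n → P zero n ⊎ ∃[ s ] P (suc s) n
    split n (zero  , p) = inj₁ p
    split n (suc s , p) = inj₂ (s , p)
  ... | inj₁ o₁ = zero , o₁
  ... | inj₂ o₂ = let (s , o) = often-Fin o₂ in suc s , o

  least : {P : ℕ → Set} → ∃[ n ] P n → ∃[ n ] (P n × (∀ m → m ℕ.< n → ¬ P m))
  least {P} (n , p) = go n (ℕ.≤-refl) p
    where
    go : ∀ k {n} → n ℕ.≤ k → P n → ∃[ n ] (P n × (∀ m → m ℕ.< n → ¬ P m))
    go zero {zero} _ p = 0 , p , λ _ ()
    go (suc k) {n} n≤ p with em {∃[ m ] (m ℕ.< n × P m)}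
    ... | yes (m , m<n , pm) = go k (ℕ.s≤s⁻¹ (ℕ.≤-trans m<n n≤)) pm
    ... | no ¬m = n , p , λ m m<n pm → ¬m (m , m<n , pm)

  -- König's lemma.
  cluster : (b : ℕ → ℕ) (ζ : ℕ → Baire) → {P : ℕ → Set} → (∀ n i → P n → ζ n i ℕ.≤ b i) →
            Often P → ∃[ ξ ] (∀ j → Often (λ n → P n × Agree j ξ (ζ n)))
  cluster b ζ {P} bounded o = (λ i → proj₁ (state (suc i)) i) , λ j →
    often-map (λ n (pn , a) → pn , agree-trans (limit j) a) (proj₂ (state j))
    where
    -- Only the first `j` entries of the sequence in `State j` matter, the others are filler; hence
    -- the limit reads entry `i` off `state (suc i)`.
    State : ℕ → Set
    State j = Σ[ ξ ∈ Baire ] Often (λ n → P n × Agree j ξ (ζ n))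

    extend : ∀ j → (s : State j) → Σ[ s′ ∈ State (suc j) ] Agree j (proj₁ s) (proj₁ s′)
    extend j (ξ , o) = let (v , o′) = often-≤ (b j) (often-map next o) in (upd v , o′) , old v
      where
      upd : ℕ → Baire
      upd v i with ℕ._<?_ i j
      ... | yes _ = ξ i
      ... | no _  = v
      old : ∀ v → Agree j ξ (upd v)
      old v i i<j with ℕ._<?_ i j
      ... | yes _ = refl
      ... | no ¬p = contradiction i<j ¬p
      new : ∀ n → Agree j ξ (ζ n) → Agree (suc j) (upd (ζ n j)) (ζ n)
      new n a i i<1+j with ℕ._<?_ i j
      ... | yes i<j = a i i<j
      ... | no i≮j with ℕ.≤-antisym (ℕ.s≤s⁻¹ i<1+j) (ℕ.≮⇒≥ i≮j)
      ... | refl = refl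
      next : ∀ n → P n × Agree j ξ (ζ n) →
             ∃[ v ] (v ℕ.≤ b j × P n × Agree (suc j) (upd v) (ζ n))
      next n (pn , a) = ζ n j , bounded n j pn , pn , new n a

    state : ∀ j → State j
    state zero    = const 0 , often-map (λ n pn → pn , λ _ ()) o
    state (suc j) = proj₁ (extend j (state j))

    coherent : ∀ j k → j ℕ.≤ k → Agree j (proj₁ (state j)) (proj₁ (state k))
    coherent j k j≤k with ℕ.m≤n⇒m<n∨m≡n j≤k
    ... | inj₂ refl = agree-refl
    coherent j (suc k) _ | inj₁ (ℕ.s≤s j≤k) = agree-trans (coherent j k j≤k)
      (agree-≤ j≤k (proj₂ (extend k (state k))))

    limit : ∀ j → Agree j (λ i → proj₁ (state (suc i)) i) (proj₁ (state j))
    limit j i i<j = coherent (suc i) j i<j i (ℕ.n<1+n i)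

-- Real numbers

module S = ℚS.+-*-Solver
open S public using (_:+_; _:*_; :-_; _:-_; con; var; Polynomial)

Equation : ℕ → Set
Equation n = Polynomial n × Polynomial n

infix 4 _:=_
_:=_ : ∀ {n} → Polynomial n → Polynomial n → Equation n
_:=_ = _,_

close : ∀ n → N-ary n (Polynomial n) (Equation n) → Equation n
close n f = f $ⁿ Vec.map var (Vec.allFin n)

-- Unlike S.solve, this compares the closed normal forms and not their
-- values, which is what makes it usable over ℚ with many variables.
ring : ∀ n (f : N-ary n (Polynomial n) (Equation n)) →
       S.normalise (proj₁ (close n f)) ≡ S.normalise (proj₂ (close n f)) →
       (ρ : Vec ℚ n) → S.⟦ proj₁ (close n f) ⟧ ρ ≡ S.⟦ proj₂ (close n f) ⟧ ρ
ring n f eq ρ = S.prove ρ (proj₁ (close n f)) (proj₂ (close n f)) (cong (λ z → S.⟦ z ⟧N ρ) eq)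

-- The substitute for linear arithmetic throughout: known inequalities are added up to `a ≤ℚ b`, and
-- the ring solver checks that the goal has the same difference of sides.
rearrangeℚ : ∀ {a b c d} → a ≤ℚ b → d -ℚ c ≡ b -ℚ a → c ≤ℚ d
rearrangeℚ {a} {b} {c} {d} a≤b e =
  subst₂ _≤ℚ_ (ring 2 (λ a c → a :+ (c :- a) := c) refl (a ∷ c ∷ []))
    (trans (ring 3 (λ a b c → b :+ (c :- a) := (b :- a) :+ c) refl (a ∷ b ∷ c ∷ []))
      (trans (cong (_+ℚ c) (sym e)) (ring 2 (λ c d → (d :- c) :+ c := d) refl (c ∷ d ∷ []))))
    (ℚ.+-monoˡ-≤ (c -ℚ a) a≤b)

≤⇒≯ℚ : ∀ {p q} → p ≤ℚ q → ¬ q <ℚ p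
≤⇒≯ℚ p≤q q<p = ℚ.<-irrefl refl (ℚ.<-≤-trans q<p p≤q)

0<½* : ∀ {ε} → 0ℚ <ℚ ε → 0ℚ <ℚ ½ *ℚ ε
0<½* {ε} 0<ε = subst (_<ℚ ½ *ℚ ε) (ℚ.*-zeroʳ ½) (ℚ.*-monoʳ-<-pos ½ 0<ε)

*-nonnegℚ : ∀ {a b} → 0ℚ ≤ℚ a → 0ℚ ≤ℚ b → 0ℚ ≤ℚ a *ℚ b
*-nonnegℚ {a} {b} 0≤a 0≤b =
  subst (_≤ℚ a *ℚ b) (ℚ.*-zeroʳ a) (ℚ.*-monoˡ-≤-nonNeg a {{nonNegative 0≤a}} 0≤b)

*-monoʳ-≤ℚ : ∀ {a b c} → 0ℚ ≤ℚ c → a ≤ℚ b → c *ℚ a ≤ℚ c *ℚ b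
*-monoʳ-≤ℚ {c = c} 0≤c = ℚ.*-monoˡ-≤-nonNeg c {{nonNegative 0≤c}}

inverseℚ : ∀ a → 0ℚ <ℚ a → ∃[ r ] (0ℚ <ℚ r × a *ℚ r ≡ 1ℚ)
inverseℚ a 0<a = 1/ a , ℚ.positive⁻¹ _ {{ℚ.1/pos⇒pos a}} , ℚ.*-inverseʳ a
  where
  instance
    a-pos : ℚ.Positive a
    a-pos = positive 0<a
    a≢0 : ℚ.NonZero a
    a≢0 = ℚ.pos⇒nonZero a

∣∣-bounds : ∀ {a e} → ∣ a ∣ ≤ℚ e → a ≤ℚ e × -ℚ e ≤ℚ a
∣∣-bounds {a} {e} h with ℚ.∣p∣≡p∨∣p∣≡-p a | ℚ.≤-total 0ℚ a
... | _      | inj₁ 0≤a = subst (_≤ℚ e) (ℚ.0≤p⇒∣p∣≡p 0≤a) h ,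
  ℚ.≤-trans (ℚ.neg-antimono-≤ (ℚ.≤-trans (ℚ.0≤∣p∣ a) h)) 0≤a
... | inj₁ eq | inj₂ a≤0 = subst (_≤ℚ e) eq h ,
  ℚ.≤-trans (ℚ.neg-antimono-≤ (ℚ.≤-trans (ℚ.0≤∣p∣ a) h)) (subst (0ℚ ≤ℚ_) eq (ℚ.0≤∣p∣ a))
... | inj₂ eq | inj₂ a≤0 = ℚ.≤-trans a≤0 (ℚ.≤-trans (ℚ.0≤∣p∣ a) h) ,
  rearrangeℚ (subst (_≤ℚ e) eq h) (ring 2 (λ a e → a :- (:- e) := e :- (:- a)) refl (a ∷ e ∷ []))

∣∣≤ : ∀ {a e} → a ≤ℚ e → -ℚ e ≤ℚ a → ∣ a ∣ ≤ℚ e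
∣∣≤ {a} {e} a≤e -e≤a with ℚ.∣p∣≡p∨∣p∣≡-p a
... | inj₁ eq = subst (_≤ℚ e) (sym eq) a≤e
... | inj₂ eq = subst (_≤ℚ e) (sym eq)
  (rearrangeℚ -e≤a (ring 2 (λ a e → e :- (:- a) := a :- (:- e)) refl (a ∷ e ∷ [])))

∣-∣-bound : ∀ {a b e} → ∣ a -ℚ b ∣ ≤ℚ e → a ≤ℚ b +ℚ e
∣-∣-bound {a} {b} {e} h = rearrangeℚ (proj₁ (∣∣-bounds h))
  (ring 3 (λ a b e → (b :+ e) :- a := e :- (a :- b)) refl (a ∷ b ∷ e ∷ []))

ι : ℕ → ℚ
ι m = fromℤ (+ m)

ι-+ : ∀ m n → ι (m ℕ.+ n) ≡ ι m +ℚ ι n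
ι-+ m n = ℚ.toℚᵘ-injective (ℚᵘ.≃-trans
  (ℚᵘ.*≡* (cong (ℤ._* + 1) (sym (cong₂ ℤ._+_ (ℤ.*-identityʳ (+ m)) (ℤ.*-identityʳ (+ n))))))
  (ℚᵘ.≃-sym (ℚ.toℚᵘ-homo-+ (ι m) (ι n))))

ι-* : ∀ m n → ι (m ℕ.* n) ≡ ι m *ℚ ι n
ι-* zero    n = sym (ℚ.*-zeroˡ (ι n))
ι-* (suc m) n = trans (ι-+ n (m ℕ.* n)) (trans (cong (ι n +ℚ_) (ι-* m n))
  (trans (ring 2 (λ n m → n :+ m :* n := (con 1ℚ :+ m) :* n) refl ((ι n) ∷ (ι m) ∷ []))
    (cong (_*ℚ ι n) (sym (ι-+ 1 m)))))

ι-mono : ∀ {m n} → m ℕ.≤ n → ι m ≤ℚ ι n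
ι-mono m≤n = ℚ.*≤* (ℤ.*-monoʳ-≤-nonNeg (+ 1) (ℤ.+≤+ m≤n))

0≤ι : ∀ m → 0ℚ ≤ℚ ι m
0≤ι m = ι-mono ℕ.z≤n

ι-unbounded : ∀ r → ∃[ n ] r ≤ℚ ι n
ι-unbounded (ℚ.mkℚ (+ a) d _) =
  a , ℚ.*≤* (ℤ.*-monoˡ-≤-nonNeg (+ a) (ℤ.+≤+ (ℕ.s≤s ℕ.z≤n)))
ι-unbounded (ℚ.mkℚ (ℤ.-[1+ a ]) d _) = 0 , ℚ.*≤* ℤ.-≤+

n<2^n : ∀ n → n ℕ.< 2 ℕ.^ n
n<2^n zero    = ℕ.s≤s ℕ.z≤n
n<2^n (suc n) = ℕ.≤-trans (ℕ.s≤s (n<2^n n))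
  (ℕ.≤-trans (ℕ.+-monoˡ-≤ (2 ℕ.^ n) (ℕ.m^n>0 2 n))
    (ℕ.≤-reflexive (cong (2 ℕ.^ n ℕ.+_) (sym (ℕ.+-identityʳ _)))))

0<2⁻ : ∀ n → 0ℚ <ℚ 2⁻ n
0<2⁻ zero    = ℚ.positive⁻¹ 1ℚ
0<2⁻ (suc n) = 0<½* (0<2⁻ n)

0≤2⁻ : ∀ n → 0ℚ ≤ℚ 2⁻ n
0≤2⁻ n = ℚ.<⇒≤ (0<2⁻ n)

½*≤ : ∀ {a} → 0ℚ ≤ℚ a → ½ *ℚ a ≤ℚ a
½*≤ {a} 0≤a = rearrangeℚ (*-nonnegℚ {½} {a} (ℚ.<⇒≤ (ℚ.positive⁻¹ ½)) 0≤a)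
  (ring 1 (λ a → a :- con ½ :* a := con ½ :* a :- con 0ℚ) refl (a ∷ []))

2⁻-antitone : ∀ {m n} → m ℕ.≤ n → 2⁻ n ≤ℚ 2⁻ m
2⁻-antitone {m} {n} m≤n with ℕ.m≤n⇒m<n∨m≡n m≤n
2⁻-antitone {m} {n}     _ | inj₂ refl = ℚ.≤-refl
2⁻-antitone {m} {suc n} _ | inj₁ (ℕ.s≤s m≤n) = ℚ.≤-trans (½*≤ (0≤2⁻ n)) (2⁻-antitone m≤n)

2^*2⁻ : ∀ n → ι (2 ℕ.^ n) *ℚ 2⁻ n ≡ 1ℚ
2^*2⁻ zero    = refl
2^*2⁻ (suc n) = trans (cong (_*ℚ 2⁻ suc n) (ι-* 2 (2 ℕ.^ n)))
  (trans (ring 2 (λ a h → (con (ι 2) :* a) :* (con ½ :* h) := a :* h) refl ((ι (2 ℕ.^ n)) ∷ (2⁻ n) ∷ []))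
         (2^*2⁻ n))

2⁻-small : ∀ ε → 0ℚ <ℚ ε → ∃[ n ] 2⁻ n ≤ℚ ε
2⁻-small ε 0<ε =
  let (r , _ , εr≡1) = inverseℚ ε 0<ε
      (n , r≤n) = ι-unbounded r
      r≤2^n = ℚ.≤-trans r≤n (ι-mono (ℕ.<⇒≤ (n<2^n n)))
      ε2⁻≥0 = *-nonnegℚ (ℚ.<⇒≤ 0<ε) (0≤2⁻ n)
  in n , subst₂ _≤ℚ_
    (trans (ring 3 (λ e h r → (e :* h) :* r := (e :* r) :* h) refl (ε ∷ (2⁻ n) ∷ r ∷ []))
      (trans (cong (_*ℚ 2⁻ n) εr≡1) (ℚ.*-identityˡ _)))
    (trans (ring 3 (λ e h r → (e :* h) :* r := e :* (r :* h)) refl (ε ∷ (2⁻ n) ∷ (ι (2 ℕ.^ n)) ∷ []))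
      (trans (cong (ε *ℚ_) (2^*2⁻ n)) (ℚ.*-identityʳ ε)))
    (*-monoʳ-≤ℚ ε2⁻≥0 r≤2^n)

infix 4 _≼_

-- The order of Defs, wrapped so that its arguments can be inferred.
record _≼_ (x y : ℝ) : Set where
  constructor ≤⇒≼
  field ≼⇒≤ : x ≤ y

open _≼_ public

0ʳ 1ʳ : ℝ
0ʳ = fromℚ 0ℚ
1ʳ = fromℚ 1ℚ

neg : ℝ → ℝ
neg x = real (λ n → -ℚ seq x n) λ ε 0<ε →
  let (N , h) = cauchy x ε 0<ε
  in N , λ m n N≤m N≤n → subst (_≤ℚ ε)
    (cong ∣_∣ (ring 2 (λ a b → b :- a := (:- a) :- (:- b)) refl ((seq x m) ∷ (seq x n) ∷ [])))
    (h n m N≤n N≤m)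

infixl 6 _-ʳ_
_-ʳ_ : ℝ → ℝ → ℝ
x -ʳ y = x + neg y

≼-refl : ∀ {x} → x ≼ x
≼-refl {x} = ≤⇒≼ (≤-refl {x})

≼-trans : ∀ {x y z} → x ≼ y → y ≼ z → x ≼ z
≼-trans {x} {y} {z} (≤⇒≼ p) (≤⇒≼ q) = ≤⇒≼ (≤-trans {x} {y} {z} p q)

≼-pointwise : ∀ {x y} → (∀ n → seq x n ≤ℚ seq y n) → x ≼ y
≼-pointwise {x} {y} h = ≤⇒≼ λ ε 0<ε → 0 , λ n _ → ℚ.≤-trans (h n)
  (subst (_≤ℚ seq y n +ℚ ε) (ℚ.+-identityʳ _) (ℚ.+-monoʳ-≤ (seq y n) (ℚ.<⇒≤ 0<ε)))

≼-reflexive : ∀ {x y} → (∀ n → seq x n ≡ seq y n) → x ≼ y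
≼-reflexive h = ≼-pointwise (ℚ.≤-reflexive ∘ h)

rearrange : ∀ {x y z w} → x ≼ y → (∀ n → seq w n -ℚ seq z n ≡ seq y n -ℚ seq x n) → z ≼ w
rearrange {x} {y} {z} {w} (≤⇒≼ p) e = ≤⇒≼ λ ε 0<ε →
  let (N , h) = p ε 0<ε
  in N , λ n N≤n → rearrangeℚ (h n N≤n)
    (trans (ring 3 (λ w e z → (w :+ e) :- z := (w :- z) :+ e) refl ((seq w n) ∷ ε ∷ (seq z n) ∷ []))
      (trans (cong (_+ℚ ε) (e n))
        (ring 3 (λ y e x → (y :- x) :+ e := (y :+ e) :- x) refl ((seq y n) ∷ ε ∷ (seq x n) ∷ []))))

+-mono-≼ : ∀ {x y u v} → x ≼ y → u ≼ v → x + u ≼ y + v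
+-mono-≼ {x} {y} {u} {v} (≤⇒≼ p) (≤⇒≼ q) = ≤⇒≼ λ ε 0<ε →
  Ev-zip (λ {n} a b → rearrangeℚ (ℚ.+-mono-≤ a b)
      (cong (_-ℚ (seq x n +ℚ seq u n))
        (ring 3 (λ y v e → (y :+ v) :+ e := (y :+ con ½ :* e) :+ (v :+ con ½ :* e)) refl ((seq y n) ∷ (seq v n) ∷ ε ∷ []))))
    (p (½ *ℚ ε) (0<½* 0<ε)) (q (½ *ℚ ε) (0<½* 0<ε))

eventually-≤ : ∀ x → ∃[ B ] (0ℚ ≤ℚ B × Eventually (λ n → seq x n ≤ℚ B))
eventually-≤ x =
  let (N , h) = cauchy x 1ℚ (ℚ.positive⁻¹ 1ℚ)
      a = seq x N
  in 1ℚ +ℚ ∣ a ∣ ,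
     ℚ.≤-trans (ℚ.0≤∣p∣ a) (rearrangeℚ (ℚ.<⇒≤ (ℚ.positive⁻¹ 1ℚ))
       (ring 1 (λ b → (con 1ℚ :+ b) :- b := con 1ℚ :- con 0ℚ) refl (∣ a ∣ ∷ []))) ,
     N , λ n N≤n → rearrangeℚ
       (ℚ.+-mono-≤ (proj₁ (∣∣-bounds (h n N N≤n ℕ.≤-refl))) (proj₁ (∣∣-bounds {a} ℚ.≤-refl)))
       (ring 3 (λ b y a → (con 1ℚ :+ b) :- y := (con 1ℚ :+ b) :- ((y :- a) :+ a)) refl (∣ a ∣ ∷ (seq x n) ∷ a ∷ []))

*-nonneg : ∀ {x y} → 0ʳ ≼ x → 0ʳ ≼ y → 0ʳ ≼ x * y
*-nonneg {x} {y} (≤⇒≼ p) (≤⇒≼ q) = ≤⇒≼ goal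
  where
  goal : 0ʳ ≤ x * y
  goal ε 0<ε = Ev-zip (λ (a , b) (c , d) → step a b c d)
      (Ev-zip _,_ x≤A (p δ 0<δ)) (Ev-zip _,_ y≤B (q δ 0<δ))
    where
    A = proj₁ (eventually-≤ x)
    0≤A = proj₁ (proj₂ (eventually-≤ x))
    x≤A = proj₂ (proj₂ (eventually-≤ x))
    B = proj₁ (eventually-≤ y)
    0≤B = proj₁ (proj₂ (eventually-≤ y))
    y≤B = proj₂ (proj₂ (eventually-≤ y))
    -- In `M δ = ε` the part `A + B` pays for the cross terms of `(a + δ)(b + δ)` and 1 pays for the
    -- square of `δ`; the summand `ε` makes `δ` at most 1.
    M = (A +ℚ B) +ℚ (1ℚ +ℚ ε)
    0<M : 0ℚ <ℚ M
    0<M = ℚ.+-mono-≤-< (ℚ.+-mono-≤ 0≤A 0≤B) (ℚ.+-mono-< (ℚ.positive⁻¹ 1ℚ) 0<ε)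
    r = proj₁ (inverseℚ M 0<M)
    0<r = proj₁ (proj₂ (inverseℚ M 0<M))
    Mr≡1 = proj₂ (proj₂ (inverseℚ M 0<M))
    δ = ε *ℚ r
    0<δ : 0ℚ <ℚ δ
    0<δ = ℚ.positive⁻¹ δ {{ℚ.pos*pos⇒pos ε {{positive 0<ε}} r {{positive 0<r}}}}
    εr = *-nonnegℚ (ℚ.<⇒≤ 0<ε) (ℚ.<⇒≤ 0<r)
    Mδ≡ε : M *ℚ δ ≡ ε
    Mδ≡ε = trans (ring 3 (λ M e r → M :* (e :* r) := (M :* r) :* e) refl (M ∷ ε ∷ r ∷ []))
      (trans (cong (_*ℚ ε) Mr≡1) (ℚ.*-identityˡ ε))
    δ≤1 : 0ℚ ≤ℚ 1ℚ -ℚ δ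
    δ≤1 = subst (0ℚ ≤ℚ_)
      (trans (ring 4 (λ A B e r → ((A :+ B) :+ con 1ℚ) :* r :=
                ((A :+ B) :+ (con 1ℚ :+ e)) :* r :- e :* r) refl (A ∷ B ∷ ε ∷ r ∷ []))
        (cong (_-ℚ δ) Mr≡1))
      (*-nonnegℚ (ℚ.+-mono-≤ (ℚ.+-mono-≤ 0≤A 0≤B) (ℚ.<⇒≤ (ℚ.positive⁻¹ 1ℚ))) (ℚ.<⇒≤ 0<r))
    step : ∀ {a b} → a ≤ℚ A → 0ℚ ≤ℚ a +ℚ δ → b ≤ℚ B → 0ℚ ≤ℚ b +ℚ δ → 0ℚ ≤ℚ a *ℚ b +ℚ ε
    step {a} {b} a≤A 0≤a b≤B 0≤b = rearrangeℚ
      (ℚ.+-mono-≤ (*-nonnegℚ 0≤a 0≤b)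
        (ℚ.+-mono-≤ (*-nonnegℚ (ℚ.<⇒≤ 0<δ) (ℚ.+-mono-≤ (ℚ.+-mono-≤ (gap a≤A) (gap b≤B)) δ≤1))
          (*-nonnegℚ (ℚ.<⇒≤ 0<ε) (ℚ.<⇒≤ 0<δ))))
      (trans (cong (λ e → a *ℚ b +ℚ e -ℚ 0ℚ) (sym Mδ≡ε))
        (ring 6 (λ a b A B e d →
           (a :* b :+ ((A :+ B) :+ (con 1ℚ :+ e)) :* d) :- con 0ℚ :=
           ((a :+ d) :* (b :+ d) :+ (d :* (((A :- a) :+ (B :- b)) :+ (con 1ℚ :- d)) :+ e :* d))
             :- (con 0ℚ :+ (con 0ℚ :+ con 0ℚ)))
         refl (a ∷ b ∷ A ∷ B ∷ ε ∷ δ ∷ [])))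
      where
      gap : ∀ {a b} → a ≤ℚ b → 0ℚ ≤ℚ b -ℚ a
      gap {a} {b} a≤b = rearrangeℚ a≤b
        (ring 2 (λ a b → (b :- a) :- con 0ℚ := b :- a) refl (a ∷ b ∷ []))

0≼-ʳ : ∀ {x y} → x ≼ y → 0ʳ ≼ y -ʳ x
0≼-ʳ {x} {y} x≼y = rearrange x≼y λ n →
  ring 2 (λ a b → (b :+ (:- a)) :- con 0ℚ := b :- a) refl ((seq x n) ∷ (seq y n) ∷ [])

*-monoʳ-≼ : ∀ {x y c} → 0ʳ ≼ c → x ≼ y → c * x ≼ c * y
*-monoʳ-≼ {x} {y} {c} 0≼c x≼y = rearrange (*-nonneg 0≼c (0≼-ʳ x≼y)) λ n →
  ring 3 (λ a b c → c :* b :- c :* a := c :* (b :+ (:- a)) :- con 0ℚ) refl ((seq x n) ∷ (seq y n) ∷ (seq c n) ∷ [])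

-- Only products of nonnegative numbers are at hand, and c need not have a
-- sign: write c as the difference of D + c and D.
*-null : ∀ c {a b} D → 0ℚ ≤ℚ D → 0ʳ ≼ fromℚ D + c → a ≼ b → b ≼ a → c * a ≼ c * b
*-null c {a} {b} D 0≤D 0≼D+c a≼b b≼a =
  rearrange {0ʳ + 0ʳ} {(fromℚ D + c) * (b -ʳ a) + fromℚ D * (a -ʳ b)} {c * a} {c * b}
    (+-mono-≼ {0ʳ} {(fromℚ D + c) * (b -ʳ a)} {0ʳ} {fromℚ D * (a -ʳ b)}
      (*-nonneg {fromℚ D + c} {b -ʳ a} 0≼D+c (0≼-ʳ a≼b))
      (*-nonneg {fromℚ D} {a -ʳ b} (≼-pointwise {0ʳ} {fromℚ D} λ _ → 0≤D) (0≼-ʳ b≼a)))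
    λ n → ring 4 (λ c a b D → c :* b :- c :* a :=
      ((D :+ c) :* (b :+ (:- a)) :+ D :* (a :+ (:- b))) :- (con 0ℚ :+ con 0ℚ)) refl
      (seq c n ∷ seq a n ∷ seq b n ∷ D ∷ [])

*-congʳ-≼ : ∀ c {a b} → a ≼ b → b ≼ a → c * a ≼ c * b
*-congʳ-≼ c {a} {b} a≼b b≼a =
  let (B , 0≤B , M , -c≤B) = eventually-≤ (neg c)
  in *-null c {a} {b} B 0≤B (≤⇒≼ λ ε 0<ε → M , λ n M≤n →
       step {seq c n} (-c≤B n M≤n) (ℚ.<⇒≤ 0<ε)) a≼b b≼a
  where
  step : ∀ {c B ε} → -ℚ c ≤ℚ B → 0ℚ ≤ℚ ε → 0ℚ ≤ℚ (B +ℚ c) +ℚ ε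
  step {c} {B} {ε} p q = rearrangeℚ (ℚ.+-mono-≤ p q)
    (ring 3 (λ c B ε → ((B :+ c) :+ ε) :- con 0ℚ := (B :+ ε) :- ((:- c) :+ con 0ℚ)) refl
      (c ∷ B ∷ ε ∷ []))

neg-anti : ∀ {x y} → x ≼ y → neg y ≼ neg x
neg-anti {x} {y} x≼y = rearrange x≼y λ n →
  ring 2 (λ a b → (:- a) :- (:- b) := b :- a) refl ((seq x n) ∷ (seq y n) ∷ [])

fromℚ-mono : ∀ {p q} → p ≤ℚ q → fromℚ p ≼ fromℚ q
fromℚ-mono p≤q = ≼-pointwise λ _ → p≤q

fromℚ-reflect : ∀ {p q} → fromℚ p ≼ fromℚ q → p ≤ℚ q
fromℚ-reflect {p} {q} (≤⇒≼ h) with p ℚ.≤? q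
... | yes p≤q = p≤q
... | no ¬p≤q =
  let q<p = ℚ.≰⇒> ¬p≤q
      0<p-q = subst₂ _<ℚ_ (ℚ.+-inverseʳ q) refl (ℚ.+-monoˡ-< (-ℚ q) q<p)
      (N , k) = h (½ *ℚ (p -ℚ q)) (0<½* 0<p-q)
  in contradiction (0<½* 0<p-q) (≤⇒≯ℚ (rearrangeℚ (k N ℕ.≤-refl)
       (ring 2 (λ p q → con 0ℚ :- con ½ :* (p :- q) := (q :+ con ½ :* (p :- q)) :- p) refl (p ∷ q ∷ []))))

≼-archimedean : ∀ {x y} → (∀ ε → 0ℚ <ℚ ε → x ≼ y + fromℚ ε) → x ≼ y
≼-archimedean {x} {y} h = ≤⇒≼ λ ε 0<ε →
  let (N , k) = ≼⇒≤ (h (½ *ℚ ε) (0<½* 0<ε)) (½ *ℚ ε) (0<½* 0<ε)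
  in N , λ n N≤n → rearrangeℚ (k n N≤n) (cong (_-ℚ seq x n)
    (ring 2 (λ y e → y :+ e := (y :+ con ½ :* e) :+ con ½ :* e) refl ((seq y n) ∷ ε ∷ [])))

≼-archimedean-2⁻ : ∀ {x y} c → (∀ k → x ≼ y + fromℚ (c *ℚ 2⁻ k)) → x ≼ y
≼-archimedean-2⁻ {x} {y} c h = ≼-archimedean λ ε 0<ε →
  let B = 1ℚ +ℚ ∣ c ∣
      0<B = ℚ.+-mono-<-≤ (ℚ.positive⁻¹ 1ℚ) (ℚ.0≤∣p∣ c)
      (r , 0<r , Br≡1) = inverseℚ B 0<B
      0<εr = ℚ.positive⁻¹ _ {{ℚ.pos*pos⇒pos ε {{positive 0<ε}} r {{positive 0<r}}}}
      (k , 2⁻≤) = 2⁻-small (ε *ℚ r) 0<εr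
      c≤B : c ≤ℚ B
      c≤B = rearrangeℚ {c = c} {d = B} (ℚ.+-mono-≤ (ℚ.<⇒≤ (ℚ.positive⁻¹ 1ℚ)) (proj₁ (∣∣-bounds {c} ℚ.≤-refl)))
              (ring 2 (λ b c → (con 1ℚ :+ b) :- c := (con 1ℚ :+ b) :- (con 0ℚ :+ c)) refl (∣ c ∣ ∷ c ∷ []))
      c2⁻≤ε : c *ℚ 2⁻ k ≤ℚ ε
      c2⁻≤ε = ℚ.≤-trans {c *ℚ 2⁻ k} {B *ℚ 2⁻ k} {ε} (ℚ.*-monoʳ-≤-nonNeg (2⁻ k) {{nonNegative (0≤2⁻ k)}} c≤B)
                (subst (B *ℚ 2⁻ k ≤ℚ_)
                  (trans (ring 3 (λ B e r → B :* (e :* r) := (B :* r) :* e) refl (B ∷ ε ∷ r ∷ []))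
                    (trans (cong (_*ℚ ε) Br≡1) (ℚ.*-identityˡ ε)))
                  (*-monoʳ-≤ℚ (ℚ.<⇒≤ 0<B) 2⁻≤))
  in ≼-trans (h k) (+-mono-≼ {y} {y} {fromℚ (c *ℚ 2⁻ k)} {fromℚ ε} (≼-refl {y}) (fromℚ-mono c2⁻≤ε))

-- From some index on either sequence moves by at most a quarter of `ε`, so a gap of `ε` at one late
-- index leaves half of it at all later ones.
often-gap : ∀ {x y ε} → 0ℚ <ℚ ε → Often (λ n → ¬ seq x n ≤ℚ seq y n +ℚ ε) →
            y + fromℚ (½ *ℚ ε) ≼ x
often-gap {x} {y} {ε} 0<ε far = ≤⇒≼ λ η 0<η →
  let 0<ε₄ = 0<½* (0<½* 0<ε)
      (N₁ , cx) = cauchy x _ 0<ε₄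
      (N₂ , cy) = cauchy y _ 0<ε₄
      (n , N≤n , h) = far (N₁ ⊔ N₂)
  in N₁ ⊔ N₂ , λ m N≤m →
    let i₁ : ∀ {k} → N₁ ⊔ N₂ ℕ.≤ k → N₁ ℕ.≤ k
        i₁ = ℕ.≤-trans (ℕ.m≤m⊔n N₁ N₂)
        i₂ : ∀ {k} → N₁ ⊔ N₂ ℕ.≤ k → N₂ ℕ.≤ k
        i₂ = ℕ.≤-trans (ℕ.m≤n⊔m N₁ N₂)
        a = proj₂ (∣∣-bounds (cx m n (i₁ N≤m) (i₁ N≤n)))
        b = proj₁ (∣∣-bounds (cy m n (i₂ N≤m) (i₂ N≤n)))
    in step {seq x m} {seq x n} {seq y m} {seq y n} {ε} {η}
         (ℚ.<⇒≤ (ℚ.≰⇒> h)) a b (ℚ.<⇒≤ 0<η)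
  where
  step : ∀ {xm xn ym yn e η} → yn +ℚ e ≤ℚ xn → -ℚ (½ *ℚ (½ *ℚ e)) ≤ℚ xm -ℚ xn →
         ym -ℚ yn ≤ℚ ½ *ℚ (½ *ℚ e) → 0ℚ ≤ℚ η → ym +ℚ ½ *ℚ e ≤ℚ xm +ℚ η
  step {xm} {xn} {ym} {yn} {e} {η} h a b c =
    rearrangeℚ (ℚ.+-mono-≤ h (ℚ.+-mono-≤ (ℚ.+-mono-≤ a b) c))
      (ring 6 (λ xm xn ym yn e η →
         (xm :+ η) :- (ym :+ con ½ :* e) :=
         (xn :+ (((xm :- xn) :+ con ½ :* (con ½ :* e)) :+ η)) :-
         ((yn :+ e) :+ ((:- (con ½ :* (con ½ :* e)) :+ (ym :- yn)) :+ con 0ℚ)))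
       refl (xm ∷ xn ∷ ym ∷ yn ∷ e ∷ η ∷ []))

module Order (em : ExcludedMiddle 0ℓ) where
  open Classical em

  ⋠⇒gap : ∀ {x y} → ¬ x ≼ y → ∃[ ε ] (0ℚ <ℚ ε × y + fromℚ ε ≼ x)
  ⋠⇒gap {x} {y} x⋠y =
    let (ε , ¬h) = ¬∀⇒∃¬ (λ h → x⋠y (≤⇒≼ h))
        (0<ε , ¬ev) = ¬∀⇒∃¬ ¬h
    in ½ *ℚ ε , 0<½* 0<ε , often-gap {x} {y} {ε} 0<ε λ N → by-contradiction λ ¬far →
         ¬ev (N , λ n N≤n → by-contradiction λ h → ¬far (n , N≤n , h))

  ⋠⇒≽ : ∀ {x y} → ¬ x ≼ y → y ≼ x
  ⋠⇒≽ {x} {y} x⋠y =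
    let (ε , 0<ε , h) = ⋠⇒gap x⋠y
    in ≼-trans (≼-pointwise λ n → subst (_≤ℚ seq y n +ℚ ε) (ℚ.+-identityʳ _)
                  (ℚ.+-monoʳ-≤ (seq y n) (ℚ.<⇒≤ 0<ε))) h

shift : ℝ → ℕ → ℝ
shift x N = real (λ n → seq x (N ℕ.+ n)) λ ε 0<ε →
  let (M , h) = cauchy x ε 0<ε
  in M , λ m n M≤m M≤n → h _ _ (ℕ.≤-trans M≤m (ℕ.m≤n+m m N)) (ℕ.≤-trans M≤n (ℕ.m≤n+m n N))

inverse-of-bounded : ∀ x {δ} → 0ℚ <ℚ δ → (∀ n → δ ≤ℚ seq x n) →
  Σ[ v ∈ ℝ ] ((∀ n → seq x n *ℚ seq v n ≡ 1ℚ) × (∀ n → 0ℚ ≤ℚ seq v n))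
inverse-of-bounded x {δ} 0<δ δ≤x = real v cau , xv≡1 , λ n → ℚ.<⇒≤ (0<v n)
  where
  inv : ∀ n → ∃[ r ] (0ℚ <ℚ r × seq x n *ℚ r ≡ 1ℚ)
  inv n = inverseℚ (seq x n) (ℚ.<-≤-trans 0<δ (δ≤x n))
  v : ℕ → ℚ
  v n = proj₁ (inv n)
  0<v : ∀ n → 0ℚ <ℚ v n
  0<v n = proj₁ (proj₂ (inv n))
  xv≡1 : ∀ n → seq x n *ℚ v n ≡ 1ℚ
  xv≡1 n = proj₂ (proj₂ (inv n))
  d = proj₁ (inverseℚ δ 0<δ)
  0≤d = ℚ.<⇒≤ (proj₁ (proj₂ (inverseℚ δ 0<δ)))
  δd≡1 = proj₂ (proj₂ (inverseℚ δ 0<δ))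
  v≤d : ∀ n → v n ≤ℚ d
  v≤d n = rearrangeℚ
    (*-nonnegℚ (*-nonnegℚ 0≤d (ℚ.<⇒≤ (0<v n)))
      (rearrangeℚ (δ≤x n) (ring 2 (λ a b → (b :- a) :- con 0ℚ := b :- a) refl (δ ∷ (seq x n) ∷ []))))
    (trans (cong₂ _-ℚ_ (trans (sym (ℚ.*-identityʳ d)) (cong (d *ℚ_) (sym (xv≡1 n))))
                        (trans (sym (ℚ.*-identityʳ (v n))) (cong (v n *ℚ_) (sym δd≡1))))
      (ring 4 (λ d x v e → d :* (x :* v) :- v :* (e :* d) := (d :* v) :* (x :- e) :- con 0ℚ) refl (d ∷ (seq x n) ∷ (v n) ∷ δ ∷ [])))
  cau : Cauchy v
  cau ε 0<ε =
    -- The difference `v m - v n` equals `v m * v n * (x n - x m)`, and `v` is bounded by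
    -- `d = 1 / δ`.
    let D = ε *ℚ (δ *ℚ δ)
        0<D = ℚ.positive⁻¹ D {{ℚ.pos*pos⇒pos ε {{positive 0<ε}} (δ *ℚ δ)
                {{ℚ.pos*pos⇒pos δ {{positive 0<δ}} δ {{positive 0<δ}}}}}}
        (N , h) = cauchy x D 0<D
    in N , λ m n N≤m N≤n →
      let vv≥0 = *-nonnegℚ (ℚ.<⇒≤ (0<v m)) (ℚ.<⇒≤ (0<v n))
          vv≤dd = ℚ.≤-trans (*-monoʳ-≤ℚ {v n} {d} {v m} (ℚ.<⇒≤ (0<v m)) (v≤d n))
                    (ℚ.*-monoʳ-≤-nonNeg d {{nonNegative 0≤d}} (v≤d m))
          (up , low) = ∣∣-bounds (h n m N≤n N≤m)
          eq : (v m *ℚ v n) *ℚ (seq x n -ℚ seq x m) ≡ v m -ℚ v n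
          eq = trans (ring 4 (λ a b x y → (a :* b) :* (y :- x) := a :* (y :* b) :- b :* (x :* a)) refl ((v m) ∷ (v n) ∷ (seq x m) ∷ (seq x n) ∷ []))
                 (cong₂ _-ℚ_ (trans (cong (v m *ℚ_) (xv≡1 n)) (ℚ.*-identityʳ (v m)))
                             (trans (cong (v n *ℚ_) (xv≡1 m)) (ℚ.*-identityʳ (v n))))
          ddD≡ε : (d *ℚ d) *ℚ D ≡ ε
          ddD≡ε = trans (ring 3 (λ d e δ → (d :* d) :* (e :* (δ :* δ)) := (e :* (δ :* d)) :* (δ :* d)) refl (d ∷ ε ∷ δ ∷ []))
                    (trans (cong₂ (λ a b → (ε *ℚ a) *ℚ b) δd≡1 δd≡1)
                      (trans (ℚ.*-identityʳ _) (ℚ.*-identityʳ _)))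
          vvD≤ε : (v m *ℚ v n) *ℚ D ≤ℚ ε
          vvD≤ε =
            ℚ.≤-trans (ℚ.*-monoʳ-≤-nonNeg D {{nonNegative (ℚ.<⇒≤ 0<D)}} vv≤dd) (ℚ.≤-reflexive ddD≡ε)
      in ∣∣≤ (ℚ.≤-trans (subst (_≤ℚ (v m *ℚ v n) *ℚ D) eq (*-monoʳ-≤ℚ vv≥0 up)) vvD≤ε)
             (ℚ.≤-trans (ℚ.neg-antimono-≤ vvD≤ε)
               (subst₂ _≤ℚ_ (ring 2 (λ a D → a :* (:- D) := :- (a :* D)) refl ((v m *ℚ v n) ∷ D ∷ [])) eq
                 (*-monoʳ-≤ℚ vv≥0 low)))

≼-shift : ∀ x N → x ≼ shift x N
≼-shift x N = ≤⇒≼ λ ε 0<ε →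
  let (M , h) = cauchy x ε 0<ε
  in M , λ n M≤n →
    ∣-∣-bound {seq x n} {seq x (N ℕ.+ n)} (h n (N ℕ.+ n) M≤n (ℕ.≤-trans M≤n (ℕ.m≤n+m n N)))

shift-≼ : ∀ x N → shift x N ≼ x
shift-≼ x N = ≤⇒≼ λ ε 0<ε →
  let (M , h) = cauchy x ε 0<ε
  in M , λ n M≤n →
    ∣-∣-bound {seq x (N ℕ.+ n)} {seq x n} (h (N ℕ.+ n) n (ℕ.≤-trans M≤n (ℕ.m≤n+m n N)) M≤n)

half-left : ∀ {a d} → d ≤ℚ a +ℚ ½ *ℚ d → ½ *ℚ d ≤ℚ a
half-left {a} {d} h = rearrangeℚ h
  (ring 2 (λ a d → a :- con ½ :* d := (a :+ con ½ :* d) :- d) refl (a ∷ d ∷ []))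

-- Termwise inversion needs a positive bound at every index, while the order on reals gives one only
-- eventually and up to an error; half of `δ` is given up for the error, and the initial terms are
-- dropped.
bounded-shift : ∀ x {δ} → 0ℚ <ℚ δ → fromℚ δ ≼ x → ∃[ N ] (∀ n → ½ *ℚ δ ≤ℚ seq (shift x N) n)
bounded-shift x {δ} 0<δ (≤⇒≼ h) =
  let (N , k) = h (½ *ℚ δ) (0<½* 0<δ)
  in N , λ n → half-left {seq x (N ℕ.+ n)} (k (N ℕ.+ n) (ℕ.m≤m+n N n))

infixl 6 _⊕_ _⊖_
infixl 7 _⊗_
infix  8 ⊝_
infix  4 _≋_

record _≋_ (x y : ℝ) : Set where
  constructor _&_
  field
    ≋⇒≼ : x ≼ y
    ≋⇒≽ : y ≼ x
open _≋_ public

-- The arithmetic of Defs computes on representing sequences, and comparing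
-- two terms by evaluation is hopeless; hence these opaque copies.
opaque
  _⊕_ _⊗_ : ℝ → ℝ → ℝ
  x ⊕ y = x + y
  x ⊗ y = x * y

  ⊝_ : ℝ → ℝ
  ⊝ x = neg x

  ↑ : ℚ → ℝ
  ↑ q = fromℚ q

_⊖_ : ℝ → ℝ → ℝ
x ⊖ y = x ⊕ ⊝ y

≋-refl : ∀ {x} → x ≋ x
≋-refl = ≼-refl & ≼-refl

≋-sym : ∀ {x y} → x ≋ y → y ≋ x
≋-sym (p & q) = q & p

≋-trans : ∀ {x y z} → x ≋ y → y ≋ z → x ≋ z
≋-trans (p & q) (r & s) = ≼-trans p r & ≼-trans s q

≋-pointwise : ∀ {x y} → (∀ n → seq x n ≡ seq y n) → x ≋ y
≋-pointwise h = ≼-reflexive h & ≼-reflexive (sym ∘ h)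

opaque
  unfolding _⊕_

  +≋⊕ : ∀ x y → x + y ≋ x ⊕ y
  +≋⊕ x y = ≋-refl

  *≋⊗ : ∀ x y → x * y ≋ x ⊗ y
  *≋⊗ x y = ≋-refl

  fromℚ≋↑ : ∀ q → fromℚ q ≋ ↑ q
  fromℚ≋↑ q = ≋-refl

  ⊕-mono : ∀ {x y u v} → x ≼ y → u ≼ v → x ⊕ u ≼ y ⊕ v
  ⊕-mono {x} {y} {u} {v} = +-mono-≼ {x} {y} {u} {v}

  ⊗-monoʳ : ∀ {x y c} → ↑ 0ℚ ≼ c → x ≼ y → c ⊗ x ≼ c ⊗ y
  ⊗-monoʳ {x} {y} {c} = *-monoʳ-≼ {x} {y} {c}

  ⊗-nonneg : ∀ {x y} → ↑ 0ℚ ≼ x → ↑ 0ℚ ≼ y → ↑ 0ℚ ≼ x ⊗ y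
  ⊗-nonneg {x} {y} = *-nonneg {x} {y}

  ⊝-anti : ∀ {x y} → x ≼ y → ⊝ y ≼ ⊝ x
  ⊝-anti {x} {y} = neg-anti {x} {y}

  ↑-mono : ∀ {p q} → p ≤ℚ q → ↑ p ≼ ↑ q
  ↑-mono = fromℚ-mono

  ↑-reflect : ∀ {p q} → ↑ p ≼ ↑ q → p ≤ℚ q
  ↑-reflect = fromℚ-reflect

  ↑-+ : ∀ p q → ↑ (p +ℚ q) ≋ ↑ p ⊕ ↑ q
  ↑-+ p q = ≋-pointwise λ _ → refl

  ↑-* : ∀ p q → ↑ (p *ℚ q) ≋ ↑ p ⊗ ↑ q
  ↑-* p q = ≋-pointwise λ _ → refl

  ↑-⊝ : ∀ p → ↑ (-ℚ p) ≋ ⊝ ↑ p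
  ↑-⊝ p = ≋-pointwise λ _ → refl

  ⊕-assoc : ∀ x y z → (x ⊕ y) ⊕ z ≋ x ⊕ (y ⊕ z)
  ⊕-assoc x y z = ≋-pointwise λ n → ℚ.+-assoc (seq x n) (seq y n) (seq z n)

  ⊕-comm : ∀ x y → x ⊕ y ≋ y ⊕ x
  ⊕-comm x y = ≋-pointwise λ n → ℚ.+-comm (seq x n) (seq y n)

  ⊕-identityˡ : ∀ x → ↑ 0ℚ ⊕ x ≋ x
  ⊕-identityˡ x = ≋-pointwise λ n → ℚ.+-identityˡ (seq x n)

  ⊕-identityʳ : ∀ x → x ⊕ ↑ 0ℚ ≋ x
  ⊕-identityʳ x = ≋-pointwise λ n → ℚ.+-identityʳ (seq x n)

  ⊕-inverseˡ : ∀ x → ⊝ x ⊕ x ≋ ↑ 0ℚ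
  ⊕-inverseˡ x = ≋-pointwise λ n → ℚ.+-inverseˡ (seq x n)

  ⊕-inverseʳ : ∀ x → x ⊕ ⊝ x ≋ ↑ 0ℚ
  ⊕-inverseʳ x = ≋-pointwise λ n → ℚ.+-inverseʳ (seq x n)

  ⊗-assoc : ∀ x y z → (x ⊗ y) ⊗ z ≋ x ⊗ (y ⊗ z)
  ⊗-assoc x y z = ≋-pointwise λ n → ℚ.*-assoc (seq x n) (seq y n) (seq z n)

  ⊗-comm : ∀ x y → x ⊗ y ≋ y ⊗ x
  ⊗-comm x y = ≋-pointwise λ n → ℚ.*-comm (seq x n) (seq y n)

  ⊗-identityˡ : ∀ x → ↑ 1ℚ ⊗ x ≋ x
  ⊗-identityˡ x = ≋-pointwise λ n → ℚ.*-identityˡ (seq x n)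

  ⊗-identityʳ : ∀ x → x ⊗ ↑ 1ℚ ≋ x
  ⊗-identityʳ x = ≋-pointwise λ n → ℚ.*-identityʳ (seq x n)

  ⊗-distribˡ : ∀ x y z → x ⊗ (y ⊕ z) ≋ x ⊗ y ⊕ x ⊗ z
  ⊗-distribˡ x y z = ≋-pointwise λ n → ℚ.*-distribˡ-+ (seq x n) (seq y n) (seq z n)

  ⊗-distribʳ : ∀ x y z → (y ⊕ z) ⊗ x ≋ y ⊗ x ⊕ z ⊗ x
  ⊗-distribʳ x y z = ≋-pointwise λ n → ℚ.*-distribʳ-+ (seq x n) (seq y n) (seq z n)

  ⊗-cong : ∀ {x y u v} → x ≋ y → u ≋ v → x ⊗ u ≋ y ⊗ v
  ⊗-cong {x} {y} {u} {v} (p & q) (r & s) = le {x} {y} {u} {v} p q r s & le {y} {x} {v} {u} q p s r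
    where
    le : ∀ {x y u v} → x ≼ y → y ≼ x → u ≼ v → v ≼ u → x * u ≼ y * v
    le {x} {y} {u} {v} p q r s =
      ≼-trans {x * u} {x * v} {y * v} (*-congʳ-≼ x {u} {v} r s)
        (≼-trans {x * v} {v * x} {y * v} (≼-reflexive {x * v} {v * x} λ n → ℚ.*-comm (seq x n) (seq v n))
        (≼-trans {v * x} {v * y} {y * v} (*-congʳ-≼ v {x} {y} p q)
          (≼-reflexive {v * y} {y * v} λ n → ℚ.*-comm (seq v n) (seq y n))))

≼-archimedean↑ : ∀ {x y} c → (∀ k → x ≼ y ⊕ ↑ (c *ℚ 2⁻ k)) → x ≼ y
≼-archimedean↑ {x} {y} c h = ≼-archimedean-2⁻ {x} {y} c λ k →
  ≼-trans (h k) (≼-trans (≋⇒≽ (+≋⊕ y (↑ (c *ℚ 2⁻ k))))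
    (+-mono-≼ {y} {y} {↑ (c *ℚ 2⁻ k)} {fromℚ (c *ℚ 2⁻ k)} ≼-refl (≋⇒≽ (fromℚ≋↑ (c *ℚ 2⁻ k)))))

inverse : ∀ x {δ} → 0ℚ <ℚ δ → ↑ δ ≼ x → Σ[ v ∈ ℝ ] (↑ 0ℚ ≼ v × x ⊗ v ≋ ↑ 1ℚ)
inverse x {δ} 0<δ δ≼x =
  let (N , h) = bounded-shift x 0<δ (≼-trans (≋⇒≼ (fromℚ≋↑ δ)) δ≼x)
  in build N (inverse-of-bounded (shift x N) (0<½* 0<δ) h)
  where
  build : ∀ N → Σ[ v ∈ ℝ ] ((∀ n → seq (shift x N) n *ℚ seq v n ≡ 1ℚ) × (∀ n → 0ℚ ≤ℚ seq v n)) →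
          Σ[ v ∈ ℝ ] (↑ 0ℚ ≼ v × x ⊗ v ≋ ↑ 1ℚ)
  build N (v , xv≡1 , 0≤v) = v ,
    ≼-trans (≋⇒≽ (fromℚ≋↑ 0ℚ)) (≼-pointwise {0ʳ} {v} 0≤v) ,
    ≋-trans (⊗-cong {x} {shift x N} {v} {v} (≼-shift x N & shift-≼ x N) ≋-refl)
      (≋-trans (≋-sym (*≋⊗ (shift x N) v))
        (≋-trans (≋-pointwise {shift x N * v} {1ʳ} xv≡1) (fromℚ≋↑ 1ℚ)))

⊕-cong : ∀ {x y u v} → x ≋ y → u ≋ v → x ⊕ u ≋ y ⊕ v
⊕-cong (p & q) (r & s) = ⊕-mono p r & ⊕-mono q s

⊝-cong : ∀ {x y} → x ≋ y → ⊝ x ≋ ⊝ y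
⊝-cong (p & q) = ⊝-anti q & ⊝-anti p

ℝ-commutativeRing : CommutativeRing 0ℓ 0ℓ
ℝ-commutativeRing = record
  { Carrier = ℝ ; _≈_ = _≋_ ; _+_ = _⊕_ ; _*_ = _⊗_ ; -_ = ⊝_ ; 0# = ↑ 0ℚ ; 1# = ↑ 1ℚ
  ; isCommutativeRing = record
    { isRing = record
      { +-isAbelianGroup = record
        { isGroup = record
          { isMonoid = record
            { isSemigroup = record
              { isMagma = record
                { isEquivalence = record { refl = ≋-refl ; sym = ≋-sym ; trans = ≋-trans }
                ; ∙-cong = ⊕-cong }
              ; assoc = ⊕-assoc }
            ; identity = ⊕-identityˡ , ⊕-identityʳ }
          ; inverse = ⊕-inverseˡ , ⊕-inverseʳ
          ; ⁻¹-cong = ⊝-cong }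
        ; comm = ⊕-comm }
      ; *-cong = ⊗-cong
      ; *-assoc = ⊗-assoc
      ; *-identity = ⊗-identityˡ , ⊗-identityʳ
      ; distrib = ⊗-distribˡ , ⊗-distribʳ }
    ; *-comm = ⊗-comm } }

ℝ-ring : ACR.AlmostCommutativeRing 0ℓ 0ℓ
ℝ-ring = ACR.fromCommutativeRing ℝ-commutativeRing

↑-homomorphism : ℚ.+-*-rawRing ACR.-Raw-AlmostCommutative⟶ ℝ-ring
↑-homomorphism = record
  { ⟦_⟧ = ↑ ; +-homo = ↑-+ ; *-homo = ↑-* ; -‿homo = ↑-⊝ ; 0-homo = ≋-refl ; 1-homo = ≋-refl }

coefficient-≟ : WeaklyDecidable (ACR.Induced-equivalence ↑-homomorphism)
coefficient-≟ p q with p ℚ.≟ q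
... | yes refl = just ≋-refl
... | no _     = nothing

module R = RingSolver ℚ.+-*-rawRing ℝ-ring ↑-homomorphism coefficient-≟

open R public using () renaming
  (_:+_ to _:⊕_; _:*_ to _:⊗_; _:-_ to _:⊖_; :-_ to :⊝_; con to :↑)

infix 4 _:≋_
_:≋_ : ∀ {n} → R.Polynomial n → R.Polynomial n → R.Polynomial n × R.Polynomial n
_:≋_ = _,_

closeʳ : ∀ n → N-ary n (R.Polynomial n) (R.Polynomial n × R.Polynomial n) →
         R.Polynomial n × R.Polynomial n
closeʳ n f = f $ⁿ Vec.map R.var (Vec.allFin n)

ringʳ : ∀ n (f : N-ary n (R.Polynomial n) (R.Polynomial n × R.Polynomial n)) →
        R.normalise (proj₁ (closeʳ n f)) ≡ R.normalise (proj₂ (closeʳ n f)) →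
        (ρ : Vec ℝ n) → R.⟦ proj₁ (closeʳ n f) ⟧ ρ ≋ R.⟦ proj₂ (closeʳ n f) ⟧ ρ
ringʳ n f eq ρ = R.prove ρ (proj₁ (closeʳ n f)) (proj₂ (closeʳ n f))
  (subst (λ z → R.⟦ R.normalise (proj₁ (closeʳ n f)) ⟧N ρ ≋ R.⟦ z ⟧N ρ) eq ≋-refl)

linear : ∀ {x y z w} → x ≼ y → w ⊖ z ≋ y ⊖ x → z ≼ w
linear {x} {y} {z} {w} x≼y e =
  ≼-trans (≋⇒≼ (ringʳ 2 (λ x z → z :≋ x :⊕ (z :⊖ x)) refl (x ∷ z ∷ [])))
    (≼-trans (⊕-mono x≼y (≼-refl {z ⊖ x}))
      (≼-trans (≋⇒≼ (ringʳ 3 (λ x y z → y :⊕ (z :⊖ x) :≋ (y :⊖ x) :⊕ z) refl (x ∷ y ∷ z ∷ [])))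
        (≼-trans (⊕-mono (≋⇒≽ e) (≼-refl {z}))
          (≋⇒≼ (ringʳ 2 (λ z w → (w :⊖ z) :⊕ z :≋ w) refl (z ∷ w ∷ []))))))

-- Names of points

¼ ¾ : ℚ
¼ = ½ *ℚ ½
¾ = ½ +ℚ ¼

0≤½ : 0ℚ ≤ℚ ½
0≤½ = ℚ.<⇒≤ (ℚ.positive⁻¹ ½)

0≤¼ : 0ℚ ≤ℚ ¼
0≤¼ = ℚ.<⇒≤ (ℚ.positive⁻¹ ¼)

≼-resp : ∀ {x x′ y y′} → x ≋ x′ → y ≋ y′ → x ≼ y → x′ ≼ y′
≼-resp e f x≼y = ≼-trans (≋⇒≽ e) (≼-trans x≼y (≋⇒≼ f))

↑-cong : ∀ {p q} → p ≡ q → ↑ p ≋ ↑ q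
↑-cong refl = ≋-refl

record Close (x y : ℝ) (e : ℚ) : Set where
  constructor mkClose
  field
    close-≼ : x ≼ y ⊕ ↑ e
    close-≽ : y ≼ x ⊕ ↑ e
open Close public

close-sym : ∀ {x y e} → Close x y e → Close y x e
close-sym (mkClose p q) = mkClose q p

close-refl : ∀ {x e} → 0ℚ ≤ℚ e → Close x x e
close-refl {x} {e} 0≤e = mkClose le le
  where
  le : x ≼ x ⊕ ↑ e
  le = ≼-trans (≋⇒≽ (⊕-identityʳ x)) (⊕-mono ≼-refl (↑-mono 0≤e))

close-mono : ∀ {x y e f} → e ≤ℚ f → Close x y e → Close x y f
close-mono e≤f (mkClose p q) = mkClose
  (≼-trans p (⊕-mono ≼-refl (↑-mono e≤f))) (≼-trans q (⊕-mono ≼-refl (↑-mono e≤f)))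

≼-⊕-trans : ∀ {x y z e f} → x ≼ y ⊕ ↑ e → y ≼ z ⊕ ↑ f → x ≼ z ⊕ ↑ (e +ℚ f)
≼-⊕-trans {x} {y} {z} {e} {f} p q = ≼-trans p (≼-trans (⊕-mono q (≼-refl {↑ e}))
  (≼-trans (≋⇒≼ (ringʳ 3 (λ z e f → (z :⊕ f) :⊕ e :≋ z :⊕ (e :⊕ f)) refl (z ∷ ↑ e ∷ ↑ f ∷ [])))
    (⊕-mono (≼-refl {z}) (≋⇒≽ (↑-+ e f)))))

close-trans : ∀ {x y z e f} → Close x y e → Close y z f → Close x z (e +ℚ f)
close-trans {x} {y} {z} {e} {f} (mkClose p q) (mkClose r s) = mkClose (≼-⊕-trans p r)
  (subst (λ d → z ≼ x ⊕ ↑ d) (ℚ.+-comm f e) (≼-⊕-trans s q))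

≼-⊕-reflect : ∀ {p q e} → ↑ p ≼ ↑ q ⊕ ↑ e → p ≤ℚ q +ℚ e
≼-⊕-reflect {p} {q} {e} h = ↑-reflect (≼-trans h (≋⇒≽ (↑-+ q e)))

Approx : (ℕ → ℚ) → Baire → ℝ → Set
Approx ρ ζ x = ∀ n → Close x (↑ (dyadic (ζ n) n)) (ρ n)

Tight : Baire → ℝ → Set
Tight = Approx (λ n → ¾ *ℚ 2⁻ n)

module _ {ζ : Baire} {x : ℝ} where

  name⇒approx : IntervalName ζ x → Approx 2⁻_ ζ x
  name⇒approx h n =
    let d = dyadic (ζ n) n
        ↑-split =
          ≋-trans (fromℚ≋↑ (d -ℚ 2⁻ n)) (≋-trans (↑-+ d (-ℚ 2⁻ n)) (⊕-cong ≋-refl (↑-⊝ (2⁻ n))))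
    in mkClose
      (≼-resp ≋-refl (≋-trans (fromℚ≋↑ (d +ℚ 2⁻ n)) (↑-+ d (2⁻ n))) (≤⇒≼ (proj₂ (h n))))
      (linear (≼-resp ↑-split ≋-refl (≤⇒≼ (proj₁ (h n))))
        (ringʳ 3 (λ x d r → (x :⊕ r) :⊖ d :≋ x :⊖ (d :⊖ r)) refl (x ∷ ↑ d ∷ ↑ (2⁻ n) ∷ [])))

  approx⇒name : Approx 2⁻_ ζ x → IntervalName ζ x
  approx⇒name h n =
    let d = dyadic (ζ n) n
        ↑-split =
          ≋-trans (fromℚ≋↑ (d -ℚ 2⁻ n)) (≋-trans (↑-+ d (-ℚ 2⁻ n)) (⊕-cong ≋-refl (↑-⊝ (2⁻ n))))
    in ≼⇒≤ (≼-trans (≋⇒≼ ↑-split) (linear (close-≽ (h n))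
         (ringʳ 3 (λ x d r → x :⊖ (d :⊖ r) :≋ (x :⊕ r) :⊖ d) refl (x ∷ ↑ d ∷ ↑ (2⁻ n) ∷ [])))) ,
       ≼⇒≤ (≼-resp ≋-refl (≋-sym (≋-trans (fromℚ≋↑ (d +ℚ 2⁻ n)) (↑-+ d (2⁻ n)))) (close-≼ (h n)))

¾2⁻≤2⁻ : ∀ n → ¾ *ℚ 2⁻ n ≤ℚ 2⁻ n
¾2⁻≤2⁻ n = rearrangeℚ (*-nonnegℚ {¼} {2⁻ n} 0≤¼ (0≤2⁻ n))
  (ring 1 (λ h → h :- con ¾ :* h := con ¼ :* h :- con 0ℚ) refl (2⁻ n ∷ []))

tight⇒approx : ∀ {ζ x} → Tight ζ x → Approx 2⁻_ ζ x
tight⇒approx h n = close-mono (¾2⁻≤2⁻ n) (h n)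

approx-close : ∀ {ρ σ ζ ξ x y} n → ζ n ≡ ξ n → Approx ρ ζ x → Approx σ ξ y →
               Close x y (ρ n +ℚ σ n)
approx-close {σ = σ} {y = y} n e h k =
  close-trans (h n) (close-sym (subst (λ m → Close y (↑ (dyadic m n)) (σ n)) (sym e) (k n)))

0≤dyadic : ∀ m n → 0ℚ ≤ℚ dyadic m n
0≤dyadic m n = *-nonnegℚ (0≤ι m) (0≤2⁻ n)

0≼value : ∀ x → ↑ 0ℚ ≼ value x
0≼value x = ≼-trans (≋⇒≽ (fromℚ≋↑ 0ℚ)) (≤⇒≼ (0≤ x))

value≼1 : ∀ x → value x ≼ ↑ 1ℚ
value≼1 x = ≼-trans (≤⇒≼ (≤1 x)) (≋⇒≼ (fromℚ≋↑ 1ℚ))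

unit-interval : ∀ x → ↑ 0ℚ ≼ x → x ≼ ↑ 1ℚ → UnitInterval
unit-interval x 0≼x x≼1 =
  unit x (≼⇒≤ (≼-trans (≋⇒≼ (fromℚ≋↑ 0ℚ)) 0≼x)) (≼⇒≤ (≼-trans x≼1 (≋⇒≽ (fromℚ≋↑ 1ℚ))))

dyadic-sequence : ∀ (d : ℕ → ℚ) → (∀ m n → d m ≤ℚ d n +ℚ (2⁻ m +ℚ 2⁻ n)) → Cauchy d
dyadic-sequence d below ε 0<ε =
  let (N , 2⁻N≤) = 2⁻-small (½ *ℚ ε) (0<½* 0<ε)
      le : ∀ m n → N ℕ.≤ m → N ℕ.≤ n → d m ≤ℚ d n +ℚ ε
      le m n N≤m N≤n = step {d m} {d n} {2⁻ m} {2⁻ n} {ε} (below m n) (ℚ.≤-trans (2⁻-antitone N≤m) 2⁻N≤)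
                                        (ℚ.≤-trans (2⁻-antitone N≤n) 2⁻N≤)
  in N , λ m n N≤m N≤n → two-sided (le m n N≤m N≤n) (le n m N≤n N≤m)
  where
  step : ∀ {a b g h e} → a ≤ℚ b +ℚ (g +ℚ h) → g ≤ℚ ½ *ℚ e → h ≤ℚ ½ *ℚ e → a ≤ℚ b +ℚ e
  step {a} {b} {g} {h} {e} p q r = rearrangeℚ (ℚ.+-mono-≤ p (ℚ.+-mono-≤ q r))
    (ring 5 (λ a b g h e → (b :+ e) :- a :=
       ((b :+ (g :+ h)) :+ (con ½ :* e :+ con ½ :* e)) :- (a :+ (g :+ h))) refl
      (a ∷ b ∷ g ∷ h ∷ e ∷ []))
  two-sided : ∀ {a b e} → a ≤ℚ b +ℚ e → b ≤ℚ a +ℚ e → ∣ a -ℚ b ∣ ≤ℚ e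
  two-sided {a} {b} {e} p q = ∣∣≤
    (rearrangeℚ p (ring 3 (λ a b e → e :- (a :- b) := (b :+ e) :- a) refl (a ∷ b ∷ e ∷ [])))
    (rearrangeℚ q (ring 3 (λ a b e → (a :- b) :- (:- e) := (a :+ e) :- b) refl (a ∷ b ∷ e ∷ [])))

limit-≼ : ∀ z q r → (∀ n → seq z n ≤ℚ (q +ℚ r) +ℚ 2⁻ n) → z ≼ ↑ q ⊕ ↑ r
limit-≼ z q r h = ≼-trans {z} {fromℚ (q +ℚ r)}
  (≤⇒≼ λ ε 0<ε →
    let (N , 2⁻N≤) = 2⁻-small ε 0<ε
    in N , λ n N≤n → ℚ.≤-trans (h n) (ℚ.+-monoʳ-≤ (q +ℚ r) (ℚ.≤-trans (2⁻-antitone N≤n) 2⁻N≤)))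
  (≋⇒≼ (≋-trans (fromℚ≋↑ (q +ℚ r)) (↑-+ q r)))

limit-≽ : ∀ z q r → (∀ n → q ≤ℚ (seq z n +ℚ r) +ℚ 2⁻ n) → ↑ q ≼ z ⊕ ↑ r
limit-≽ z q r h = ≼-trans (≋⇒≽ (fromℚ≋↑ q)) (≼-trans {fromℚ q} {z + fromℚ r}
  (≤⇒≼ λ ε 0<ε →
    let (N , 2⁻N≤) = 2⁻-small ε 0<ε
    in N , λ n N≤n → ℚ.≤-trans (h n) (ℚ.+-monoʳ-≤ (seq z n +ℚ r) (ℚ.≤-trans (2⁻-antitone N≤n) 2⁻N≤)))
  (≼-trans (+-mono-≼ {z} {z} {fromℚ r} {↑ r} ≼-refl (≋⇒≼ (fromℚ≋↑ r))) (≋⇒≼ (+≋⊕ z (↑ r)))))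

-- The dyadic numbers coded by `ζ` form the limit point themselves. Any two of them occur in a
-- common prefix, which begins a name of some point, so they are compatible with each other. The
-- radius `ρ` is a parameter because both tight and ordinary names are needed.
limit-name : ∀ {ρ ζ} → (∀ n → ρ n ≤ℚ 2⁻ n) →
  (∀ N → ∃[ ξ ] ∃[ x ] (Agree N ζ ξ × Approx ρ ξ (value x))) →
  Σ[ x ∈ UnitInterval ] Approx ρ ζ (value x)
limit-name {ρ} {ζ} ρ≤ near =
  unit-interval z
    (≼-trans (≋⇒≽ (fromℚ≋↑ 0ℚ)) (≼-pointwise {0ʳ} {z} λ n → 0≤dyadic (ζ n) n))
    (≼-trans (limit-≼ z 1ℚ 0ℚ below-1) (≋⇒≼ (⊕-identityʳ (↑ 1ℚ)))) ,
  λ n → mkClose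
    (limit-≼ z (d n) (ρ n) λ m → swap {d m} {d n} {2⁻ m} {ρ n} (ℚ.≤-trans (below m n) (ℚ.+-monoʳ-≤ (d n) (ℚ.+-monoˡ-≤ (ρ n) (ρ≤ m)))))
    (limit-≽ z (d n) (ρ n) λ m → ℚ.≤-trans (below n m)
      (assoc (d m) (ρ n) (ρ≤ m)))
  where
  d : ℕ → ℚ
  d n = dyadic (ζ n) n
  swap : ∀ {a b g h} → a ≤ℚ b +ℚ (g +ℚ h) → a ≤ℚ (b +ℚ h) +ℚ g
  swap {a} {b} {g} {h} p = rearrangeℚ p
    (ring 4 (λ a b g h → ((b :+ h) :+ g) :- a := (b :+ (g :+ h)) :- a) refl (a ∷ b ∷ g ∷ h ∷ []))
  assoc : ∀ b g {h k} → h ≤ℚ k → b +ℚ (g +ℚ h) ≤ℚ (b +ℚ g) +ℚ k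
  assoc b g {h} {k} p = rearrangeℚ p
    (ring 4 (λ b g h k → ((b :+ g) :+ k) :- (b :+ (g :+ h)) := k :- h) refl (b ∷ g ∷ h ∷ k ∷ []))
  below : ∀ m n → d m ≤ℚ d n +ℚ (ρ m +ℚ ρ n)
  below m n =
    let (ξ , x , a , h) = near (suc (m ⊔ n))
        c : ∀ k → k ℕ.< suc (m ⊔ n) → Close (value x) (↑ (d k)) (ρ k)
        c k k< = subst (λ e → Close (value x) (↑ (dyadic e k)) (ρ k)) (sym (a k k<)) (h k)
    in ≼-⊕-reflect (close-≼ (close-trans (close-sym (c m (ℕ.s≤s (ℕ.m≤m⊔n m n))))
                                         (c n (ℕ.s≤s (ℕ.m≤n⊔m m n)))))
  z : ℝ
  z = real d (dyadic-sequence d λ m n →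
    ℚ.≤-trans (below m n) (ℚ.+-monoʳ-≤ (d n) (ℚ.+-mono-≤ (ρ≤ m) (ρ≤ n))))
  below-1 : ∀ n → d n ≤ℚ (1ℚ +ℚ 0ℚ) +ℚ 2⁻ n
  below-1 n =
    let (ξ , x , a , h) = near (suc n)
        c = subst (λ e → Close (value x) (↑ (dyadic e n)) (ρ n)) (sym (a n (ℕ.n<1+n n))) (h n)
    in ℚ.≤-trans (≼-⊕-reflect {q = 1ℚ} (≼-trans (close-≽ c) (⊕-mono (value≼1 x) (≼-refl {↑ (ρ n)}))))
         (ℚ.+-monoʳ-≤ 1ℚ (ρ≤ n))

-- Rounding the approximation with two more binary digits.
tighten : ∀ {η x} → Approx 2⁻_ η x → ∃[ ζ ] Tight ζ x
tighten {η} {x} h = ζ , λ n →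
  subst (λ e → Close x (↑ (dyadic (ζ n) n)) e) (total (2⁻ n))
    (close-trans (h (2 ℕ.+ n)) (rounded n (η (2 ℕ.+ n))))
  where
  ζ : Baire
  ζ n = (η (2 ℕ.+ n) ℕ.+ 2) ℕ./ 4
  total : ∀ h → ½ *ℚ (½ *ℚ h) +ℚ ½ *ℚ h ≡ ¾ *ℚ h
  total h = ring 1 (λ h → con ½ :* (con ½ :* h) :+ con ½ :* h := con ¾ :* h) refl (h ∷ [])
  round : ∀ m → let q = (m ℕ.+ 2) ℕ./ 4 in
          ι m ≤ℚ ι 4 *ℚ ι q +ℚ ι 2 × ι 4 *ℚ ι q ≤ℚ ι m +ℚ ι 2
  round m = round′ ((m ℕ.+ 2) ℕ.% 4) ((m ℕ.+ 2) ℕ./ 4) (ℕ.m%n<n (m ℕ.+ 2) 4) (ℕ.m≡m%n+[m/n]*n (m ℕ.+ 2) 4)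
    where
    round′ : ∀ r q → r ℕ.< 4 → m ℕ.+ 2 ≡ r ℕ.+ q ℕ.* 4 →
             ι m ≤ℚ ι 4 *ℚ ι q +ℚ ι 2 × ι 4 *ℚ ι q ≤ℚ ι m +ℚ ι 2
    round′ r q r<4 eq =
      rearrangeℚ up (ring 2 (λ q m → (con (ι 4) :* q :+ con (ι 2)) :- m :=
        (con (ι 4) :* q :+ con (ι 4)) :- (m :+ con (ι 2))) refl (ι q ∷ ι m ∷ [])) ,
      subst (ι 4 *ℚ ι q ≤ℚ_) (sym eqℚ)
        (rearrangeℚ (0≤ι r)
          (ring 2 (λ q r → (r :+ q :* con (ι 4)) :- con (ι 4) :* q := r :- con 0ℚ) refl
            (ι q ∷ ι r ∷ [])))
      where
      eqℚ : ι m +ℚ ι 2 ≡ ι r +ℚ ι q *ℚ ι 4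
      eqℚ = trans (sym (ι-+ m 2)) (trans (cong ι eq)
        (trans (ι-+ r (q ℕ.* 4)) (cong (ι r +ℚ_) (ι-* q 4))))
      up : ι m +ℚ ι 2 ≤ℚ ι 4 *ℚ ι q +ℚ ι 4
      up = subst (_≤ℚ ι 4 *ℚ ι q +ℚ ι 4) (sym eqℚ)
        (rearrangeℚ (ι-mono (ℕ.<⇒≤ r<4))
          (ring 2 (λ q r → (con (ι 4) :* q :+ con (ι 4)) :- (r :+ q :* con (ι 4)) :=
             con (ι 4) :- r) refl (ι q ∷ ι r ∷ [])))
  scaled : ∀ {a b h} → a ≤ℚ b → 0ℚ ≤ℚ h → (¼ *ℚ h) *ℚ a ≤ℚ (¼ *ℚ h) *ℚ b
  scaled a≤b 0≤h = *-monoʳ-≤ℚ (*-nonnegℚ 0≤¼ 0≤h) a≤b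
  lower : ∀ q m h → ι 4 *ℚ q ≤ℚ m +ℚ ι 2 → 0ℚ ≤ℚ h →
          q *ℚ h ≤ℚ m *ℚ (½ *ℚ (½ *ℚ h)) +ℚ ½ *ℚ h
  lower q m h le 0≤h = rearrangeℚ (scaled le 0≤h)
    (ring 3 (λ q m h →
      (m :* (con ½ :* (con ½ :* h)) :+ con ½ :* h) :- q :* h :=
      (con ¼ :* h) :* (m :+ con (ι 2)) :- (con ¼ :* h) :* (con (ι 4) :* q)) refl (q ∷ m ∷ h ∷ []))
  upper : ∀ q m h → m ≤ℚ ι 4 *ℚ q +ℚ ι 2 → 0ℚ ≤ℚ h →
          m *ℚ (½ *ℚ (½ *ℚ h)) ≤ℚ q *ℚ h +ℚ ½ *ℚ h
  upper q m h le 0≤h = rearrangeℚ (scaled le 0≤h)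
    (ring 3 (λ q m h →
      (q :* h :+ con ½ :* h) :- m :* (con ½ :* (con ½ :* h)) :=
      (con ¼ :* h) :* (con (ι 4) :* q :+ con (ι 2)) :- (con ¼ :* h) :* m) refl (q ∷ m ∷ h ∷ []))
  rounded : ∀ n m → Close (↑ (dyadic m (2 ℕ.+ n))) (↑ (dyadic ((m ℕ.+ 2) ℕ./ 4) n)) (½ *ℚ 2⁻ n)
  rounded n m =
    let q = (m ℕ.+ 2) ℕ./ 4
        (a , b) = round m
    in mkClose
      (≼-trans (↑-mono (upper (ι q) (ι m) (2⁻ n) a (0≤2⁻ n))) (≋⇒≼ (↑-+ (dyadic q n) (½ *ℚ 2⁻ n))))
      (≼-trans (↑-mono (lower (ι q) (ι m) (2⁻ n) b (0≤2⁻ n))) (≋⇒≼ (↑-+ (dyadic m (2 ℕ.+ n)) (½ *ℚ 2⁻ n))))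

interval-name : ∀ (x : UnitInterval) → ∃[ η ] Approx 2⁻_ η (value x)
interval-name x = let (η , h) = RepresentedSpace.surjective 𝕀 x in η , name⇒approx h

tight-name : ∀ (x : UnitInterval) → ∃[ ζ ] Tight ζ (value x)
tight-name x = tighten (proj₂ (interval-name x))

-- A numerator over `2 ^ n` that approximates a point of the unit interval up to `2⁻ n` is at most
-- `2 ^ n + 1`. Names thus form a finitely branching tree, to which `cluster` applies.
name-bound : ℕ → ℕ
name-bound n = suc (2 ℕ.^ n)

approx-bounded : ∀ {ζ x} → Approx 2⁻_ ζ (value x) → ∀ n → ζ n ℕ.≤ name-bound n
approx-bounded {ζ} {x} h n with ζ n ℕ.≤? name-bound n
... | yes le = le
... | no ¬le =
  let le = ≼-⊕-reflect {q = 1ℚ} (≼-trans (close-≽ (h n)) (⊕-mono (value≼1 x) (≼-refl {↑ (2⁻ n)})))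
  in contradiction (0<2⁻ n) (≤⇒≯ℚ (big (ι (2 ℕ.^ n)) (ι (ζ n)) (2⁻ n) (2^*2⁻ n)
       (subst (_≤ℚ ι (ζ n)) (ι-+ 2 (2 ℕ.^ n)) (ι-mono (ℕ.≰⇒> ¬le))) (0≤2⁻ n) le))
  where
  big : ∀ a z h → a *ℚ h ≡ 1ℚ → ι 2 +ℚ a ≤ℚ z → 0ℚ ≤ℚ h → z *ℚ h ≤ℚ 1ℚ +ℚ h → h ≤ℚ 0ℚ
  big a z h ah≡1 2+a≤z 0≤h le =
    rearrangeℚ (ℚ.+-mono-≤ (*-monoʳ-≤ℚ 0≤h 2+a≤z) (subst (λ e → z *ℚ h ≤ℚ e +ℚ h) (sym ah≡1) le))
      (ring 3 (λ a z h → con 0ℚ :- h :=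
        (h :* z :+ (a :* h :+ h)) :- (h :* (con (ι 2) :+ a) :+ z :* h)) refl (a ∷ z ∷ h ∷ []))

switch : ∀ {a} {A : Set a} → ℕ → (ℕ → A) → (ℕ → A) → ℕ → A
switch N p q i with i ℕ.<? N
... | yes _ = p i
... | no _  = q i

switch-agree : ∀ {a} {A : Set a} N (p q : ℕ → A) → Agree N p (switch N p q)
switch-agree N p q i i<N with i ℕ.<? N
... | yes _ = refl
... | no ¬h = contradiction i<N ¬h

switch-elim : ∀ {a} {A : Set a} (P : A → Set) N (p q : ℕ → A) i →
              (i ℕ.< N → P (p i)) → (N ℕ.≤ i → P (q i)) → P (switch N p q i)
switch-elim P N p q i f g with i ℕ.<? N
... | yes i<N = f i<N
... | no i≮N  = g (ℕ.≮⇒≥ i≮N)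

-- The slack of tight names: without it a finite prefix of a name of x need
-- not begin a name of any other point.
tight-neighbourhood : ∀ {ζ x} (y : UnitInterval) N → Tight ζ x →
  Close x (value y) (¼ *ℚ 2⁻ N) → ∃[ ξ ] (Agree N ζ ξ × Approx 2⁻_ ξ (value y))
tight-neighbourhood {ζ} {x} y N h c = switch N ζ η , switch-agree N ζ η , named
  where
  η = proj₁ (interval-name y)
  named : Approx 2⁻_ (switch N ζ η) (value y)
  named n = switch-elim (λ m → Close (value y) (↑ (dyadic m n)) (2⁻ n)) N ζ η n
    (λ n<N → close-mono (sum (2⁻ n) (2⁻ N) (2⁻-antitone (ℕ.<⇒≤ n<N)))
                        (close-trans (close-sym c) (h n)))
    (λ _ → proj₂ (interval-name y) n)
    where
    sum : ∀ h k → k ≤ℚ h → ¼ *ℚ k +ℚ ¾ *ℚ h ≤ℚ h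
    sum h k k≤h = rearrangeℚ (*-monoʳ-≤ℚ {k} {h} {¼} 0≤¼ k≤h)
      (ring 2 (λ h k → h :- (con ¼ :* k :+ con ¾ :* h) := con ¼ :* h :- con ¼ :* k) refl (h ∷ k ∷ []))

-- Realizers of choice on intervals

Names : (X : RepresentedSpace) → Baire → Carrier X → Set
Names X = RepresentedSpace._names_ X

-- A nonzero output entry is the Sierpiński value true for the complement: the point named by `ζ` is
-- recognised as lying outside the set.
Rejects : Baire → Baire → Set
Rejects h ζ = ∃[ n ] ∃[ m ] AppliesAt h ζ n (suc m)

agree-applyUpTo : ∀ {ζ ξ : Baire} k → Agree k ζ ξ → applyUpTo ζ k ≡ applyUpTo ξ k
agree-applyUpTo zero    a = refl
agree-applyUpTo (suc k) a =
  cong₂ _∷_ (a 0 (ℕ.s≤s ℕ.z≤n)) (agree-applyUpTo k λ i i<k → a (suc i) (ℕ.s≤s i<k))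

-- A rejection reads `use` entries of `ζ` and the entries of `h` at the codes of the prefixes up to
-- that length.
rejects-open : ∀ {h ζ} → Rejects h ζ →
  ∃[ N ] (∀ h′ ζ′ → Agree N h h′ → Agree N ζ ζ′ → Rejects h′ ζ′)
rejects-open {h} {ζ} (n , m , appliesAt use answer waiting) =
  let (N , bound) = uniform {λ j N → encode (n ∷ applyUpTo ζ j) ℕ.< N} (λ M≤N <M → ℕ.<-≤-trans <M M≤N)
                      (suc use) (λ j _ → _ , ℕ.n<1+n _)
  in N ⊔ use , λ h′ ζ′ a b →
    let eq : ∀ j → j ℕ.≤ use → h′ (encode (n ∷ applyUpTo ζ′ j)) ≡ h (encode (n ∷ applyUpTo ζ j))
        eq j j≤ = trans (cong (λ l → h′ (encode (n ∷ l)))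
                    (sym (agree-applyUpTo j (agree-≤ (ℕ.≤-trans j≤ (ℕ.m≤n⊔m N use)) b))))
                  (sym (a _ (ℕ.<-≤-trans (bound j (ℕ.s≤s j≤)) (ℕ.m≤m⊔n N use))))
    in n , m , appliesAt use (trans (eq use ℕ.≤-refl) answer)
                 (λ j j<use → trans (eq j (ℕ.<⇒≤ j<use)) (waiting j j<use))

rejects-resp : ∀ {h h′ ζ ζ′} → h ≗ h′ → ζ ≗ ζ′ → Rejects h ζ → Rejects h′ ζ′
rejects-resp h≗ ζ≗ (n , m , a) = n , m , AppliesAt-resp h≗ ζ≗ refl a

module _ {X : RepresentedSpace} {h ζ} {A : Carrier (𝒜 X)} {x : Carrier X}
         (hA : Names (𝒜 X) h A) (ζx : Names X ζ x) where
  private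
    module X = RepresentedSpace X
    run = hA ζ x ζx (_ , refl)

  ∈⇒¬rejects : _∈_ {X} x A → ¬ Rejects h ζ
  ∈⇒¬rejects x∈A (n , m , a) = absurd run
    where
    absurd : ∃[ r ] ((h · ↦ ζ) r × ∃[ y ] (SierpińskiName r y × Continuous.to A x ≡ y)) → _
    absurd (r , hζ , false , r≡0 , _) =
      contradiction (trans (AppliesAt-unique a (hζ n)) (r≡0 n)) λ ()
    absurd (r , hζ , true , _ , e) = contradiction (trans (sym x∈A) e) λ ()

  ¬rejects⇒∈ : ¬ Rejects h ζ → _∈_ {X} x A
  ¬rejects⇒∈ ¬rej = go run
    where
    go : ∃[ r ] ((h · ↦ ζ) r × ∃[ y ] (SierpińskiName r y × Continuous.to A x ≡ y)) → _∈_ {X} x A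
    go (r , hζ , false , _ , e) = e
    go (r , hζ , true , (n , rn≢0) , _) = contradiction (rejecting (r n) refl) ¬rej
      where
      rejecting : ∀ k → r n ≡ k → Rejects h ζ
      rejecting zero    e = contradiction e rn≢0
      rejecting (suc k) e = n , k , subst (AppliesAt h ζ n) e (hζ n)

-- Phrased by rejection rather than by membership in a set named by `h`, the relation makes sense
-- for all `h` and is closed in both arguments.
Point : Baire → Baire → Set
Point h ζ = Σ[ x ∈ UnitInterval ] (Approx 2⁻_ ζ (value x) × ¬ Rejects h ζ)

point-resp : ∀ {h h′ ζ} → h ≗ h′ → Point h ζ → Point h′ ζ
point-resp h≗ (x , ζx , ¬rej) = x , ζx , ¬rej ∘ rejects-resp (sym ∘ h≗) (λ _ → refl)

point-closed : ∀ {h ζ} → (∀ N → ∃[ h′ ] ∃[ ζ′ ] (Agree N h h′ × Agree N ζ ζ′ × Point h′ ζ′)) →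
    Point h ζ
point-closed near =
  let (x , ζx) = limit-name (λ _ → ℚ.≤-refl) λ N →
                   let (_ , ξ , _ , a , x , ξx , _) = near N in ξ , x , a , ξx
  in x , ζx , λ rej →
    let (N , open-rej) = rejects-open rej
        (h′ , ζ′ , a , b , _ , _ , ¬rej) = near N
    in ¬rej (open-rej h′ ζ′ a b)

IntervalSet : Baire → Set
IntervalSet h = Σ[ A ∈ Carrier (𝒜 𝕀) ] (Names (𝒜 𝕀) h A × Convex {1} A)

-- A realizer has to respect pointwise equality, so its values are selected
-- as lexicographically least names.
Least : Baire → Baire → Set
Least h ζ = ∀ n → (∃[ ξ ] (Agree (suc n) ζ ξ × Point h ξ)) ×
                  (∀ ξ → Agree n ζ ξ → Point h ξ → ζ n ℕ.≤ ξ n)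

least-point : ∀ {h ζ} → Least h ζ → Point h ζ
least-point {h} {ζ} least = point-closed λ N →
  let ((ξ , a , p) , _) = least N in h , ξ , agree-refl , agree-≤ (ℕ.n≤1+n N) a , p

least-resp : ∀ {h h′ ζ ζ′} → h ≗ h′ → ζ ≗ ζ′ → Least h ζ → Least h′ ζ′
least-resp h≗ ζ≗ least n =
  let ((ξ , a , p) , minimal) = least n
  in (ξ , agree-trans (agree-≗ (sym ∘ ζ≗)) a , point-resp h≗ p) ,
     λ ξ b q → subst (ℕ._≤ ξ n) (ζ≗ n) (minimal ξ (agree-trans (agree-≗ ζ≗) b) (point-resp (sym ∘ h≗) q))

least-unique : ∀ {h ζ ζ′} → Least h ζ → Least h ζ′ → ζ ≗ ζ′
least-unique {h} {ζ} {ζ′} l l′ n = agree (suc n) n (ℕ.n<1+n n)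
  where
  agree : ∀ n → Agree n ζ ζ′
  agree zero    i ()
  agree (suc n) i i<1+n with ℕ.m≤n⇒m<n∨m≡n (ℕ.s≤s⁻¹ i<1+n)
  ... | inj₁ i<n  = agree n i i<n
  ... | inj₂ refl =
    let ((ξ , a , p) , minimal)   = l n
        ((ξ′ , a′ , p′) , minimal′) = l′ n
        e  = a n (ℕ.n<1+n n)
        e′ = a′ n (ℕ.n<1+n n)
    in ℕ.≤-antisym
         (ℕ.≤-trans (minimal ξ′ (agree-trans (agree n) (agree-≤ (ℕ.n≤1+n n) a′)) p′) (ℕ.≤-reflexive (sym e′)))
         (ℕ.≤-trans (minimal′ ξ (agree-trans (agree-sym (agree n)) (agree-≤ (ℕ.n≤1+n n) a)) p)
                    (ℕ.≤-reflexive (sym e)))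

module Realizers (em : ExcludedMiddle 0ℓ) where
  open Classical em

  least-exists : ∀ {h ζ} → Point h ζ → ∃[ ζ′ ] Least h ζ′
  least-exists {h} {ζ₀} p₀ = ζ , λ n →
    (proj₁ (state (suc n)) , limit (suc n) , proj₂ (state (suc n))) ,
    λ ξ a q → proj₂ (proj₂ (step (state n))) ξ (agree-trans (agree-sym (limit n)) a) q
    where
    State : Set
    State = Σ[ ξ ∈ Baire ] Point h ξ

    step : ∀ {n} → (s : State) → Σ[ s′ ∈ State ]
      (Agree n (proj₁ s) (proj₁ s′) ×
       (∀ ξ → Agree n (proj₁ s) ξ → Point h ξ → proj₁ s′ n ℕ.≤ ξ n))
    step {n} (ξ , p) =
      let (m , (ξ′ , a , p′ , e) , minimal) =
            least {λ m → ∃[ ξ′ ] (Agree n ξ ξ′ × Point h ξ′ × ξ′ n ≡ m)} (_ , ξ , agree-refl , p , refl)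
      in (ξ′ , p′) , a , λ ξ″ b q → ℕ.≤-trans (ℕ.≤-reflexive e)
           (ℕ.≮⇒≥ λ lt → minimal _ lt (ξ″ , b , q , refl))

    state : ℕ → State
    state zero    = ζ₀ , p₀
    state (suc n) = proj₁ (step {n} (state n))

    ζ : Baire
    ζ n = proj₁ (state (suc n)) n

    coherent : ∀ j k → j ℕ.≤ k → Agree j (proj₁ (state j)) (proj₁ (state k))
    coherent j k j≤k with ℕ.m≤n⇒m<n∨m≡n j≤k
    ... | inj₂ refl = agree-refl
    coherent j (suc k) _ | inj₁ (ℕ.s≤s j≤k) =
      agree-trans (coherent j k j≤k) (agree-≤ j≤k (proj₁ (proj₂ (step {k} (state k)))))

    limit : ∀ j → Agree j ζ (proj₁ (state j))
    limit j i i<j = coherent (suc i) j i<j i (ℕ.n<1+n i)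

  -- The requirement `IntervalSet` leaves the realizer undefined off the names of pairs of
  -- intervals. Since its composite with `H` and `K` must have a value, `H` is forced to produce
  -- such names.
  LeastPair : Baire → Baire → Set
  LeastPair h g = ∃[ h₁ ] ∃[ h₂ ] ∃[ g₁ ] ∃[ g₂ ]
    (h ≗ ⟨ h₁ , h₂ ⟩ × g ≗ ⟨ g₁ , g₂ ⟩ × (IntervalSet h₁ × IntervalSet h₂) × Least h₁ g₁ × Least h₂ g₂)

  leastPair-resp : ∀ {h h′ g g′} → h ≗ h′ → g ≗ g′ → LeastPair h g → LeastPair h′ g′
  leastPair-resp h≗ g≗ (h₁ , h₂ , g₁ , g₂ , e , e′ , rest) =
    h₁ , h₂ , g₁ , g₂ , (λ n → trans (sym (h≗ n)) (e n)) , (λ n → trans (sym (g≗ n)) (e′ n)) , rest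

  leastPair-unique : ∀ {h g g′} → LeastPair h g → LeastPair h g′ → g ≗ g′
  leastPair-unique (h₁ , h₂ , g₁ , g₂ , e , f , _ , l₁ , l₂) (h₁′ , h₂′ , g₁′ , g₂′ , e′ , f′ , _ , l₁′ , l₂′) n =
    let (h₁≗ , h₂≗) = ⟨,⟩-injective {h₁} {h₁′} {h₂} {h₂′} (λ n → trans (sym (e n)) (e′ n))
    in trans (f n) (trans (⟨,⟩-cong (least-unique (least-resp h₁≗ (λ _ → refl) l₁) l₁′)
                                    (least-unique (least-resp h₂≗ (λ _ → refl) l₂) l₂′) n)
                          (sym (f′ n)))

  leastRealizer : PartialFunction
  leastRealizer = record
    { _↦_ = LeastPair ; ↦-resp = leastPair-resp ; functional = leastPair-unique }

  -- Redefining a realizer at one input shows that `K` has to cope with every pair of names of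
  -- points of the rectangle, and not only with the least ones.
  overriding : Baire → Baire → PartialFunction
  overriding h₀ g₀ = record
    { _↦_ = λ h g → (h ≗ h₀ × g ≗ g₀) ⊎ (¬ h ≗ h₀ × LeastPair h g)
    ; ↦-resp = λ h≗ g≗ →
        [ (λ (e , f) → inj₁ ((λ n → trans (sym (h≗ n)) (e n)) , (λ n → trans (sym (g≗ n)) (f n))))
        , (λ (ne , l) → inj₂ ((λ e → ne λ n → trans (h≗ n) (e n)) , leastPair-resp h≗ g≗ l)) ]′
    ; functional =
        λ { (inj₁ (_ , f)) (inj₁ (_ , f′)) n → trans (f n) (sym (f′ n))
          ; (inj₁ (e , _)) (inj₂ (ne , _)) → contradiction e ne
          ; (inj₂ (ne , _)) (inj₁ (e , _)) → contradiction e ne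
          ; (inj₂ (_ , l)) (inj₂ (_ , l′)) → leastPair-unique l l′ } }

  point-∈ : ∀ {h ζ} {A : Carrier (𝒜 𝕀)} → Names (𝒜 𝕀) h A → (p : Point h ζ) → _∈_ {𝕀} (proj₁ p) A
  point-∈ {h} {ζ} {A} hA (x , ζx , ¬rej) = ¬rejects⇒∈ {𝕀} {A = A} {x} hA (approx⇒name ζx) ¬rej

  ∈-point : ∀ {h} {A : Carrier (𝒜 𝕀)} → Names (𝒜 𝕀) h A → ∀ x → _∈_ {𝕀} x A → ∃[ ζ ] Point h ζ
  ∈-point {h} {A} hA x x∈A =
    let (ζ , ζx) = interval-name x
    in ζ , x , ζx , ∈⇒¬rejects {𝕀} {A = A} {x} hA (approx⇒name ζx) x∈A

  respond : ∀ {h₁ h₂ g₁ g₂ h} {A₁ A₂ : Carrier (𝒜 𝕀)} →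
    Names (𝒜 𝕀) h₁ A₁ → Names (𝒜 𝕀) h₂ A₂ → Convex {1} A₁ → Convex {1} A₂ → h ≗ ⟨ h₁ , h₂ ⟩ →
    Point h₁ g₁ → Point h₂ g₂ →
    ∃[ y ] (Names (𝕀 ×ʳ 𝕀) ⟨ g₁ , g₂ ⟩ y × _⇉_.Graph (XC 1 ×ᵐ XC 1) (A₁ , A₂) y)
  respond {g₁ = g₁} {g₂} {A₁ = A₁} {A₂} h₁A h₂A c₁ c₂ e p₁ p₂ =
    (proj₁ p₁ , proj₁ p₂) ,
    (g₁ , g₂ , (λ _ → refl) , approx⇒name (proj₁ (proj₂ p₁)) , approx⇒name (proj₁ (proj₂ p₂))) ,
    (c₁ , point-∈ {A = A₁} h₁A p₁) , (c₂ , point-∈ {A = A₂} h₂A p₂)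

  leastPair-total : ∀ {h} {A₁ A₂ : Carrier (𝒜 𝕀)} → Names (𝒜 𝕀 ×ʳ 𝒜 𝕀) h (A₁ , A₂) →
    _⇉_.Dom (XC 1 ×ᵐ XC 1) (A₁ , A₂) →
    ∃[ g ] (LeastPair h g × ∃[ y ] (Names (𝕀 ×ʳ 𝕀) g y × _⇉_.Graph (XC 1 ×ᵐ XC 1) (A₁ , A₂) y))
  leastPair-total {A₁ = A₁} {A₂} (h₁ , h₂ , e , h₁A , h₂A) ((y₁ , y₂) , (c₁ , y₁∈) , (c₂ , y₂∈)) =
    let (g₁ , l₁) = least-exists (proj₂ (∈-point {A = A₁} h₁A y₁ y₁∈))
        (g₂ , l₂) = least-exists (proj₂ (∈-point {A = A₂} h₂A y₂ y₂∈))
    in ⟨ g₁ , g₂ ⟩ ,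
       (h₁ , h₂ , g₁ , g₂ , e , (λ _ → refl) , ((A₁ , h₁A , c₁) , (A₂ , h₂A , c₂)) , l₁ , l₂) ,
       respond {A₁ = A₁} {A₂} h₁A h₂A c₁ c₂ e (least-point l₁) (least-point l₂)

  leastRealizer-⊢ : leastRealizer ⊢ XC 1 ×ᵐ XC 1
  leastRealizer-⊢ h (A₁ , A₂) hA dom = leastPair-total {A₁ = A₁} {A₂} hA dom

  overriding-⊢ : ∀ {h₁ h₂ g₁ g₂} → Point h₁ g₁ → Point h₂ g₂ →
                 overriding ⟨ h₁ , h₂ ⟩ ⟨ g₁ , g₂ ⟩ ⊢ XC 1 ×ᵐ XC 1
  overriding-⊢ {h₁} {h₂} {g₁} {g₂} p₁ p₂ h (A₁ , A₂) hA dom with em {h ≗ ⟨ h₁ , h₂ ⟩}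
  ... | no ne = let (g , l , r) = leastPair-total {A₁ = A₁} {A₂} hA dom in g , inj₂ (ne , l) , r
  ... | yes e = ⟨ g₁ , g₂ ⟩ , inj₁ (e , λ _ → refl) , replace hA dom
    where
    replace : Names (𝒜 𝕀 ×ʳ 𝒜 𝕀) h (A₁ , A₂) → _⇉_.Dom (XC 1 ×ᵐ XC 1) (A₁ , A₂) →
              ∃[ y ] (Names (𝕀 ×ʳ 𝕀) ⟨ g₁ , g₂ ⟩ y × _⇉_.Graph (XC 1 ×ᵐ XC 1) (A₁ , A₂) y)
    replace (h₁′ , h₂′ , e′ , h₁A , h₂A) (_ , (c₁ , _) , (c₂ , _)) =
      let (h₁≗ , h₂≗) = ⟨,⟩-injective {h₁} {h₁′} {h₂} {h₂′} (λ n → trans (sym (e n)) (e′ n))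
      in respond {A₁ = A₁} {A₂} h₁A h₂A c₁ c₂ e′ (point-resp h₁≗ p₁) (point-resp h₂≗ p₂)

  record Response (H K : PartialFunction) (p : Baire) (A : Carrier (𝒜 (Cube 2))) : Set where
    field
      h₁ h₂ : Baire
      maps  : (H ↦ p) ⟨ h₁ , h₂ ⟩
      set₁  : IntervalSet h₁
      set₂  : IntervalSet h₂
      some₁ : ∃[ ζ ] Point h₁ ζ
      some₂ : ∃[ ζ ] Point h₂ ζ
      answer : ∀ {ζ₁ ζ₂} → Point h₁ ζ₁ → Point h₂ ζ₂ →
               ∃[ r ] ((K ↦ ⟨ p , ⟨ ζ₁ , ζ₂ ⟩ ⟩) r ×
                       ∃[ y ] (Names (𝕀 ×ʳ 𝕀) r y × _∈_ {Cube 2} y A))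

  response : ∀ {H K} → (∀ G → G ⊢ XC 1 ×ᵐ XC 1 → wrap H G K ⊢ XC₂∣𝔗) →
             ∀ {p A} → Names (𝒜 (Cube 2)) p A → _⇉_.Dom XC₂∣𝔗 A → Response H K p A
  response {H} {K} red {p} {A} pA dom with red leastRealizer leastRealizer-⊢ p A pA dom
  ... | _ , (h , g , Hph , (h₁ , h₂ , g₁ , g₂ , e , f , (s₁ , s₂) , l₁ , l₂) , _) , _ = record
    { h₁ = h₁ ; h₂ = h₂ ; maps = Hp ; set₁ = s₁ ; set₂ = s₂
    ; some₁ = g₁ , least-point l₁ ; some₂ = g₂ , least-point l₂
    ; answer = λ {ζ₁} {ζ₂} p₁ p₂ → run (red (overriding ⟨ h₁ , h₂ ⟩ ⟨ ζ₁ , ζ₂ ⟩) (overriding-⊢ p₁ p₂) p A pA dom) }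
    where
    Hp : (H ↦ p) ⟨ h₁ , h₂ ⟩
    Hp = ↦-resp H (λ _ → refl) e Hph
    run : ∀ {ζ₁ ζ₂} →
      ∃[ r ] ((wrap H (overriding ⟨ h₁ , h₂ ⟩ ⟨ ζ₁ , ζ₂ ⟩) K ↦ p) r ×
              ∃[ y ] (Names (𝕀 ×ʳ 𝕀) r y × _⇉_.Graph XC₂∣𝔗 A y)) →
      ∃[ r ] ((K ↦ ⟨ p , ⟨ ζ₁ , ζ₂ ⟩ ⟩) r × ∃[ y ] (Names (𝕀 ×ʳ 𝕀) r y × _∈_ {Cube 2} y A))
    run (r , (h′ , g′ , Hph′ , inj₁ (_ , g≗) , Kr) , y , ry , (_ , _ , y∈A)) =
      r , ↦-resp K (⟨,⟩-cong (λ _ → refl) g≗) (λ _ → refl) Kr , y , ry , y∈A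
    run (r , (h′ , g′ , Hph′ , inj₂ (ne , _) , _) , _) = contradiction (functional H Hph′ Hp) ne

-- Triangles and their names

Square : Set
Square = UnitInterval × UnitInterval

Shape : Set
Shape = Square × Square × Square

In : Shape → Square → Set
In (a , b , c) x = InTriangle a b c x

infix 4 _⊆_
_⊆_ : Shape → Shape → Set
S ⊆ T = ∀ x → In S x → In T x

c₁ c₂ : Square → ℝ
c₁ (x , _) = value x
c₂ (_ , x) = value x

mixture : (r s t a b c : ℝ) → ℝ
mixture r s t a b c = r ⊗ a ⊕ s ⊗ b ⊕ t ⊗ c

record Bary (S : Shape) (x : Square) (r s t : ℝ) : Set where
  field
    0≼r : ↑ 0ℚ ≼ r
    0≼s : ↑ 0ℚ ≼ s
    0≼t : ↑ 0ℚ ≼ t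
    sum : r ⊕ s ⊕ t ≋ ↑ 1ℚ
    at₁ : c₁ x ≋ mixture r s t (c₁ (proj₁ S)) (c₁ (proj₁ (proj₂ S))) (c₁ (proj₂ (proj₂ S)))
    at₂ : c₂ x ≋ mixture r s t (c₂ (proj₁ S)) (c₂ (proj₁ (proj₂ S))) (c₂ (proj₂ (proj₂ S)))

≃⇒≋ : ∀ {x y} → x ≃ y → x ≋ y
≃⇒≋ (p , q) = ≤⇒≼ p & ≤⇒≼ q

≋⇒≃ : ∀ {x y} → x ≋ y → x ≃ y
≋⇒≃ (p & q) = ≼⇒≤ p , ≼⇒≤ q

+-≋ : ∀ {x x′ y y′} → x ≋ x′ → y ≋ y′ → x + y ≋ x′ ⊕ y′
+-≋ {x} {x′} {y} {y′} e f = ≋-trans (+≋⊕ x y) (⊕-cong e f)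

Σ≋mixture : ∀ r s t a b c → r * a + s * b + t * c ≋ mixture r s t a b c
Σ≋mixture r s t a b c = +-≋ {r * a + s * b} {r ⊗ a ⊕ s ⊗ b} {t * c} {t ⊗ c}
  (+-≋ {r * a} {r ⊗ a} {s * b} {s ⊗ b} (*≋⊗ r a) (*≋⊗ s b)) (*≋⊗ t c)

in⇒bary : ∀ {S x} → In S x → ∃[ r ] ∃[ s ] ∃[ t ] Bary S x r s t
in⇒bary {a , b , c} {x} (r , s , t , 0≤r , 0≤s , 0≤t , sum , at) = r , s , t , record
  { 0≼r = ≼-trans (≋⇒≽ (fromℚ≋↑ 0ℚ)) (≤⇒≼ 0≤r)
  ; 0≼s = ≼-trans (≋⇒≽ (fromℚ≋↑ 0ℚ)) (≤⇒≼ 0≤s)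
  ; 0≼t = ≼-trans (≋⇒≽ (fromℚ≋↑ 0ℚ)) (≤⇒≼ 0≤t)
  ; sum = ≋-trans (≋-sym (+-≋ {r + s} {r ⊕ s} {t} {t} (+≋⊕ r s) ≋-refl)) (≋-trans (≃⇒≋ {r + s + t} {fromℚ 1ℚ} sum) (fromℚ≋↑ 1ℚ))
  ; at₁ = ≋-trans (≃⇒≋ {c₁ x} {r * c₁ a + s * c₁ b + t * c₁ c} (at zero)) (Σ≋mixture r s t (c₁ a) (c₁ b) (c₁ c))
  ; at₂ = ≋-trans (≃⇒≋ {c₂ x} {r * c₂ a + s * c₂ b + t * c₂ c} (at (suc zero))) (Σ≋mixture r s t (c₂ a) (c₂ b) (c₂ c)) }

bary⇒in : ∀ {S x r s t} → Bary S x r s t → In S x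
bary⇒in {a , b , c} {x} {r} {s} {t} β = r , s , t ,
  ≼⇒≤ (≼-trans (≋⇒≼ (fromℚ≋↑ 0ℚ)) 0≼r) , ≼⇒≤ (≼-trans (≋⇒≼ (fromℚ≋↑ 0ℚ)) 0≼s) ,
  ≼⇒≤ (≼-trans (≋⇒≼ (fromℚ≋↑ 0ℚ)) 0≼t) ,
  ≋⇒≃ {r + s + t} {fromℚ 1ℚ} (≋-trans (+-≋ {r + s} {r ⊕ s} {t} {t} (+≋⊕ r s) ≋-refl) (≋-trans sum (≋-sym (fromℚ≋↑ 1ℚ)))) ,
  λ { zero → ≋⇒≃ {c₁ x} {r * c₁ a + s * c₁ b + t * c₁ c} (≋-trans at₁ (≋-sym (Σ≋mixture r s t (c₁ a) (c₁ b) (c₁ c))))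
    ; (suc zero) → ≋⇒≃ {c₂ x} {r * c₂ a + s * c₂ b + t * c₂ c} (≋-trans at₂ (≋-sym (Σ≋mixture r s t (c₂ a) (c₂ b) (c₂ c)))) }
  where open Bary β

in-resp : ∀ {S x y} → c₁ x ≋ c₁ y → c₂ x ≋ c₂ y → In S x → In S y
in-resp e f x∈S = let (r , s , t , β) = in⇒bary x∈S in bary⇒in (record
  { 0≼r = Bary.0≼r β ; 0≼s = Bary.0≼s β ; 0≼t = Bary.0≼t β ; sum = Bary.sum β
  ; at₁ = ≋-trans (≋-sym e) (Bary.at₁ β) ; at₂ = ≋-trans (≋-sym f) (Bary.at₂ β) })

⊕-nonneg : ∀ {x y} → ↑ 0ℚ ≼ x → ↑ 0ℚ ≼ y → ↑ 0ℚ ≼ x ⊕ y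
⊕-nonneg p q = ≼-trans (≋⇒≽ (⊕-identityˡ (↑ 0ℚ))) (⊕-mono p q)

in-convex : ∀ {S x y z s t} → ↑ 0ℚ ≼ s → ↑ 0ℚ ≼ t → s ⊕ t ≋ ↑ 1ℚ →
            c₁ z ≋ s ⊗ c₁ x ⊕ t ⊗ c₁ y → c₂ z ≋ s ⊗ c₂ x ⊕ t ⊗ c₂ y →
            In S x → In S y → In S z
in-convex {a , b , c} {x} {y} {z} {s} {t} 0≼s 0≼t s+t≋1 e f x∈S y∈S =
  let (r₁ , s₁ , t₁ , β) = in⇒bary x∈S
      (r₂ , s₂ , t₂ , γ) = in⇒bary y∈S
      module β = Bary β
      module γ = Bary γ
      at : ∀ a b c → s ⊗ mixture r₁ s₁ t₁ a b c ⊕ t ⊗ mixture r₂ s₂ t₂ a b c ≋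
           mixture (s ⊗ r₁ ⊕ t ⊗ r₂) (s ⊗ s₁ ⊕ t ⊗ s₂) (s ⊗ t₁ ⊕ t ⊗ t₂) a b c
      at a b c = ringʳ 11 (λ s t r₁ s₁ t₁ r₂ s₂ t₂ a b c →
        s :⊗ (r₁ :⊗ a :⊕ s₁ :⊗ b :⊕ t₁ :⊗ c) :⊕ t :⊗ (r₂ :⊗ a :⊕ s₂ :⊗ b :⊕ t₂ :⊗ c) :≋
        (s :⊗ r₁ :⊕ t :⊗ r₂) :⊗ a :⊕ (s :⊗ s₁ :⊕ t :⊗ s₂) :⊗ b :⊕ (s :⊗ t₁ :⊕ t :⊗ t₂) :⊗ c) refl
        (s ∷ t ∷ r₁ ∷ s₁ ∷ t₁ ∷ r₂ ∷ s₂ ∷ t₂ ∷ a ∷ b ∷ c ∷ [])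
  in bary⇒in {r = s ⊗ r₁ ⊕ t ⊗ r₂} {s ⊗ s₁ ⊕ t ⊗ s₂} {s ⊗ t₁ ⊕ t ⊗ t₂} (record
    { 0≼r = ⊕-nonneg (⊗-nonneg 0≼s β.0≼r) (⊗-nonneg 0≼t γ.0≼r)
    ; 0≼s = ⊕-nonneg (⊗-nonneg 0≼s β.0≼s) (⊗-nonneg 0≼t γ.0≼s)
    ; 0≼t = ⊕-nonneg (⊗-nonneg 0≼s β.0≼t) (⊗-nonneg 0≼t γ.0≼t)
    ; sum = ≋-trans (ringʳ 8 (λ s t r₁ s₁ t₁ r₂ s₂ t₂ →
          (s :⊗ r₁ :⊕ t :⊗ r₂) :⊕ (s :⊗ s₁ :⊕ t :⊗ s₂) :⊕ (s :⊗ t₁ :⊕ t :⊗ t₂) :≋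
          s :⊗ (r₁ :⊕ s₁ :⊕ t₁) :⊕ t :⊗ (r₂ :⊕ s₂ :⊕ t₂)) refl (s ∷ t ∷ r₁ ∷ s₁ ∷ t₁ ∷ r₂ ∷ s₂ ∷ t₂ ∷ []))
        (≋-trans (⊕-cong (≋-trans (⊗-cong ≋-refl β.sum) (⊗-identityʳ s))
                         (≋-trans (⊗-cong ≋-refl γ.sum) (⊗-identityʳ t))) s+t≋1)
    ; at₁ = ≋-trans e (≋-trans (⊕-cong (⊗-cong ≋-refl β.at₁) (⊗-cong ≋-refl γ.at₁)) (at (c₁ a) (c₁ b) (c₁ c)))
    ; at₂ = ≋-trans f (≋-trans (⊕-cong (⊗-cong ≋-refl β.at₂) (⊗-cong ≋-refl γ.at₂)) (at (c₂ a) (c₂ b) (c₂ c))) })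

0≼1 : ↑ 0ℚ ≼ ↑ 1ℚ
0≼1 = ↑-mono (ℚ.<⇒≤ (ℚ.positive⁻¹ 1ℚ))

first-vertex : ∀ {S} → In S (proj₁ S)
first-vertex {a , b , c} = bary⇒in {r = ↑ 1ℚ} {↑ 0ℚ} {↑ 0ℚ} (record
  { 0≼r = 0≼1 ; 0≼s = ≼-refl ; 0≼t = ≼-refl
  ; sum = ≋-trans (⊕-identityʳ _) (⊕-identityʳ _)
  ; at₁ = at (c₁ a) (c₁ b) (c₁ c) ; at₂ = at (c₂ a) (c₂ b) (c₂ c) })
  where
  at : ∀ a b c → a ≋ mixture (↑ 1ℚ) (↑ 0ℚ) (↑ 0ℚ) a b c
  at a b c = ringʳ 3 (λ a b c → a :≋ :↑ 1ℚ :⊗ a :⊕ :↑ 0ℚ :⊗ b :⊕ :↑ 0ℚ :⊗ c) refl (a ∷ b ∷ c ∷ [])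

Near : ℚ → Square → Square → Set
Near e x y = Close (c₁ x) (c₁ y) e × Close (c₂ x) (c₂ y) e

near-mono : ∀ {e f x y} → e ≤ℚ f → Near e x y → Near f x y
near-mono e≤f (p , q) = close-mono e≤f p , close-mono e≤f q

-- How far apart two points can be that lie within `2⁻ n` of the same dyadic point.
spread : ℕ → ℚ
spread n = 2⁻ n +ℚ 2⁻ n

spread-antitone : ∀ {m n} → m ℕ.≤ n → spread n ≤ℚ spread m
spread-antitone m≤n = ℚ.+-mono-≤ (2⁻-antitone m≤n) (2⁻-antitone m≤n)

-- Read contrapositively: a point outside `T` is missed by some `S n` with margin `spread n`, so
-- that its box of radius `2⁻ n` can be rejected at stage `n`.
Converges : (ℕ → Shape) → Shape → Set
Converges S T = ∀ x → (∀ n → ∃[ y ] (In (S n) y × Near (spread n) x y)) → In T x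

Closed : Shape → Set
Closed T = Converges (const T) T

-- The shapes S n are the approximations shown so far; T is their limit.
record Play : Set where
  field
    S         : ℕ → Shape
    T         : Shape
    T⊆S       : ∀ n → T ⊆ S n
    converges : Converges S T

InBox : ℕ → ℕ → ℕ → Square → Set
InBox n i j y = Close (c₁ y) (↑ (dyadic i n)) (2⁻ n) × Close (c₂ y) (↑ (dyadic j n)) (2⁻ n)

nth : List ℕ → ℕ → ℕ
nth []       _       = 0
nth (x ∷ xs) zero    = x
nth (x ∷ xs) (suc i) = nth xs i

nth-applyUpTo : ∀ (q : Baire) k i → i ℕ.< k → nth (applyUpTo q k) i ≡ q i
nth-applyUpTo q (suc k) zero    _ = refl
nth-applyUpTo q (suc k) (suc i) i<k = nth-applyUpTo (q ∘ suc) k i (ℕ.s≤s⁻¹ i<k)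

pow-odd-injective : ∀ x y a b → 2 ℕ.^ x ℕ.* suc (2 ℕ.* a) ≡ 2 ℕ.^ y ℕ.* suc (2 ℕ.* b) →
    x ≡ y × a ≡ b
pow-odd-injective zero zero a b e =
  refl , ℕ.*-cancelˡ-≡ a b 2 (ℕ.suc-injective (trans (sym (ℕ.*-identityˡ _)) (trans e (ℕ.*-identityˡ _))))
pow-odd-injective zero (suc y) a b e = contradiction
  (trans (sym (ℕ.*-assoc 2 (2 ℕ.^ y) _)) (trans (sym e) (ℕ.*-identityˡ _))) (ℕ.even≢odd (2 ℕ.^ y ℕ.* suc (2 ℕ.* b)) a)
pow-odd-injective (suc x) zero a b e = contradiction
  (trans (sym (ℕ.*-assoc 2 (2 ℕ.^ x) _)) (trans e (ℕ.*-identityˡ _))) (ℕ.even≢odd (2 ℕ.^ x ℕ.* suc (2 ℕ.* a)) b)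
pow-odd-injective (suc x) (suc y) a b e =
  let (p , q) = pow-odd-injective x y a b (ℕ.*-cancelˡ-≡ _ _ 2
        (trans (sym (ℕ.*-assoc 2 (2 ℕ.^ x) _)) (trans e (ℕ.*-assoc 2 (2 ℕ.^ y) _))))
  in cong suc p , q

encode-pos : ∀ x xs → encode (x ∷ xs) ≢ 0
encode-pos x xs e with ℕ.m*n≡0⇒m≡0∨n≡0 (2 ℕ.^ x) e
... | inj₁ p = contradiction (ℕ.m^n≡0⇒m≡0 2 x p) λ ()
... | inj₂ ()

encode-injective : ∀ xs ys → encode xs ≡ encode ys → xs ≡ ys
encode-injective []       []       _ = refl
encode-injective []       (y ∷ ys) e = contradiction (sym e) (encode-pos y ys)
encode-injective (x ∷ xs) []       e = contradiction e (encode-pos x xs)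
encode-injective (x ∷ xs) (y ∷ ys) e =
  let (p , q) = pow-odd-injective x y _ _ e in cong₂ _∷_ p (encode-injective xs ys q)

-- Entry `encode (n ∷ w)` of a name of a play depends on shape `n` only. By this inequality the
-- first `N` shapes determine the first `N` entries.
head<encode : ∀ n w → n ℕ.< encode (n ∷ w)
head<encode n w = ℕ.<-≤-trans (n<2^n n) (ℕ.m≤m*n (2 ℕ.^ n) (suc (2 ℕ.* encode w)))

module Plays (em : ExcludedMiddle 0ℓ) where
  open Classical em

  rejection : Shape → ℕ → ℕ → ℕ → ℕ
  rejection S n i j with em {∃[ y ] (In S y × InBox n i j y)}
  ... | yes _ = 0
  ... | no  _ = 1

  rejection-0 : ∀ {S n i j} → ∃[ y ] (In S y × InBox n i j y) → rejection S n i j ≡ 0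
  rejection-0 {S} {n} {i} {j} h with em {∃[ y ] (In S y × InBox n i j y)}
  ... | yes _ = refl
  ... | no ¬h = contradiction h ¬h

  rejection-0⁻ : ∀ {S n i j} → rejection S n i j ≡ 0 → ∃[ y ] (In S y × InBox n i j y)
  rejection-0⁻ {S} {n} {i} {j} e with em {∃[ y ] (In S y × InBox n i j y)}
  ... | yes h = h

  -- Output `n` depends on entry `n` of either coordinate name; in the interleaved input these are
  -- at `n + n` and `suc (n + n)`, so `n + n + 2` entries are awaited. A box is rejected only if it
  -- misses `S n` altogether.
  respond-to : (ℕ → Shape) → List ℕ → ℕ
  respond-to S []      = 0
  respond-to S (n ∷ w) with length w ℕ.<? suc (suc (n ℕ.+ n))
  ... | yes _ = 0
  ... | no  _ = suc (rejection (S n) n (nth w (n ℕ.+ n)) (nth w (suc (n ℕ.+ n))))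

  respond-to-short : ∀ S n w → length w ℕ.< suc (suc (n ℕ.+ n)) → respond-to S (n ∷ w) ≡ 0
  respond-to-short S n w lt with length w ℕ.<? suc (suc (n ℕ.+ n))
  ... | yes _ = refl
  ... | no ¬p = contradiction lt ¬p

  respond-to-long : ∀ S n w → suc (suc (n ℕ.+ n)) ℕ.≤ length w →
    respond-to S (n ∷ w) ≡ suc (rejection (S n) n (nth w (n ℕ.+ n)) (nth w (suc (n ℕ.+ n))))
  respond-to-long S n w le with length w ℕ.<? suc (suc (n ℕ.+ n))
  ... | yes lt = contradiction lt (ℕ.≤⇒≯ le)
  ... | no _   = refl

  respond-to-local : ∀ S S′ n w → S n ≡ S′ n → respond-to S (n ∷ w) ≡ respond-to S′ (n ∷ w)
  respond-to-local S S′ n w e with length w ℕ.<? suc (suc (n ℕ.+ n))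
  ... | yes _ = refl
  ... | no _  = cong (λ T → suc (rejection T n _ _)) e

  decode : ℕ → List ℕ
  decode c with em {∃[ l ] encode l ≡ c}
  ... | yes (l , _) = l
  ... | no _        = []

  decode-encode : ∀ l → decode (encode l) ≡ l
  decode-encode l with em {∃[ l′ ] encode l′ ≡ encode l}
  ... | yes (l′ , e) = encode-injective l′ l e
  ... | no ¬h        = contradiction (l , refl) ¬h

  decode-head : ∀ c {n w} → decode c ≡ n ∷ w → n ℕ.< c
  decode-head c e with em {∃[ l ] encode l ≡ c}
  decode-head c {n} {w} refl | yes (l , refl) = head<encode n w
  decode-head c ()   | no _

  play-name : (ℕ → Shape) → Baire
  play-name S c = respond-to S (decode c)

  play-name-agree : ∀ {N S S′} → Agree N S S′ → Agree N (play-name S) (play-name S′)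
  play-name-agree {N} {S} {S′} a c c<N = go (decode c) refl
    where
    go : ∀ l → decode c ≡ l → respond-to S l ≡ respond-to S′ l
    go []      _ = refl
    go (n ∷ w) e = respond-to-local S S′ n w (a n (ℕ.<-trans (decode-head c e) c<N))

  closed-set : ∀ {S T} → (∀ n → T ⊆ S n) → Converges S T →
    Σ[ A ∈ Carrier (𝒜 (Cube 2)) ]
      (Names (𝒜 (Cube 2)) (play-name S) A × (∀ x → _∈_ {Cube 2} x A ⇔ In T x))
  closed-set {S} {T} T⊆S conv = A , names , λ x → mk⇔ (char⁻ x) (char x)
    where
    χ : Square → Bool
    χ x with em {In T x}
    ... | yes _ = false
    ... | no _  = true
    char : ∀ x → In T x → χ x ≡ false
    char x x∈T with em {In T x}
    ... | yes _  = refl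
    ... | no x∉T = contradiction x∈T x∉T
    char⁻ : ∀ x → χ x ≡ false → In T x
    char⁻ x e with em {In T x}
    ... | yes x∈T = x∈T
    χ-cong : ∀ {x y} → c₁ x ≋ c₁ y → c₂ x ≋ c₂ y → χ x ≡ χ y
    χ-cong {x} {y} e f with em {In T x} | em {In T y}
    ... | yes _   | yes _   = refl
    ... | no _    | no _    = refl
    ... | yes x∈T | no y∉T  = contradiction (in-resp e f x∈T) y∉T
    ... | no x∉T  | yes y∈T = contradiction (in-resp (≋-sym e) (≋-sym f) y∈T) x∉T
    run : ∀ q x → Names (Cube 2) q x →
        ∃[ r ] ((play-name S · PartialFunction.↦ q) r × SierpińskiName r (χ x))
    run q x (q₁ , q₂ , q≗ , q₁x , q₂x) = r , applies , value-of (χ x) refl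
      where
      r : Baire
      r n = rejection (S n) n (q₁ n) (q₂ n)
      answers : ∀ n k → play-name S (encode (n ∷ applyUpTo q k)) ≡ respond-to S (n ∷ applyUpTo q k)
      answers n k = cong (respond-to S) (decode-encode (n ∷ applyUpTo q k))
      applies : ∀ n → AppliesAt (play-name S) q n (r n)
      applies n = let use = suc (suc (n ℕ.+ n)) in appliesAt use
        (trans (answers n use)
          (trans (respond-to-long S n (applyUpTo q use) (ℕ.≤-reflexive (sym (List.length-applyUpTo q use))))
            (cong suc (cong₂ (rejection (S n) n)
              (trans (nth-applyUpTo q use (n ℕ.+ n) (ℕ.n≤1+n _)) (trans (q≗ _) (⟨,⟩-even q₁ q₂ n)))
              (trans (nth-applyUpTo q use (suc (n ℕ.+ n)) ℕ.≤-refl) (trans (q≗ _) (⟨,⟩-odd q₁ q₂ n)))))))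
        (λ j j<use → trans (answers n j) (respond-to-short S n (applyUpTo q j)
          (subst (ℕ._< use) (sym (List.length-applyUpTo q j)) j<use)))
      box : ∀ n → InBox n (q₁ n) (q₂ n) x
      box n = name⇒approx {q₁} {c₁ x} q₁x n , name⇒approx {q₂} {c₂ x} q₂x n
      value-of : ∀ b → χ x ≡ b → SierpińskiName r b
      value-of false e n = rejection-0 (x , T⊆S n x (char⁻ x e) , box n)
      value-of true  e = by-contradiction λ ¬rej →
        contradiction (trans (sym e) (char x (conv x λ n →
          let (y , y∈S , (b₁ , b₂)) = rejection-0⁻ (by-contradiction λ r≢0 → ¬rej (n , r≢0))
          in y , y∈S , close-trans (proj₁ (box n)) (close-sym b₁) , close-trans (proj₂ (box n)) (close-sym b₂)))) λ ()
    A : Carrier (𝒜 (Cube 2))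
    A = record
      { to = χ
      ; to-cong = λ {x} {y} (e , f) → χ-cong {x} {y} (≃⇒≋ {c₁ x} {c₁ y} e) (≃⇒≋ {c₂ x} {c₂ y} f)
      ; continuous = play-name S , λ q x qx _ → let (r , a , s) = run q x qx in r , a , χ x , s , refl }
    names : Names (𝒜 (Cube 2)) (play-name S) A
    names q x qx _ = let (r , a , s) = run q x qx in r , a , χ x , s , refl

  -- The shapes before stage `m` contain `T`, hence also `T′`, so nothing shown so far is
  -- contradicted. For convergence it is enough to look at the stages `n ⊔ m`, which show `T′`.
  extend : (π : Play) (m : ℕ) (T′ : Shape) → T′ ⊆ Play.T π → Closed T′ → Play
  extend π m T′ T′⊆T closed = record
    { S = switch m (Play.S π) (const T′)
    ; T = T′
    ; T⊆S = λ n x x∈T′ → switch-elim (λ U → In U x) m (Play.S π) (const T′) n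
        (λ _ → Play.T⊆S π n x (T′⊆T x x∈T′)) (λ _ → x∈T′)
    ; converges = λ x near → closed x λ n →
        let (y , y∈ , c) = near (n ⊔ m)
        in y , late n y y∈ , near-mono {x = x} {y} (spread-antitone (ℕ.m≤m⊔n n m)) c }
    where
    late : ∀ n y → In (switch m (Play.S π) (const T′) (n ⊔ m)) y → In T′ y
    late n y = switch-elim (λ U → In U y → In T′ y) m (Play.S π) (const T′) (n ⊔ m)
      (λ lt → contradiction lt (ℕ.≤⇒≯ (ℕ.m≤n⊔m n m))) (λ _ h → h)

  extend-agree : ∀ π m T′ h c → Agree m (Play.S π) (Play.S (extend π m T′ h c))
  extend-agree π m T′ _ _ = switch-agree m (Play.S π) (const T′)

  in-domain : ∀ {A T} → (∀ x → _∈_ {Cube 2} x A ⇔ In T x) → _⇉_.Dom XC₂∣𝔗 A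
  in-domain {A} {T@(a , b , c)} A⇔T = a , (a , b , c , A⇔T) , convex , Equivalence.from (A⇔T a) (first-vertex {T})
    where
    convex : Convex {2} A
    convex x y z s t 0≤s 0≤t s+t≃1 z≃ x∈A y∈A = Equivalence.from (A⇔T z)
      (in-convex {T} {x} {y} {z} {s} {t}
        (≼-trans (≋⇒≽ (fromℚ≋↑ 0ℚ)) (≤⇒≼ 0≤s)) (≼-trans (≋⇒≽ (fromℚ≋↑ 0ℚ)) (≤⇒≼ 0≤t))
        (≋-trans (≋-sym (+≋⊕ s t)) (≋-trans (≃⇒≋ {s + t} {fromℚ 1ℚ} s+t≃1) (fromℚ≋↑ 1ℚ)))
        (≋-trans (≃⇒≋ {c₁ z} {s * c₁ x + t * c₁ y} (z≃ zero)) (+-≋ {s * c₁ x} {s ⊗ c₁ x} {t * c₁ y} {t ⊗ c₁ y} (*≋⊗ s (c₁ x)) (*≋⊗ t (c₁ y))))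
        (≋-trans (≃⇒≋ {c₂ z} {s * c₂ x + t * c₂ y} (z≃ (suc zero))) (+-≋ {s * c₂ x} {s ⊗ c₂ x} {t * c₂ y} {t ⊗ c₂ y} (*≋⊗ s (c₂ x)) (*≋⊗ t (c₂ y))))
        (Equivalence.to (A⇔T x) x∈A) (Equivalence.to (A⇔T y) y∈A))

⟨,⟩-≤ : ∀ {p p′ q q′ : Baire} → (∀ i → p i ℕ.≤ p′ i) → (∀ i → q i ℕ.≤ q′ i) →
        ∀ i → ⟨ p , q ⟩ i ℕ.≤ ⟨ p′ , q′ ⟩ i
⟨,⟩-≤ f g zero    = f zero
⟨,⟩-≤ f g (suc i) = ⟨,⟩-≤ g (f ∘ suc) i

interleave-split : ∀ (ξ : Baire) → ⟨ (λ n → ξ (n ℕ.+ n)) , (λ n → ξ (suc (n ℕ.+ n))) ⟩ ≗ ξ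
interleave-split ξ zero    = refl
interleave-split ξ (suc n) =
  trans (⟨,⟩-cong (λ _ → refl) (λ k → cong (ξ ∘ suc) (ℕ.+-suc k k)) n) (interleave-split (ξ ∘ suc) n)

module PairClusters (em : ExcludedMiddle 0ℓ) where
  open Classical em

  -- Interleaving the two sequences makes their limits arise along the same indices.
  cluster-pairs : ∀ b (ζ₁ ζ₂ : ℕ → Baire) → (∀ n i → ζ₁ n i ℕ.≤ b i) → (∀ n i → ζ₂ n i ℕ.≤ b i) →
    ∃[ ξ₁ ] ∃[ ξ₂ ] (∀ j → Often (λ n → Agree j ξ₁ (ζ₁ n) × Agree j ξ₂ (ζ₂ n)))
  cluster-pairs b ζ₁ ζ₂ b₁ b₂ = build
    (cluster ⟨ b , b ⟩ (λ n → ⟨ ζ₁ n , ζ₂ n ⟩) {λ _ → ⊤}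
      (λ n i _ → ⟨,⟩-≤ (b₁ n) (b₂ n) i) (λ N → N , ℕ.≤-refl , tt))
    where
    build : ∃[ ξ ] (∀ j → Often (λ n → ⊤ × Agree j ξ ⟨ ζ₁ n , ζ₂ n ⟩)) →
      ∃[ ξ₁ ] ∃[ ξ₂ ] (∀ j → Often (λ n → Agree j ξ₁ (ζ₁ n) × Agree j ξ₂ (ζ₂ n)))
    build (ξ , often) = (λ n → ξ (n ℕ.+ n)) , (λ n → ξ (suc (n ℕ.+ n))) , λ j →
      often-map (λ n (_ , a) →
        agree-⟨⟩⁻ {j} {λ n → ξ (n ℕ.+ n)} {ζ₁ n} {λ n → ξ (suc (n ℕ.+ n))} {ζ₂ n}
          (agree-trans (agree-≗ (interleave-split ξ)) a)) (often (j ℕ.+ j))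

module Betweenness (em : ExcludedMiddle 0ℓ) where
  open Order em

  ¬≼⇒gap : ∀ {x y} → ¬ x ≼ y → ∃[ ε ] (0ℚ <ℚ ε × y ⊕ ↑ ε ≼ x)
  ¬≼⇒gap {x} {y} h =
    let (ε , 0<ε , g) = ⋠⇒gap {x} {y} h
    in ε , 0<ε , ≼-trans (≋⇒≽ (+≋⊕ y (↑ ε)))
         (≼-trans (+-mono-≼ {y} {y} {↑ ε} {fromℚ ε} ≼-refl (≋⇒≽ (fromℚ≋↑ ε))) g)

  -- The weights of `x` and `y` are `(y - z) / (y - x)` and `(z - x) / (y - x)`. Inverting `y - x`
  -- needs a positive lower bound, so the case where the endpoints coincide is separate.
  between : ∀ {A : Carrier (𝒜 𝕀)} → Convex {1} A → ∀ {x y z} → _∈_ {𝕀} x A → _∈_ {𝕀} y A →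
            value x ≼ value z → value z ≼ value y → _∈_ {𝕀} z A
  between {A} cvx {x} {y} {z} x∈A y∈A x≼z z≼y with em {value y ≼ value x}
  ... | yes y≼x = trans (sym (Continuous.to-cong A {x} {z}
          (≋⇒≃ {value x} {value z} (x≼z & ≼-trans z≼y y≼x)))) x∈A
  ... | no y⋠x = combine (¬≼⇒gap y⋠x)
    where
    X = value x
    Y = value y
    Z = value z
    combine : ∃[ ε ] (0ℚ <ℚ ε × X ⊕ ↑ ε ≼ Y) → _∈_ {𝕀} z A
    combine (ε , 0<ε , g) = divide-by (inverse (Y ⊖ X) 0<ε (linear g
        (ringʳ 3 (λ x y e → (y :⊖ x) :⊖ e :≋ y :⊖ (x :⊕ e)) refl (X ∷ Y ∷ ↑ ε ∷ []))))
      where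
      divide-by : Σ[ v ∈ ℝ ] (↑ 0ℚ ≼ v × (Y ⊖ X) ⊗ v ≋ ↑ 1ℚ) → _∈_ {𝕀} z A
      divide-by (v , 0≼v , inv) = cvx x y z ((Y ⊖ Z) ⊗ v) ((Z ⊖ X) ⊗ v)
        (≼⇒≤ (≼-trans (≋⇒≼ (fromℚ≋↑ 0ℚ)) (⊗-nonneg (nonneg z≼y) 0≼v)))
        (≼⇒≤ (≼-trans (≋⇒≼ (fromℚ≋↑ 0ℚ)) (⊗-nonneg (nonneg x≼z) 0≼v)))
        (≋⇒≃ {(Y ⊖ Z) ⊗ v + (Z ⊖ X) ⊗ v} {fromℚ 1ℚ}
          (≋-trans (+≋⊕ ((Y ⊖ Z) ⊗ v) ((Z ⊖ X) ⊗ v))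
          (≋-trans (ringʳ 4 (λ x y z v → (y :⊖ z) :⊗ v :⊕ (z :⊖ x) :⊗ v :≋ (y :⊖ x) :⊗ v) refl
                      (X ∷ Y ∷ Z ∷ v ∷ []))
          (≋-trans inv (≋-sym (fromℚ≋↑ 1ℚ))))))
        (λ { zero → ≋⇒≃ {Z} {(Y ⊖ Z) ⊗ v * X + (Z ⊖ X) ⊗ v * Y}
          (≋-trans (≋-sym (≋-trans (⊗-cong ≋-refl inv) (⊗-identityʳ Z)))
          (≋-trans (ringʳ 4 (λ x y z v → z :⊗ ((y :⊖ x) :⊗ v) :≋
                      (y :⊖ z) :⊗ v :⊗ x :⊕ (z :⊖ x) :⊗ v :⊗ y) refl (X ∷ Y ∷ Z ∷ v ∷ []))
            (≋-sym (+-≋ {(Y ⊖ Z) ⊗ v * X} {(Y ⊖ Z) ⊗ v ⊗ X} {(Z ⊖ X) ⊗ v * Y} {(Z ⊖ X) ⊗ v ⊗ Y}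
              (*≋⊗ ((Y ⊖ Z) ⊗ v) X) (*≋⊗ ((Z ⊖ X) ⊗ v) Y))))) })
        x∈A y∈A
        where
        nonneg : ∀ {a b} → a ≼ b → ↑ 0ℚ ≼ b ⊖ a
        nonneg {a} {b} h = linear h
          (ringʳ 2 (λ a b → (b :⊖ a) :⊖ :↑ 0ℚ :≋ b :⊖ a) refl (a ∷ b ∷ []))

-- The rectangles given by `H` and the points given by `K`

Axis : Set
Axis = Fin 2

module Game (em : ExcludedMiddle 0ℓ) (H K : PartialFunction) (H-comp : Computable H) (K-comp : Computable K)
            (red : ∀ G → G ⊢ XC 1 ×ᵐ XC 1 → wrap H G K ⊢ XC₂∣𝔗) where
  open Classical em
  open Realizers em
  open Plays em
  open Betweenness em
  open PairClusters em

  module _ (π : Play) where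
    open Play π

    name : Baire
    name = play-name S

    opaque
      set : Carrier (𝒜 (Cube 2))
      set = proj₁ (closed-set {S} {T} T⊆S converges)

      name-names : Names (𝒜 (Cube 2)) name set
      name-names = proj₁ (proj₂ (closed-set {S} {T} T⊆S converges))

      set⇔ : ∀ x → _∈_ {Cube 2} x set ⇔ In T x
      set⇔ = proj₂ (proj₂ (closed-set {S} {T} T⊆S converges))

      responses : Response H K name set
      responses = response red {name} {set} name-names (in-domain {set} {T} set⇔)

    open Response responses

    bounds : Axis → Baire
    bounds zero    = h₁
    bounds (suc _) = h₂

    interval-set : ∀ i → IntervalSet (bounds i)
    interval-set zero       = set₁
    interval-set (suc zero) = set₂

    interval : ∀ i → Carrier (𝒜 𝕀)
    interval i = proj₁ (interval-set i)

    some-point : ∀ i → ∃[ ζ ] Point (bounds i) ζ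
    some-point zero       = some₁
    some-point (suc zero) = some₂

  infix 4 _∈[_,_]
  _∈[_,_] : UnitInterval → Axis → Play → Set
  x ∈[ i , π ] = _∈_ {𝕀} x (interval π i)

  ¬rejects-∈ : ∀ {i π ζ x} → Approx 2⁻_ ζ (value x) → ¬ Rejects (bounds π i) ζ → x ∈[ i , π ]
  ¬rejects-∈ {i} {π} {ζ} {x} ζx = ¬rejects⇒∈ {𝕀} {A = interval π i} {x}
    (proj₁ (proj₂ (interval-set π i))) (approx⇒name ζx)

  ∈-¬rejects : ∀ {i π ζ x} → Approx 2⁻_ ζ (value x) → x ∈[ i , π ] → ¬ Rejects (bounds π i) ζ
  ∈-¬rejects {i} {π} {ζ} {x} ζx = ∈⇒¬rejects {𝕀} {A = interval π i} {x}
    (proj₁ (proj₂ (interval-set π i))) (approx⇒name ζx)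

  nonempty : ∀ i π → ∃[ x ] x ∈[ i , π ]
  nonempty i π = let (ζ , x , ζx , ¬rej) = some-point π i in x , ¬rejects-∈ {i} {π} {ζ} {x} ζx ¬rej

  between-∈ : ∀ {i π x y z} → x ∈[ i , π ] → y ∈[ i , π ] → value x ≼ value z →
      value z ≼ value y → z ∈[ i , π ]
  between-∈ {i} {π} {x} {y} {z} =
    between {interval π i} (proj₂ (proj₂ (interval-set π i))) {x} {y} {z}

  bounds-continuous : ∀ π i m → ∃[ N ] (∀ π′ → Agree N (Play.S π) (Play.S π′) →
                                      Agree m (bounds π i) (bounds π′ i))
  bounds-continuous π i m =
    let (N , f) = computable-continuous {H} H-comp (Response.maps (responses π)) (m ℕ.+ m)
    in N , λ π′ a → pick i (agree-⟨⟩⁻ (f (name π′) _ (play-name-agree a) (Response.maps (responses π′))))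
    where
    pick : ∀ {π′} i → Agree m (Response.h₁ (responses π)) (Response.h₁ (responses π′)) ×
                     Agree m (Response.h₂ (responses π)) (Response.h₂ (responses π′)) →
           Agree m (bounds π i) (bounds π′ i)
    pick zero       = proj₁
    pick (suc zero) = proj₂

  rejects-persists : ∀ {i π ζ} → Rejects (bounds π i) ζ →
    ∃[ N ] (∀ π′ ζ′ → Agree N (Play.S π) (Play.S π′) → Agree N ζ ζ′ → Rejects (bounds π′ i) ζ′)
  rejects-persists {i} {π} rej =
    let (M , f) = rejects-open rej
        (N , g) = bounds-continuous π i M
    in N ⊔ M , λ π′ ζ′ a b → f _ ζ′ (g π′ (agree-≤ (ℕ.m≤m⊔n N M) a)) (agree-≤ (ℕ.m≤n⊔m N M) b)

  record Output (π : Play) (ζ₁ ζ₂ : Baire) : Set where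
    field
      r₁ r₂ : Baire
      maps  : (K ↦ ⟨ name π , ⟨ ζ₁ , ζ₂ ⟩ ⟩) ⟨ r₁ , r₂ ⟩
      y     : Square
      r₁y   : Approx 2⁻_ r₁ (c₁ y)
      r₂y   : Approx 2⁻_ r₂ (c₂ y)
      y∈T   : In (Play.T π) y

  output : ∀ {π ζ₁ ζ₂} → Point (bounds π zero) ζ₁ → Point (bounds π (suc zero)) ζ₂ → Output π ζ₁ ζ₂
  output {π} p₁ p₂ with Response.answer (responses π) p₁ p₂
  ... | r , Kr , y , (r₁ , r₂ , r≗ , r₁y , r₂y) , y∈ = record
    { r₁ = r₁ ; r₂ = r₂ ; maps = ↦-resp K (λ _ → refl) r≗ Kr ; y = y
    ; r₁y = name⇒approx {r₁} {c₁ y} r₁y ; r₂y = name⇒approx {r₂} {c₂ y} r₂y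
    ; y∈T = Equivalence.to (set⇔ π y) y∈ }

  output-continuous : ∀ {π ζ₁ ζ₂} (o : Output π ζ₁ ζ₂) m →
      ∃[ N ] (∀ {π′ ζ₁′ ζ₂′} (o′ : Output π′ ζ₁′ ζ₂′) →
    Agree N (Play.S π) (Play.S π′) → Agree N ζ₁ ζ₁′ → Agree N ζ₂ ζ₂′ →
    Agree m (Output.r₁ o) (Output.r₁ o′) × Agree m (Output.r₂ o) (Output.r₂ o′))
  output-continuous o m =
    let (N , f) = computable-continuous {K} K-comp (Output.maps o) (m ℕ.+ m)
    in N , λ o′ a b c → agree-⟨⟩⁻ (f _ _ (agree-⟨⟩ (play-name-agree a) (agree-⟨⟩ b c)) (Output.maps o′))

  record TightPoint (i : Axis) (π : Play) : Set where
    field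
      ζ     : Baire
      x     : UnitInterval
      tight : Tight ζ (value x)
      ¬rej  : ¬ Rejects (bounds π i) ζ

    point : Point (bounds π i) ζ
    point = x , tight⇒approx {ζ} tight , ¬rej

    inside : x ∈[ i , π ]
    inside = ¬rejects-∈ {i} {π} {ζ} {x} (tight⇒approx {ζ} tight) ¬rej

  tight-point : ∀ {i π x} → x ∈[ i , π ] → Σ[ z ∈ TightPoint i π ] TightPoint.x z ≡ x
  tight-point {i} {π} {x} x∈ =
    let (ζ , t) = tight-name x
    in record { ζ = ζ ; x = x ; tight = t ; ¬rej = ∈-¬rejects {i} {π} {ζ} {x} (tight⇒approx {ζ} t) x∈ } , refl

  -- Upper semicontinuity of the rectangle: a rejection at the limit would, being open, already
  -- occur for one of the approximating plays and points.
  limit-point : ∀ {i π ξ} →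
    (∀ j → ∃[ π′ ] Σ[ z ∈ TightPoint i π′ ] (Agree j (Play.S π) (Play.S π′) × Agree j ξ (TightPoint.ζ z))) →
    Σ[ w ∈ TightPoint i π ] TightPoint.ζ w ≡ ξ
  limit-point {i} {π} {ξ} near =
    let (x , ξx) = limit-name ¾2⁻≤2⁻ λ N →
          let (π′ , z , a , b) = near N in TightPoint.ζ z , TightPoint.x z , b , TightPoint.tight z
    in record { ζ = ξ ; x = x ; tight = ξx ; ¬rej = λ rej →
         let (N , f) = rejects-persists {i} {π} rej
             (π′ , z , a , b) = near N
         in TightPoint.¬rej z (f π′ (TightPoint.ζ z) a b) } , refl

  limit-points : ∀ {π} (πs : ℕ → Play) → (∀ n → Agree n (Play.S π) (Play.S (πs n))) →
    (z₁ : ∀ n → TightPoint zero (πs n)) (z₂ : ∀ n → TightPoint (suc zero) (πs n)) →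
    Σ[ w₁ ∈ TightPoint zero π ] Σ[ w₂ ∈ TightPoint (suc zero) π ] (∀ j → Often (λ n →
      Agree j (TightPoint.ζ w₁) (TightPoint.ζ (z₁ n)) × Agree j (TightPoint.ζ w₂) (TightPoint.ζ (z₂ n))))
  limit-points {π} πs agree z₁ z₂ = build (cluster-pairs name-bound ζ₁ ζ₂
      (λ n → bounded (z₁ n)) (λ n → bounded (z₂ n)))
    where
    ζ₁ ζ₂ : ℕ → Baire
    ζ₁ n = TightPoint.ζ (z₁ n)
    ζ₂ n = TightPoint.ζ (z₂ n)
    bounded : ∀ {i n} (z : TightPoint i (πs n)) j → TightPoint.ζ z j ℕ.≤ name-bound j
    bounded z =
      approx-bounded {TightPoint.ζ z} {TightPoint.x z} (tight⇒approx {TightPoint.ζ z} (TightPoint.tight z))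
    build : ∃[ ξ₁ ] ∃[ ξ₂ ] (∀ j → Often (λ n → Agree j ξ₁ (ζ₁ n) × Agree j ξ₂ (ζ₂ n))) →
      Σ[ w₁ ∈ TightPoint zero π ] Σ[ w₂ ∈ TightPoint (suc zero) π ] (∀ j → Often (λ n →
        Agree j (TightPoint.ζ w₁) (ζ₁ n) × Agree j (TightPoint.ζ w₂) (ζ₂ n)))
    build (ξ₁ , ξ₂ , often) = pair
      (limit-point {zero} {π} {ξ₁} λ j →
        let (n , j≤n , a , _) = often j j in πs n , z₁ n , agree-≤ j≤n (agree n) , a)
      (limit-point {suc zero} {π} {ξ₂} λ j →
        let (n , j≤n , _ , b) = often j j in πs n , z₂ n , agree-≤ j≤n (agree n) , b)
      where
      pair : Σ[ w ∈ TightPoint zero π ] TightPoint.ζ w ≡ ξ₁ →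
             Σ[ w ∈ TightPoint (suc zero) π ] TightPoint.ζ w ≡ ξ₂ → _
      pair (w₁ , refl) (w₂ , refl) = w₁ , w₂ , often

  -- A point of the rectangle that `K` maps to `x`. Its names are tight, so that all points of a
  -- neighbourhood have names sharing a long prefix with them and continuity of `K` applies to each.
  record Preimage (π : Play) (x : Square) : Set where
    field
      w₁  : TightPoint zero π
      w₂  : TightPoint (suc zero) π
      out : Output π (TightPoint.ζ w₁) (TightPoint.ζ w₂)
      r₁x : Approx 2⁻_ (Output.r₁ out) (c₁ x)
      r₂x : Approx 2⁻_ (Output.r₂ out) (c₂ x)

    at : Axis → UnitInterval
    at zero    = TightPoint.x w₁
    at (suc _) = TightPoint.x w₂

-- Barycentric coordinates

⅓ : ℚ
⅓ = + 1 ℚ./ 3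

0≤⅓ : 0ℚ ≤ℚ ⅓
0≤⅓ = ℚ.<⇒≤ (ℚ.positive⁻¹ ⅓)

⊖-nonneg : ∀ {a b} → a ≼ b → ↑ 0ℚ ≼ b ⊖ a
⊖-nonneg {a} {b} h = linear h (ringʳ 2 (λ a b → (b :⊖ a) :⊖ :↑ 0ℚ :≋ b :⊖ a) refl (a ∷ b ∷ []))

⊖-nonneg⁻ : ∀ {a b} → ↑ 0ℚ ≼ b ⊖ a → a ≼ b
⊖-nonneg⁻ {a} {b} h = linear h (ringʳ 2 (λ a b → b :⊖ a :≋ (b :⊖ a) :⊖ :↑ 0ℚ) refl (a ∷ b ∷ []))

≼-from : ∀ {a b d} → b ⊖ a ≋ d → ↑ 0ℚ ≼ d → a ≼ b
≼-from e h = ⊖-nonneg⁻ (≼-trans h (≋⇒≽ e))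

-- For identities that hold only modulo a relation `p = 0`: the solver proves the identity with an
-- explicit multiple of `p` added, which is then dropped.
vanishes : ∀ {a p} E → p ≋ ↑ 0ℚ → a ⊕ p ⊗ E ≋ a
vanishes {a} E p≋0 = ≋-trans (⊕-cong ≋-refl (⊗-cong p≋0 ≋-refl))
  (ringʳ 2 (λ a E → a :⊕ :↑ 0ℚ :⊗ E :≋ a) refl (a ∷ E ∷ []))

⊖-zero : ∀ {a b} → a ≋ b → a ⊖ b ≋ ↑ 0ℚ
⊖-zero {a} {b} e = ≋-trans (⊕-cong e ≋-refl) (⊕-inverseʳ b)

record Lipschitz (f : Square → ℝ) : Set where
  field
    L    : ℚ
    0≤L  : 0ℚ ≤ℚ L
    near : ∀ {x y e} → 0ℚ ≤ℚ e → Near e x y → Close (f x) (f y) (L *ℚ e)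

-- Avoids absolute values: `c b + B e - c a` is half of `(B - c)(a + e - b) + (B + c)(b + e - a)`,
-- where all four factors are nonnegative.
close-scale : ∀ {a b c e} B → ⊝ ↑ B ≼ c → c ≼ ↑ B → Close a b e → Close (c ⊗ a) (c ⊗ b) (B *ℚ e)
close-scale {a} {b} {c} {e} B -B≼c c≼B (mkClose p q) = mkClose (le p q) (le q p)
  where
  le : ∀ {a b} → a ≼ b ⊕ ↑ e → b ≼ a ⊕ ↑ e → c ⊗ a ≼ c ⊗ b ⊕ ↑ (B *ℚ e)
  le {a} {b} p q = ≼-trans (≼-from
    (ringʳ 5 (λ a b c B e → (c :⊗ b :⊕ B :⊗ e) :⊖ c :⊗ a :≋
      :↑ ½ :⊗ ((B :⊖ c) :⊗ ((a :⊕ e) :⊖ b) :⊕ (c :⊖ :⊝ B) :⊗ ((b :⊕ e) :⊖ a))) refl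
      (a ∷ b ∷ c ∷ ↑ B ∷ ↑ e ∷ []))
    (⊗-nonneg (↑-mono 0≤½)
      (⊕-nonneg (⊗-nonneg (⊖-nonneg c≼B) (⊖-nonneg q)) (⊗-nonneg (⊖-nonneg -B≼c) (⊖-nonneg p)))))
    (⊕-mono ≼-refl (≋⇒≽ (↑-* B e)))

close-⊕ : ∀ {a b c d e f} → Close a b e → Close c d f → Close (a ⊕ c) (b ⊕ d) (e +ℚ f)
close-⊕ {a} {b} {c} {d} {e} {f} (mkClose p q) (mkClose r s) = mkClose (le p r) (le q s)
  where
  le : ∀ {a b c d} → a ≼ b ⊕ ↑ e → c ≼ d ⊕ ↑ f → a ⊕ c ≼ (b ⊕ d) ⊕ ↑ (e +ℚ f)
  le {a} {b} {c} {d} p r = ≼-trans (⊕-mono p r) (≼-trans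
    (≋⇒≼ (ringʳ 4 (λ b d e f → (b :⊕ e) :⊕ (d :⊕ f) :≋ (b :⊕ d) :⊕ (e :⊕ f)) refl (b ∷ d ∷ ↑ e ∷ ↑ f ∷ [])))
    (⊕-mono ≼-refl (≋⇒≽ (↑-+ e f))))

lipschitz-c₁ : Lipschitz c₁
lipschitz-c₁ = record { L = 1ℚ ; 0≤L = ℚ.<⇒≤ (ℚ.positive⁻¹ 1ℚ)
  ; near = λ {x} {y} {e} _ (h , _) → subst (Close (c₁ x) (c₁ y)) (sym (ℚ.*-identityˡ e)) h }

lipschitz-c₂ : Lipschitz c₂
lipschitz-c₂ = record { L = 1ℚ ; 0≤L = ℚ.<⇒≤ (ℚ.positive⁻¹ 1ℚ)
  ; near = λ {x} {y} {e} _ (_ , h) → subst (Close (c₂ x) (c₂ y)) (sym (ℚ.*-identityˡ e)) h }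

lipschitz-const : ∀ q → Lipschitz (const (↑ q))
lipschitz-const q = record { L = 0ℚ ; 0≤L = ℚ.≤-refl
  ; near = λ {x} {y} {e} _ _ → close-refl (ℚ.≤-reflexive (sym (ℚ.*-zeroˡ e))) }

lipschitz-⊕ : ∀ {f g} → Lipschitz f → Lipschitz g → Lipschitz (λ x → f x ⊕ g x)
lipschitz-⊕ {f} {g} F G = record
  { L = F.L +ℚ G.L ; 0≤L = ℚ.+-mono-≤ F.0≤L G.0≤L
  ; near = λ {x} {y} {e} 0≤e h → subst (Close (f x ⊕ g x) (f y ⊕ g y)) (sym (ℚ.*-distribʳ-+ e F.L G.L))
      (close-⊕ (F.near {x} {y} 0≤e h) (G.near {x} {y} 0≤e h)) }
  where
  module F = Lipschitz F
  module G = Lipschitz G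

lipschitz-scale : ∀ {f} B c → 0ℚ ≤ℚ B → ⊝ ↑ B ≼ c → c ≼ ↑ B → Lipschitz f →
    Lipschitz (λ x → c ⊗ f x)
lipschitz-scale {f} B c 0≤B -B≼c c≼B F = record
  { L = B *ℚ F.L ; 0≤L = *-nonnegℚ 0≤B F.0≤L
  ; near = λ {x} {y} {e} 0≤e h → subst (Close (c ⊗ f x) (c ⊗ f y)) (sym (ℚ.*-assoc B F.L e))
      (close-scale B -B≼c c≼B (F.near {x} {y} 0≤e h)) }
  where module F = Lipschitz F

-- Barycentric coordinates as functions on the whole square. Outside `S` some coordinate is
-- negative, so membership is a matter of signs, and the Lipschitz bounds make it a closed
-- condition.
record Frame (S : Shape) : Set where
  field
    f₀ f₁ f₂ : Square → ℝ
    sum      : ∀ x → f₀ x ⊕ f₁ x ⊕ f₂ x ≋ ↑ 1ℚ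
    at₁      : ∀ x → c₁ x ≋ mixture (f₀ x) (f₁ x) (f₂ x) (c₁ (proj₁ S)) (c₁ (proj₁ (proj₂ S))) (c₁ (proj₂ (proj₂ S)))
    at₂      : ∀ x → c₂ x ≋ mixture (f₀ x) (f₁ x) (f₂ x) (c₂ (proj₁ S)) (c₂ (proj₁ (proj₂ S))) (c₂ (proj₂ (proj₂ S)))
    unique   : ∀ {x r s t} → Bary S x r s t → f₀ x ≋ r × f₁ x ≋ s × f₂ x ≋ t
    lip₀     : Lipschitz f₀
    lip₁     : Lipschitz f₁
    lip₂     : Lipschitz f₂

  Deep : ℚ → Square → Set
  Deep δ x = ↑ δ ≼ f₀ x × ↑ δ ≼ f₁ x × ↑ δ ≼ f₂ x

  deep⇒in : ∀ {x} → Deep 0ℚ x → In S x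
  deep⇒in {x} (p , q , r) = bary⇒in {r = f₀ x} {f₁ x} {f₂ x} (record
    { 0≼r = p ; 0≼s = q ; 0≼t = r ; sum = sum x ; at₁ = at₁ x ; at₂ = at₂ x })

  in⇒deep : ∀ {x} → In S x → Deep 0ℚ x
  in⇒deep x∈S =
    let (r , s , t , β) = in⇒bary x∈S
        (p , q , w) = unique β
    in ≼-trans (Bary.0≼r β) (≋⇒≽ p) , ≼-trans (Bary.0≼s β) (≋⇒≽ q) , ≼-trans (Bary.0≼t β) (≋⇒≽ w)

0≤spread : ∀ n → 0ℚ ≤ℚ spread n
0≤spread n = ℚ.+-mono-≤ (0≤2⁻ n) (0≤2⁻ n)

nonneg-limit : ∀ {f} (F : Lipschitz f) x →
               (∀ n → ∃[ y ] (↑ 0ℚ ≼ f y × Near (spread n) x y)) → ↑ 0ℚ ≼ f x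
nonneg-limit {f} F x h = ≼-archimedean↑ (F.L +ℚ F.L) λ n →
  let (y , 0≼fy , near) = h n
  in ≼-trans 0≼fy (≼-trans (close-≽ (F.near {x} {y} (0≤spread n) near))
       (⊕-mono ≼-refl (≋⇒≼ (↑-cong (double F.L (2⁻ n))))))
  where
  module F = Lipschitz F
  double : ∀ L h → L *ℚ (h +ℚ h) ≡ (L +ℚ L) *ℚ h
  double L h = ring 2 (λ L h → L :* (h :+ h) := (L :+ L) :* h) refl (L ∷ h ∷ [])

frame-closed : ∀ {S} → Frame S → Closed S
frame-closed {S} F x near = deep⇒in
  ( nonneg-limit lip₀ x (λ n → let (y , y∈ , c) = near n in y , proj₁ (in⇒deep y∈) , c)
  , nonneg-limit lip₁ x (λ n → let (y , y∈ , c) = near n in y , proj₁ (proj₂ (in⇒deep y∈)) , c)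
  , nonneg-limit lip₂ x (λ n → let (y , y∈ , c) = near n in y , proj₂ (proj₂ (in⇒deep y∈)) , c) )
  where open Frame F

swap₂₃ swap₁₃ : Shape → Shape
swap₂₃ (a , b , c) = a , c , b
swap₁₃ (a , b , c) = c , b , a

mixture-swap₂₃ : ∀ r s t a b c → mixture r s t a b c ≋ mixture r t s a c b
mixture-swap₂₃ r s t a b c = ringʳ 6 (λ r s t a b c →
  r :⊗ a :⊕ s :⊗ b :⊕ t :⊗ c :≋ r :⊗ a :⊕ t :⊗ c :⊕ s :⊗ b) refl (r ∷ s ∷ t ∷ a ∷ b ∷ c ∷ [])

mixture-swap₁₃ : ∀ r s t a b c → mixture r s t a b c ≋ mixture t s r c b a
mixture-swap₁₃ r s t a b c = ringʳ 6 (λ r s t a b c →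
  r :⊗ a :⊕ s :⊗ b :⊕ t :⊗ c :≋ t :⊗ c :⊕ s :⊗ b :⊕ r :⊗ a) refl (r ∷ s ∷ t ∷ a ∷ b ∷ c ∷ [])

sum-swap₂₃ : ∀ r s t → r ⊕ s ⊕ t ≋ r ⊕ t ⊕ s
sum-swap₂₃ r s t = ringʳ 3 (λ r s t → r :⊕ s :⊕ t :≋ r :⊕ t :⊕ s) refl (r ∷ s ∷ t ∷ [])

sum-swap₁₃ : ∀ r s t → r ⊕ s ⊕ t ≋ t ⊕ s ⊕ r
sum-swap₁₃ r s t = ringʳ 3 (λ r s t → r :⊕ s :⊕ t :≋ t :⊕ s :⊕ r) refl (r ∷ s ∷ t ∷ [])

bary-swap₂₃ : ∀ {S x r s t} → Bary S x r s t → Bary (swap₂₃ S) x r t s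
bary-swap₂₃ {a , b , c} {x} {r} {s} {t} β = record
  { 0≼r = 0≼r ; 0≼s = 0≼t ; 0≼t = 0≼s
  ; sum = ≋-trans (sum-swap₂₃ r t s) sum
  ; at₁ = ≋-trans at₁ (mixture-swap₂₃ r s t (c₁ a) (c₁ b) (c₁ c))
  ; at₂ = ≋-trans at₂ (mixture-swap₂₃ r s t (c₂ a) (c₂ b) (c₂ c)) }
  where open Bary β

bary-swap₁₃ : ∀ {S x r s t} → Bary S x r s t → Bary (swap₁₃ S) x t s r
bary-swap₁₃ {a , b , c} {x} {r} {s} {t} β = record
  { 0≼r = 0≼t ; 0≼s = 0≼s ; 0≼t = 0≼r
  ; sum = ≋-trans (sum-swap₁₃ t s r) sum
  ; at₁ = ≋-trans at₁ (mixture-swap₁₃ r s t (c₁ a) (c₁ b) (c₁ c))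
  ; at₂ = ≋-trans at₂ (mixture-swap₁₃ r s t (c₂ a) (c₂ b) (c₂ c)) }
  where open Bary β

opaque
  frame-swap₂₃ : ∀ {S} → Frame S → Frame (swap₂₃ S)
  frame-swap₂₃ {S@(a , b , c)} F = record
    { f₀ = f₀ ; f₁ = f₂ ; f₂ = f₁
    ; sum = λ x → ≋-trans (sum-swap₂₃ (f₀ x) (f₂ x) (f₁ x)) (sum x)
    ; at₁ = λ x → ≋-trans (at₁ x) (mixture-swap₂₃ (f₀ x) (f₁ x) (f₂ x) (c₁ a) (c₁ b) (c₁ c))
    ; at₂ = λ x → ≋-trans (at₂ x) (mixture-swap₂₃ (f₀ x) (f₁ x) (f₂ x) (c₂ a) (c₂ b) (c₂ c))
    ; unique = λ β → let (p , q , r) = unique (bary-swap₂₃ {a , c , b} β) in p , r , q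
    ; lip₀ = lip₀ ; lip₁ = lip₂ ; lip₂ = lip₁ }
    where open Frame F

  frame-swap₁₃ : ∀ {S} → Frame S → Frame (swap₁₃ S)
  frame-swap₁₃ {S@(a , b , c)} F = record
    { f₀ = f₂ ; f₁ = f₁ ; f₂ = f₀
    ; sum = λ x → ≋-trans (sum-swap₁₃ (f₂ x) (f₁ x) (f₀ x)) (sum x)
    ; at₁ = λ x → ≋-trans (at₁ x) (mixture-swap₁₃ (f₀ x) (f₁ x) (f₂ x) (c₁ a) (c₁ b) (c₁ c))
    ; at₂ = λ x → ≋-trans (at₂ x) (mixture-swap₁₃ (f₀ x) (f₁ x) (f₂ x) (c₂ a) (c₂ b) (c₂ c))
    ; unique = λ β → let (p , q , r) = unique (bary-swap₁₃ {c , b , a} β) in r , q , p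
    ; lip₀ = lip₂ ; lip₁ = lip₁ ; lip₂ = lip₀ }
    where open Frame F

  deep-swap₂₃ : ∀ {S e x} (F : Frame S) → Frame.Deep F e x → Frame.Deep (frame-swap₂₃ F) e x
  deep-swap₂₃ F (p , q , r) = p , r , q

  deep-swap₁₃ : ∀ {S e x} (F : Frame S) → Frame.Deep F e x → Frame.Deep (frame-swap₁₃ F) e x
  deep-swap₁₃ F (p , q , r) = r , q , p

-- When the first vertex moves towards the second by the factor 1 - v, the
-- barycentric coordinates (r , s , t) become ((1 + κ) r , s - κ r , t).
record Weight : Set where
  field
    κ v    : ℚ
    0<κ    : 0ℚ <ℚ κ
    κ≤½    : κ ≤ℚ ½
    0≤v    : 0ℚ ≤ℚ v
    v≤1    : v ≤ℚ 1ℚ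
    scaled : v *ℚ (1ℚ +ℚ κ) ≡ 1ℚ

  scaledʳ : ↑ v ⊗ (↑ 1ℚ ⊕ ↑ κ) ⊖ ↑ 1ℚ ≋ ↑ 0ℚ
  scaledʳ = ⊖-zero (≋-trans (⊗-cong ≋-refl (≋-sym (↑-+ 1ℚ κ)))
    (≋-trans (≋-sym (↑-* v (1ℚ +ℚ κ))) (↑-cong scaled)))

weight : ∀ κ → 0ℚ <ℚ κ → κ ≤ℚ ½ → Weight
weight κ 0<κ κ≤½ =
  let (v , 0<v , e) = inverseℚ (1ℚ +ℚ κ) (ℚ.+-mono-< (ℚ.positive⁻¹ 1ℚ) 0<κ)
  in record { κ = κ ; v = v ; 0<κ = 0<κ ; κ≤½ = κ≤½ ; 0≤v = ℚ.<⇒≤ 0<v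
            ; v≤1 = bound v (ℚ.<⇒≤ 0<v) e ; scaled = trans (ℚ.*-comm v (1ℚ +ℚ κ)) e }
  where
  bound : ∀ v → 0ℚ ≤ℚ v → (1ℚ +ℚ κ) *ℚ v ≡ 1ℚ → v ≤ℚ 1ℚ
  bound v 0≤v e = subst (v ≤ℚ_) e (rearrangeℚ (*-nonnegℚ (ℚ.<⇒≤ 0<κ) 0≤v)
    (ring 2 (λ κ v → (con 1ℚ :+ κ) :* v :- v := κ :* v :- con 0ℚ) refl (κ ∷ v ∷ [])))

blend : ∀ v → 0ℚ ≤ℚ v → v ≤ℚ 1ℚ → UnitInterval → UnitInterval → UnitInterval
blend v 0≤v v≤1 x y = unit-interval (↑ v ⊗ value x ⊕ (↑ 1ℚ ⊖ ↑ v) ⊗ value y)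
  (⊕-nonneg (⊗-nonneg 0≼v (0≼value x)) (⊗-nonneg 0≼1-v (0≼value y)))
  (≼-from (ringʳ 3 (λ v x y → :↑ 1ℚ :⊖ (v :⊗ x :⊕ (:↑ 1ℚ :⊖ v) :⊗ y) :≋
      v :⊗ (:↑ 1ℚ :⊖ x) :⊕ (:↑ 1ℚ :⊖ v) :⊗ (:↑ 1ℚ :⊖ y)) refl (↑ v ∷ value x ∷ value y ∷ []))
    (⊕-nonneg (⊗-nonneg 0≼v (⊖-nonneg (value≼1 x))) (⊗-nonneg 0≼1-v (⊖-nonneg (value≼1 y)))))
  where
  0≼v = ↑-mono 0≤v
  0≼1-v = ⊖-nonneg (↑-mono v≤1)

module _ (W : Weight) where
  open Weight W

  opaque
    towards : Square → Square → Square
    towards (x , y) (x′ , y′) = blend v 0≤v v≤1 x x′ , blend v 0≤v v≤1 y y′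

    move : Shape → Shape
    move (a , b , c) = towards a b , b , c

  move-mixture : ∀ r s t a b c →
    mixture r s t (↑ v ⊗ a ⊕ (↑ 1ℚ ⊖ ↑ v) ⊗ b) b c ≋ mixture (↑ v ⊗ r) (s ⊕ (↑ 1ℚ ⊖ ↑ v) ⊗ r) t a b c
  move-mixture r s t a b c = ringʳ 7 (λ v r s t a b c →
    r :⊗ (v :⊗ a :⊕ (:↑ 1ℚ :⊖ v) :⊗ b) :⊕ s :⊗ b :⊕ t :⊗ c :≋
    (v :⊗ r) :⊗ a :⊕ (s :⊕ (:↑ 1ℚ :⊖ v) :⊗ r) :⊗ b :⊕ t :⊗ c) refl
    (↑ v ∷ r ∷ s ∷ t ∷ a ∷ b ∷ c ∷ [])

  opaque
    unfolding move

    move-bary : ∀ {S x r s t} → Bary (move S) x r s t → Bary S x (↑ v ⊗ r) (s ⊕ (↑ 1ℚ ⊖ ↑ v) ⊗ r) t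
    move-bary {a , b , c} {x} {r} {s} {t} β = record
      { 0≼r = ⊗-nonneg (↑-mono 0≤v) 0≼r
      ; 0≼s = ⊕-nonneg 0≼s (⊗-nonneg (⊖-nonneg (↑-mono v≤1)) 0≼r)
      ; 0≼t = 0≼t
      ; sum = ≋-trans (ringʳ 4 (λ v r s t → v :⊗ r :⊕ (s :⊕ (:↑ 1ℚ :⊖ v) :⊗ r) :⊕ t :≋ r :⊕ s :⊕ t) refl
                (↑ v ∷ r ∷ s ∷ t ∷ [])) sum
      ; at₁ = ≋-trans at₁ (move-mixture r s t (c₁ a) (c₁ b) (c₁ c))
      ; at₂ = ≋-trans at₂ (move-mixture r s t (c₂ a) (c₂ b) (c₂ c)) }
      where open Bary β

  move-⊆ : ∀ S → move S ⊆ S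
  move-⊆ S x x∈ = let (r , s , t , β) = in⇒bary {move S} {x} x∈ in bary⇒in (move-bary {S} β)

  opaque
    unfolding move

    frame-move : ∀ {S} → Frame S → Frame (move S)
    frame-move {S@(a , b , c)} F = record
      { f₀ = λ x → (↑ 1ℚ ⊕ ↑ κ) ⊗ f₀ x ; f₁ = λ x → f₁ x ⊕ (⊝ ↑ κ) ⊗ f₀ x ; f₂ = f₂
      ; sum = λ x → ≋-trans (ringʳ 4 (λ κ r s t →
          (:↑ 1ℚ :⊕ κ) :⊗ r :⊕ (s :⊕ (:⊝ κ) :⊗ r) :⊕ t :≋ r :⊕ s :⊕ t) refl (↑ κ ∷ f₀ x ∷ f₁ x ∷ f₂ x ∷ [])) (sum x)
      ; at₁ = λ x → ≋-trans (at₁ x) (recon (f₀ x) (f₁ x) (f₂ x) (c₁ a) (c₁ b) (c₁ c))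
      ; at₂ = λ x → ≋-trans (at₂ x) (recon (f₀ x) (f₁ x) (f₂ x) (c₂ a) (c₂ b) (c₂ c))
      ; unique = λ {x} {r} {s} {t} β →
          let (p , q , w) = unique (move-bary {S} β)
          in ≋-trans (⊗-cong ≋-refl p) (≋-trans
               (ringʳ 3 (λ κ v r → (:↑ 1ℚ :⊕ κ) :⊗ (v :⊗ r) :≋
                 r :⊕ (v :⊗ (:↑ 1ℚ :⊕ κ) :⊖ :↑ 1ℚ) :⊗ r) refl (↑ κ ∷ ↑ v ∷ r ∷ []))
               (vanishes r scaledʳ)) ,
             ≋-trans (⊕-cong q (⊗-cong ≋-refl p)) (≋-trans
               (ringʳ 4 (λ κ v r s → (s :⊕ (:↑ 1ℚ :⊖ v) :⊗ r) :⊕ (:⊝ κ) :⊗ (v :⊗ r) :≋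
                 s :⊕ (v :⊗ (:↑ 1ℚ :⊕ κ) :⊖ :↑ 1ℚ) :⊗ (:⊝ r)) refl (↑ κ ∷ ↑ v ∷ r ∷ s ∷ []))
               (vanishes (⊝ r) scaledʳ)) , w
      ; lip₀ = lipschitz-scale (1ℚ +ℚ κ) (↑ 1ℚ ⊕ ↑ κ) 0≤1+κ
          (≼-trans (below 0≤1+κ) (≋⇒≼ (↑-+ 1ℚ κ))) (≋⇒≽ (↑-+ 1ℚ κ)) lip₀
      ; lip₁ = lipschitz-⊕ lip₁ (lipschitz-scale κ (⊝ ↑ κ) (ℚ.<⇒≤ 0<κ) ≼-refl
          (below (ℚ.<⇒≤ 0<κ)) lip₀)
      ; lip₂ = lip₂ }
      where
      open Frame F
      0≤1+κ : 0ℚ ≤ℚ 1ℚ +ℚ κ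
      0≤1+κ = ℚ.<⇒≤ (ℚ.+-mono-< (ℚ.positive⁻¹ 1ℚ) 0<κ)
      below : ∀ {B} → 0ℚ ≤ℚ B → ⊝ ↑ B ≼ ↑ B
      below {B} 0≤B = ≼-from (ringʳ 1 (λ B → B :⊖ (:⊝ B) :≋ B :⊕ B) refl (↑ B ∷ []))
        (⊕-nonneg (↑-mono 0≤B) (↑-mono 0≤B))
      recon : ∀ r s t a b c → mixture r s t a b c ≋
        mixture ((↑ 1ℚ ⊕ ↑ κ) ⊗ r) (s ⊕ (⊝ ↑ κ) ⊗ r) t (↑ v ⊗ a ⊕ (↑ 1ℚ ⊖ ↑ v) ⊗ b) b c
      recon r s t a b c = ≋-sym (≋-trans
        (ringʳ 8 (λ κ v r s t a b c →
          ((:↑ 1ℚ :⊕ κ) :⊗ r) :⊗ (v :⊗ a :⊕ (:↑ 1ℚ :⊖ v) :⊗ b) :⊕ (s :⊕ (:⊝ κ) :⊗ r) :⊗ b :⊕ t :⊗ c :≋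
          (r :⊗ a :⊕ s :⊗ b :⊕ t :⊗ c) :⊕ (v :⊗ (:↑ 1ℚ :⊕ κ) :⊖ :↑ 1ℚ) :⊗ (r :⊗ a :⊖ r :⊗ b)) refl
          (↑ κ ∷ ↑ v ∷ r ∷ s ∷ t ∷ a ∷ b ∷ c ∷ []))
        (vanishes (r ⊗ a ⊖ r ⊗ b) scaledʳ))

  opaque
    unfolding frame-move

    -- Only the second coordinate can decrease, to `s - κ r`. As the coordinates add up to 1, it
    -- exceeds `δ - κ` by `(s - δ) + κ (s + t)`.
    deep-move : ∀ {S δ x} (F : Frame S) → κ ≤ℚ δ → Frame.Deep F δ x →
        Frame.Deep (frame-move F) (δ -ℚ κ) x
    deep-move {S} {δ} {x} F κ≤δ (p , q , w) =
      ≼-trans (↑-mono shrink) (≼-from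
        (ringʳ 3 (λ κ r d → (:↑ 1ℚ :⊕ κ) :⊗ r :⊖ d :≋ κ :⊗ r :⊕ (r :⊖ d)) refl (↑ κ ∷ f₀ x ∷ ↑ δ ∷ []))
        (⊕-nonneg (⊗-nonneg 0≼κ 0≼f₀) (⊖-nonneg p))) ,
      ≼-from (≋-trans (⊕-cong ≋-refl (⊝-cong (≋-trans (↑-+ δ (-ℚ κ)) (⊕-cong ≋-refl (↑-⊝ κ)))))
        (≋-trans (ringʳ 5 (λ κ d r s t → (s :⊕ (:⊝ κ) :⊗ r) :⊖ (d :⊕ :⊝ κ) :≋
            ((s :⊖ d) :⊕ κ :⊗ (s :⊕ t)) :⊕ (r :⊕ s :⊕ t :⊖ :↑ 1ℚ) :⊗ (:⊝ κ)) refl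
            (↑ κ ∷ ↑ δ ∷ f₀ x ∷ f₁ x ∷ f₂ x ∷ []))
          (vanishes (⊝ ↑ κ) (⊖-zero (sum x)))))
        (⊕-nonneg (⊖-nonneg q) (⊗-nonneg 0≼κ (⊕-nonneg (≼-trans 0≼δ q) (≼-trans 0≼δ w)))) ,
      ≼-trans (↑-mono shrink) w
      where
      open Frame F
      0≼κ : ↑ 0ℚ ≼ ↑ κ
      0≼κ = ↑-mono (ℚ.<⇒≤ 0<κ)
      0≼δ : ↑ 0ℚ ≼ ↑ δ
      0≼δ = ↑-mono (ℚ.≤-trans (ℚ.<⇒≤ 0<κ) κ≤δ)
      0≼f₀ : ↑ 0ℚ ≼ f₀ x
      0≼f₀ = ≼-trans 0≼δ p
      shrink : δ -ℚ κ ≤ℚ δ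
      shrink = rearrangeℚ (ℚ.<⇒≤ 0<κ)
        (ring 2 (λ d κ → d :- (d :- κ) := κ :- con 0ℚ) refl (δ ∷ κ ∷ []))

record Value {S} (F : Frame S) (x : Square) (p q r : ℚ) : Set where
  constructor value-of
  field
    is₀ : Frame.f₀ F x ≋ ↑ p
    is₁ : Frame.f₁ F x ≋ ↑ q
    is₂ : Frame.f₂ F x ≋ ↑ r

value-in : ∀ {S F x p q r} → Value {S} F x p q r → 0ℚ ≤ℚ p → 0ℚ ≤ℚ q → 0ℚ ≤ℚ r → In S x
value-in {F = F} (value-of e₀ e₁ e₂) p q r = Frame.deep⇒in F
  (≼-trans (↑-mono p) (≋⇒≽ e₀) , ≼-trans (↑-mono q) (≋⇒≽ e₁) , ≼-trans (↑-mono r) (≋⇒≽ e₂))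

value-out : ∀ {S F x p q r} → Value {S} F x p q r → q <ℚ 0ℚ → ¬ In S x
value-out {F = F} (value-of _ e₁ _) q<0 x∈S =
  ≤⇒≯ℚ (↑-reflect (≼-trans (proj₁ (proj₂ (Frame.in⇒deep F x∈S))) (≋⇒≼ e₁))) q<0

opaque
  unfolding frame-move frame-swap₂₃ frame-swap₁₃

  value-move : ∀ {S F x p q r p′ q′} (W : Weight) → let open Weight W in
    p′ ≡ (1ℚ +ℚ κ) *ℚ p → q′ ≡ q +ℚ (-ℚ κ) *ℚ p →
    Value {S} F x p q r → Value (frame-move W F) x p′ q′ r
  value-move {p = p} {q} W refl refl (value-of e₀ e₁ e₂) = value-of
    (≋-trans (⊗-cong (≋-sym (↑-+ 1ℚ κ)) e₀) (≋-sym (↑-* (1ℚ +ℚ κ) p)))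
    (≋-trans (⊕-cong e₁ (≋-trans (⊗-cong (≋-sym (↑-⊝ κ)) e₀) (≋-sym (↑-* (-ℚ κ) p)))) (≋-sym (↑-+ q ((-ℚ κ) *ℚ p))))
    e₂
    where open Weight W

  value-swap₂₃ : ∀ {S F x p q r} → Value {S} F x p q r → Value (frame-swap₂₃ F) x p r q
  value-swap₂₃ (value-of e₀ e₁ e₂) = value-of e₀ e₂ e₁

  value-swap₁₃ : ∀ {S F x p q r} → Value {S} F x p q r → Value (frame-swap₁₃ F) x r q p
  value-swap₁₃ (value-of e₀ e₁ e₂) = value-of e₂ e₁ e₀

-- The chain of triangles and the boundary points that it leaves

0≤1 : 0ℚ ≤ℚ 1ℚ
0≤1 = ℚ.<⇒≤ (ℚ.positive⁻¹ 1ℚ)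

½≤1 : ½ ≤ℚ 1ℚ
½≤1 = rearrangeℚ 0≤½ refl

opaque
  halfway : Square → Square → Square
  halfway (x , y) (x′ , y′) = blend ½ 0≤½ ½≤1 x x′ , blend ½ 0≤½ ½≤1 y y′

  c₁-halfway : ∀ x y → c₁ (halfway x y) ≋ ↑ ½ ⊗ c₁ x ⊕ (↑ 1ℚ ⊖ ↑ ½) ⊗ c₁ y
  c₁-halfway x y = ≋-refl

  c₂-halfway : ∀ x y → c₂ (halfway x y) ≋ ↑ ½ ⊗ c₂ x ⊕ (↑ 1ℚ ⊖ ↑ ½) ⊗ c₂ y
  c₂-halfway x y = ≋-refl

-- Points on the boundary of S, in the order in which the chain below leaves them.
corner : Shape → ℕ → Square
corner (a , b , c) 0 = a
corner (a , b , c) 1 = halfway a b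
corner (a , b , c) 2 = b
corner (a , b , c) 3 = halfway b c
corner (a , b , c) _ = c

in-swap₂₃ : ∀ {S} → swap₂₃ S ⊆ S
in-swap₂₃ {S} x x∈ = let (r , s , t , β) = in⇒bary {swap₂₃ S} x∈ in bary⇒in (bary-swap₂₃ {swap₂₃ S} β)

in-swap₁₃ : ∀ {S} → swap₁₃ S ⊆ S
in-swap₁₃ {S} x x∈ = let (r , s , t , β) = in⇒bary {swap₁₃ S} x∈ in bary⇒in (bary-swap₁₃ {swap₁₃ S} β)

module Chain (W : Weight) where
  open Weight W

  -- Brings the vertex to be moved to the front and its aim to second place. In terms of the
  -- original vertices, the moves are a towards b, a towards c, b towards c, b towards a, and c
  -- towards a. The first move of a or b cuts off that vertex; the second turns the edge ab or bc
  -- inwards and so loses its midpoint.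
  arrange : ℕ → Shape → Shape
  arrange 0 S = S
  arrange 1 S = swap₂₃ S
  arrange 2 S = swap₁₃ S
  arrange 3 S = swap₂₃ S
  arrange _ S = swap₁₃ S

  arrange-frame : ∀ j {S} → Frame S → Frame (arrange j S)
  arrange-frame 0 F = F
  arrange-frame 1 F = frame-swap₂₃ F
  arrange-frame 2 F = frame-swap₁₃ F
  arrange-frame 3 F = frame-swap₂₃ F
  arrange-frame (suc (suc (suc (suc _)))) F = frame-swap₁₃ F

  arrange-⊆ : ∀ j S → arrange j S ⊆ S
  arrange-⊆ 0 S x x∈ = x∈
  arrange-⊆ 1 S = in-swap₂₃ {S}
  arrange-⊆ 2 S = in-swap₁₃ {S}
  arrange-⊆ 3 S = in-swap₂₃ {S}
  arrange-⊆ (suc (suc (suc (suc _)))) S = in-swap₁₃ {S}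

  chain : Shape → ℕ → Shape
  chain S zero    = S
  chain S (suc j) = move W (arrange j (chain S j))

  chain-frame : ∀ {S} → Frame S → ∀ j → Frame (chain S j)
  chain-frame F zero    = F
  chain-frame {S} F (suc j) =
    frame-move W {arrange j (chain S j)} (arrange-frame j {chain S j} (chain-frame {S} F j))

  chain-⊆ : ∀ S j → chain S (suc j) ⊆ chain S j
  chain-⊆ S j x x∈ = arrange-⊆ j (chain S j) x (move-⊆ W (arrange j (chain S j)) x x∈)

  chain-antitone : ∀ S {j k} → j ℕ.≤ k → chain S k ⊆ chain S j
  chain-antitone S j≤k = go (ℕ.≤⇒≤′ j≤k)
    where
    go : ∀ {j k} → j ℕ.≤′ k → chain S k ⊆ chain S j
    go (ℕ.≤′-reflexive refl) x x∈ = x∈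
    go (ℕ.≤′-step {n = k} h) x x∈ = go h x (chain-⊆ S k x x∈)

  deep-step : ∀ {S e x} (F : Frame S) → 0ℚ ≤ℚ e → Frame.Deep F (e +ℚ κ) x →
              Frame.Deep (frame-move W F) e x
  deep-step {S} {e} {x} F 0≤e h = subst (λ d → Frame.Deep (frame-move W {S} F) d x)
    (ring 2 (λ e κ → (e :+ κ) :- κ := e) refl (e ∷ κ ∷ []))
    (deep-move W {S} {e +ℚ κ} {x} F (rearrangeℚ 0≤e
      (ring 2 (λ e κ → (e :+ κ) :- κ := e :- con 0ℚ) refl (e ∷ κ ∷ []))) h)

  depth : ℕ → ℚ
  depth zero    = 0ℚ
  depth (suc n) = depth n +ℚ κ

  0≤depth : ∀ n → 0ℚ ≤ℚ depth n
  0≤depth zero    = ℚ.≤-refl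
  0≤depth (suc n) = ℚ.+-mono-≤ (0≤depth n) (ℚ.<⇒≤ 0<κ)

  deep-arrange : ∀ j {S e x} (F : Frame S) → Frame.Deep F e x → Frame.Deep (arrange-frame j F) e x
  deep-arrange 0 F d           = d
  deep-arrange 1 {S} {e} {x} F d = deep-swap₂₃ {S} {e} {x} F d
  deep-arrange 2 {S} {e} {x} F d = deep-swap₁₃ {S} {e} {x} F d
  deep-arrange 3 {S} {e} {x} F d = deep-swap₂₃ {S} {e} {x} F d
  deep-arrange (suc (suc (suc (suc _)))) {S} {e} {x} F d = deep-swap₁₃ {S} {e} {x} F d

  deep-chain : ∀ {S x} (F : Frame S) → ∀ j n → Frame.Deep F (depth (j ℕ.+ n)) x →
               Frame.Deep (chain-frame F j) (depth n) x
  deep-chain F zero    n d = d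
  deep-chain {S} {x} F (suc j) n d = deep-step {arrange j (chain S j)} {depth n} {x} (arrange-frame j {chain S j} (chain-frame {S} F j)) (0≤depth n)
    (deep-arrange j {chain S j} {depth n +ℚ κ} {x} (chain-frame {S} F j)
      (deep-chain {S} {x} F j (suc n) (subst (λ m → Frame.Deep F (depth m) x) (sym (ℕ.+-suc j n)) d)))

  private
    -κ<0 : ∀ {p} → 0ℚ <ℚ p → 0ℚ +ℚ (-ℚ κ) *ℚ p <ℚ 0ℚ
    -κ<0 {p} 0<p = subst (_<ℚ 0ℚ) (ring 2 (λ κ p → :- (κ :* p) := con 0ℚ :+ (:- κ) :* p) refl (κ ∷ p ∷ []))
      (ℚ.neg-antimono-< (ℚ.positive⁻¹ (κ *ℚ p)
        {{ℚ.pos*pos⇒pos κ {{ℚ.positive 0<κ}} p {{ℚ.positive 0<p}}}}))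

    -- The coordinates of an edge midpoint after one end of the edge has moved towards the other;
    -- `κ ≤ ½` keeps the midpoint inside.
    p₁ q₁ : ℚ
    p₁ = (1ℚ +ℚ κ) *ℚ ½
    q₁ = ½ +ℚ (-ℚ κ) *ℚ ½

    0<p₁ : 0ℚ <ℚ p₁
    0<p₁ = ℚ.positive⁻¹ p₁ {{ℚ.pos*pos⇒pos (1ℚ +ℚ κ)
      {{ℚ.positive (ℚ.+-mono-< (ℚ.positive⁻¹ 1ℚ) 0<κ)}} ½}}

    0≤q₁ : 0ℚ ≤ℚ q₁
    0≤q₁ = rearrangeℚ (ℚ.≤-trans (*-monoʳ-≤ℚ {κ} {½} {½} 0≤½ κ≤½) (*-monoʳ-≤ℚ {½} {1ℚ} {½} 0≤½ ½≤1))
      (ring 1 (λ κ → (con ½ :+ (:- κ) :* con ½) :- con 0ℚ := con ½ :* con 1ℚ :- con ½ :* κ) refl (κ ∷ []))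

  value-fixed : ∀ {S F x q r} → Value {S} F x 0ℚ q r → Value (frame-move W {S} F) x 0ℚ q r
  value-fixed {S} {F} {x} {q} = value-move {S} {F} {x} W (sym (ℚ.*-zeroʳ (1ℚ +ℚ κ)))
    (ring 2 (λ q κ → q := q :+ (:- κ) :* con 0ℚ) refl (q ∷ κ ∷ []))

  -- The second coordinate becomes `- κ p`, which is negative however small `κ` is.
  value-lost : ∀ {S F x p r} → Value {S} F x p 0ℚ r → 0ℚ <ℚ p → ¬ In (move W S) x
  value-lost {S} {F} {x} {p} {r} V 0<p =
    value-out {move W S} {frame-move W {S} F} {x} (value-move {S} {F} {x} {p} {0ℚ} {r} W refl refl V) (-κ<0 0<p)

  module _ {S : Shape} (F : Frame S) where
    private
      a b c : Square
      a = proj₁ S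
      b = proj₁ (proj₂ S)
      c = proj₂ (proj₂ S)

    value-bary : ∀ {x p q r} → Bary S x (↑ p) (↑ q) (↑ r) → Value F x p q r
    value-bary β = let (e₀ , e₁ , e₂) = Frame.unique F β in value-of e₀ e₁ e₂

    vertex-a : Value F a 1ℚ 0ℚ 0ℚ
    vertex-a = value-bary (record
      { 0≼r = 0≼1 ; 0≼s = ≼-refl ; 0≼t = ≼-refl
      ; sum = ≋-trans (⊕-identityʳ _) (⊕-identityʳ _)
      ; at₁ = at (c₁ a) (c₁ b) (c₁ c) ; at₂ = at (c₂ a) (c₂ b) (c₂ c) })
      where
      at : ∀ a b c → a ≋ mixture (↑ 1ℚ) (↑ 0ℚ) (↑ 0ℚ) a b c
      at a b c =
        ringʳ 3 (λ a b c → a :≋ :↑ 1ℚ :⊗ a :⊕ :↑ 0ℚ :⊗ b :⊕ :↑ 0ℚ :⊗ c) refl (a ∷ b ∷ c ∷ [])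

    vertex-b : Value F b 0ℚ 1ℚ 0ℚ
    vertex-b = value-bary (record
      { 0≼r = ≼-refl ; 0≼s = 0≼1 ; 0≼t = ≼-refl
      ; sum = ≋-trans (⊕-identityʳ _) (⊕-identityˡ _)
      ; at₁ = at (c₁ a) (c₁ b) (c₁ c) ; at₂ = at (c₂ a) (c₂ b) (c₂ c) })
      where
      at : ∀ a b c → b ≋ mixture (↑ 0ℚ) (↑ 1ℚ) (↑ 0ℚ) a b c
      at a b c =
        ringʳ 3 (λ a b c → b :≋ :↑ 0ℚ :⊗ a :⊕ :↑ 1ℚ :⊗ b :⊕ :↑ 0ℚ :⊗ c) refl (a ∷ b ∷ c ∷ [])

    vertex-c : Value F c 0ℚ 0ℚ 1ℚ
    vertex-c = value-bary (record
      { 0≼r = ≼-refl ; 0≼s = ≼-refl ; 0≼t = 0≼1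
      ; sum = ≋-trans (⊕-cong (⊕-identityˡ _) ≋-refl) (⊕-identityˡ _)
      ; at₁ = at (c₁ a) (c₁ b) (c₁ c) ; at₂ = at (c₂ a) (c₂ b) (c₂ c) })
      where
      at : ∀ a b c → c ≋ mixture (↑ 0ℚ) (↑ 0ℚ) (↑ 1ℚ) a b c
      at a b c =
        ringʳ 3 (λ a b c → c :≋ :↑ 0ℚ :⊗ a :⊕ :↑ 0ℚ :⊗ b :⊕ :↑ 1ℚ :⊗ c) refl (a ∷ b ∷ c ∷ [])

    middle-ab : Value F (halfway a b) ½ ½ 0ℚ
    middle-ab = value-bary (record
      { 0≼r = ↑-mono 0≤½ ; 0≼s = ↑-mono 0≤½ ; 0≼t = ≼-refl
      ; sum = ≋-trans (⊕-identityʳ _) (≋-sym (↑-+ ½ ½))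
      ; at₁ = ≋-trans (c₁-halfway a b) (at (c₁ a) (c₁ b) (c₁ c))
      ; at₂ = ≋-trans (c₂-halfway a b) (at (c₂ a) (c₂ b) (c₂ c)) })
      where
      at : ∀ a b c → ↑ ½ ⊗ a ⊕ (↑ 1ℚ ⊖ ↑ ½) ⊗ b ≋ mixture (↑ ½) (↑ ½) (↑ 0ℚ) a b c
      at a b c = ringʳ 3 (λ a b c → :↑ ½ :⊗ a :⊕ (:↑ 1ℚ :⊖ :↑ ½) :⊗ b :≋
        :↑ ½ :⊗ a :⊕ :↑ ½ :⊗ b :⊕ :↑ 0ℚ :⊗ c) refl (a ∷ b ∷ c ∷ [])

    middle-bc : Value F (halfway b c) 0ℚ ½ ½
    middle-bc = value-bary (record
      { 0≼r = ≼-refl ; 0≼s = ↑-mono 0≤½ ; 0≼t = ↑-mono 0≤½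
      ; sum = ≋-trans (⊕-cong (⊕-identityˡ _) ≋-refl) (≋-sym (↑-+ ½ ½))
      ; at₁ = ≋-trans (c₁-halfway b c) (at (c₁ a) (c₁ b) (c₁ c))
      ; at₂ = ≋-trans (c₂-halfway b c) (at (c₂ a) (c₂ b) (c₂ c)) })
      where
      at : ∀ a b c → ↑ ½ ⊗ b ⊕ (↑ 1ℚ ⊖ ↑ ½) ⊗ c ≋ mixture (↑ 0ℚ) (↑ ½) (↑ ½) a b c
      at a b c = ringʳ 3 (λ a b c → :↑ ½ :⊗ b :⊕ (:↑ 1ℚ :⊖ :↑ ½) :⊗ c :≋
        :↑ 0ℚ :⊗ a :⊕ :↑ ½ :⊗ b :⊕ :↑ ½ :⊗ c) refl (a ∷ b ∷ c ∷ [])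

    private
      S′ : ℕ → Shape
      S′ = chain S
      F′ : ∀ j → Frame (S′ j)
      F′ = chain-frame {S} F
      G : ∀ j → Frame (arrange j (S′ j))
      G j = arrange-frame j {S′ j} (F′ j)

      fix : ∀ {x q r} j → Value (G j) x 0ℚ q r → Value (F′ (suc j)) x 0ℚ q r
      fix {x} {q} {r} j = value-fixed {arrange j (S′ j)} {G j} {x} {q} {r}
      squeeze : ∀ {x} j → Value (G j) x ½ ½ 0ℚ → Value (F′ (suc j)) x p₁ q₁ 0ℚ
      squeeze {x} j = value-move {arrange j (S′ j)} {G j} {x} {½} {½} {0ℚ} {p₁} {q₁} W refl refl
      twist₂₃ : ∀ {x p q r j} → Value (F′ j) x p q r → Value (frame-swap₂₃ {S′ j} (F′ j)) x p r q
      twist₂₃ {x} {p} {q} {r} {j} = value-swap₂₃ {S′ j} {F′ j} {x} {p} {q} {r}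
      twist₁₃ : ∀ {x p q r j} → Value (F′ j) x p q r → Value (frame-swap₁₃ {S′ j} (F′ j)) x r q p
      twist₁₃ {x} {p} {q} {r} {j} = value-swap₁₃ {S′ j} {F′ j} {x} {p} {q} {r}

      b₁ : Value (F′ 1) b 0ℚ 1ℚ 0ℚ
      b₁ = fix {b} 0 vertex-b
      b₂ : Value (F′ 2) b 0ℚ 0ℚ 1ℚ
      b₂ = fix {b} 1 (twist₂₃ {b} {j = 1} b₁)
      c₁′ : Value (F′ 1) c 0ℚ 0ℚ 1ℚ
      c₁′ = fix {c} 0 vertex-c
      c₂′ : Value (F′ 2) c 0ℚ 1ℚ 0ℚ
      c₂′ = fix {c} 1 (twist₂₃ {c} {j = 1} c₁′)
      c₃ : Value (F′ 3) c 0ℚ 1ℚ 0ℚ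
      c₃ = fix {c} 2 (twist₁₃ {c} {j = 2} c₂′)
      c₄ : Value (F′ 4) c 0ℚ 0ℚ 1ℚ
      c₄ = fix {c} 3 (twist₂₃ {c} {j = 3} c₃)
      m n : Square
      m = halfway a b
      n = halfway b c
      m₁ : Value (F′ 1) m p₁ q₁ 0ℚ
      m₁ = squeeze {m} 0 middle-ab
      n₁ : Value (F′ 1) n 0ℚ ½ ½
      n₁ = fix {n} 0 middle-bc
      n₂ : Value (F′ 2) n 0ℚ ½ ½
      n₂ = fix {n} 1 (twist₂₃ {n} {j = 1} n₁)
      n₃ : Value (F′ 3) n p₁ q₁ 0ℚ
      n₃ = squeeze {n} 2 (twist₁₃ {n} {j = 2} n₂)

      here : ∀ {x p q r} j → Value (F′ j) x p q r → 0ℚ ≤ℚ p → 0ℚ ≤ℚ q → 0ℚ ≤ℚ r → In (S′ j) x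
      here {x} j = value-in {S′ j} {F′ j} {x}
      gone : ∀ {x p r} j → Value (G j) x p 0ℚ r → 0ℚ <ℚ p → ¬ In (S′ (suc j)) x
      gone {x} {p} {r} j = value-lost {arrange j (S′ j)} {G j} {x} {p} {r}

    corner-in : ∀ j → j ℕ.≤ 4 → In (chain S j) (corner S j)
    corner-in 0 _ = here {a} 0 vertex-a 0≤1 ℚ.≤-refl ℚ.≤-refl
    corner-in 1 _ = here {m} 1 m₁ (ℚ.<⇒≤ 0<p₁) 0≤q₁ ℚ.≤-refl
    corner-in 2 _ = here {b} 2 b₂ ℚ.≤-refl ℚ.≤-refl 0≤1
    corner-in 3 _ = here {n} 3 n₃ (ℚ.<⇒≤ 0<p₁) 0≤q₁ ℚ.≤-refl
    corner-in 4 _ = here {c} 4 c₄ ℚ.≤-refl ℚ.≤-refl 0≤1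
    corner-in (suc (suc (suc (suc (suc _))))) (ℕ.s≤s (ℕ.s≤s (ℕ.s≤s (ℕ.s≤s ()))))

    corner-out : ∀ j → j ℕ.≤ 4 → ¬ In (chain S (suc j)) (corner S j)
    corner-out 0 _ = gone {a} 0 vertex-a (ℚ.positive⁻¹ 1ℚ)
    corner-out 1 _ = gone {m} 1 (twist₂₃ {m} {j = 1} m₁) 0<p₁
    corner-out 2 _ = gone {b} 2 (twist₁₃ {b} {j = 2} b₂) (ℚ.positive⁻¹ 1ℚ)
    corner-out 3 _ = gone {n} 3 (twist₂₃ {n} {j = 3} n₃) 0<p₁
    corner-out 4 _ = gone {c} 4 (twist₁₃ {c} {j = 4} c₄) (ℚ.positive⁻¹ 1ℚ)
    corner-out (suc (suc (suc (suc (suc _))))) (ℕ.s≤s (ℕ.s≤s (ℕ.s≤s (ℕ.s≤s ()))))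

-- A triangle centred at (½ , ½) and scaled by w = 1 / y.
record Scale : Set where
  field
    y w : ℝ
    1≼y : ↑ 1ℚ ≼ y
    y≼2 : y ≼ ↑ (1ℚ +ℚ 1ℚ)
    0≼w : ↑ 0ℚ ≼ w
    y⊗w : y ⊗ w ≋ ↑ 1ℚ

  w≼1 : w ≼ ↑ 1ℚ
  w≼1 =
    ≼-trans (≼-trans (≋⇒≽ (⊗-identityʳ w)) (≼-trans (⊗-monoʳ 0≼w 1≼y) (≋⇒≼ (⊗-comm w y)))) (≋⇒≼ y⊗w)

  0≼y : ↑ 0ℚ ≼ y
  0≼y = ≼-trans 0≼1 1≼y

  unit-residue : y ⊗ w ⊖ ↑ 1ℚ ≋ ↑ 0ℚ
  unit-residue = ⊖-zero y⊗w

c4 c8 : ℚ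
c4 = ι 4
c8 = ι 8

-- y times this, plus 1, is three times a barycentric coordinate.
affine : (α β γ : ℚ) → Square → ℝ
affine α β γ x = ↑ α ⊗ c₁ x ⊕ ↑ β ⊗ c₂ x ⊕ ↑ γ

coordinate : (α β γ : ℚ) → ℝ → Square → ℝ
coordinate α β γ y x = ↑ ⅓ ⊗ (↑ 1ℚ ⊕ y ⊗ affine α β γ x)

-- A common bound for the coefficients -4, 4, 8 and -2 of the coordinate functions of `triangle`.
record Small (α : ℚ) : Set where
  field
    low  : -ℚ c8 ≤ℚ α
    high : α ≤ℚ c8

  lowʳ : ⊝ ↑ c8 ≼ ↑ α
  lowʳ = ≼-trans (≋⇒≽ (↑-⊝ c8)) (↑-mono low)

  highʳ : ↑ α ≼ ↑ c8
  highʳ = ↑-mono high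

small-4 : Small (-ℚ c4)
small-4 = record { low = toWitness {a? = _ ℚ.≤? _} tt ; high = toWitness {a? = _ ℚ.≤? _} tt }

small4 : Small c4
small4 = record { low = toWitness {a? = _ ℚ.≤? _} tt ; high = toWitness {a? = _ ℚ.≤? _} tt }

small8 : Small c8
small8 = record { low = toWitness {a? = _ ℚ.≤? _} tt ; high = toWitness {a? = _ ℚ.≤? _} tt }

small-2 : Small (-ℚ (ι 2))
small-2 = record { low = toWitness {a? = _ ℚ.≤? _} tt ; high = toWitness {a? = _ ℚ.≤? _} tt }

lipschitz-affine : ∀ {α β γ} → Small α → Small β → Lipschitz (affine α β γ)
lipschitz-affine {α} {β} {γ} A B = lipschitz-⊕
  (lipschitz-⊕ (lipschitz-scale c8 (↑ α) (0≤ι 8) (Small.lowʳ A) (Small.highʳ A) lipschitz-c₁)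
               (lipschitz-scale c8 (↑ β) (0≤ι 8) (Small.lowʳ B) (Small.highʳ B) lipschitz-c₂))
  (lipschitz-const γ)

affine-bounded : ∀ {α β γ} → Small α → Small β → Small γ → ∀ x →
                 Close (affine α β γ x) (↑ 0ℚ) ((c8 *ℚ 1ℚ +ℚ c8 *ℚ 1ℚ) +ℚ c8)
affine-bounded {α} {β} {γ} A B C x = close-trans-≋
    (close-⊕ (close-⊕ (term A (proj₁ x)) (term B (proj₂ x))) const-close)
  where
  unit-close : ∀ z → Close (value z) (↑ 0ℚ) 1ℚ
  unit-close z = mkClose (≼-trans (value≼1 z) (≋⇒≽ (⊕-identityˡ (↑ 1ℚ))))
    (≼-trans (0≼value z) (≼-trans (≋⇒≽ (⊕-identityʳ (value z))) (⊕-mono ≼-refl 0≼1)))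
  term : ∀ {α} → Small α → ∀ z → Close (↑ α ⊗ value z) (↑ α ⊗ ↑ 0ℚ) (c8 *ℚ 1ℚ)
  term A z = close-scale c8 (Small.lowʳ A) (Small.highʳ A) (unit-close z)
  const-close : Close (↑ γ) (↑ 0ℚ) c8
  const-close = mkClose (≼-trans (Small.highʳ C) (≋⇒≽ (⊕-identityˡ (↑ c8))))
    (linear (Small.lowʳ C) (ringʳ 2 (λ g e → (g :⊕ e) :⊖ :↑ 0ℚ :≋ g :⊖ (:⊝ e)) refl (↑ γ ∷ ↑ c8 ∷ [])))
  close-trans-≋ : ∀ {e z} → Close z (↑ α ⊗ ↑ 0ℚ ⊕ ↑ β ⊗ ↑ 0ℚ ⊕ ↑ 0ℚ) e → Close z (↑ 0ℚ) e
  close-trans-≋ (mkClose p q) = mkClose (≼-trans p (⊕-mono (≋⇒≼ zero-sum) ≼-refl)) (≼-trans (≋⇒≽ zero-sum) q)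
    where
    zero-sum : ↑ α ⊗ ↑ 0ℚ ⊕ ↑ β ⊗ ↑ 0ℚ ⊕ ↑ 0ℚ ≋ ↑ 0ℚ
    zero-sum = ringʳ 2 (λ a b → a :⊗ :↑ 0ℚ :⊕ b :⊗ :↑ 0ℚ :⊕ :↑ 0ℚ :≋ :↑ 0ℚ) refl (↑ α ∷ ↑ β ∷ [])

module _ (σ : Scale) where
  open Scale σ

  private
    -2≼y : ⊝ ↑ (1ℚ +ℚ 1ℚ) ≼ y
    -2≼y = ≼-trans (≼-from (ringʳ 1 (λ t → :↑ 0ℚ :⊖ (:⊝ t) :≋ t) refl (↑ (1ℚ +ℚ 1ℚ) ∷ []))
      (↑-mono (ℚ.+-mono-≤ 0≤1 0≤1))) 0≼y

  lipschitz-coordinate : ∀ {α β γ} → Small α → Small β → Lipschitz (coordinate α β γ y)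
  lipschitz-coordinate A B = lipschitz-scale 1ℚ (↑ ⅓) 0≤1
    (≼-trans (≼-trans (≋⇒≽ (↑-⊝ 1ℚ)) (↑-mono { -ℚ 1ℚ} {0ℚ} (toWitness {a? = -ℚ 1ℚ ℚ.≤? 0ℚ} tt))) (↑-mono 0≤⅓))
    (↑-mono (toWitness {a? = ⅓ ℚ.≤? 1ℚ} tt))
    (lipschitz-⊕ (lipschitz-const 1ℚ)
      (lipschitz-scale (1ℚ +ℚ 1ℚ) y (ℚ.+-mono-≤ 0≤1 0≤1) -2≼y y≼2 (lipschitz-affine A B)))

  private
    minus plus : UnitInterval
    minus = unit-interval (↑ ½ ⊖ ↑ ¼ ⊗ w)
      (≼-from (ringʳ 1 (λ w → (:↑ ½ :⊖ :↑ ¼ :⊗ w) :⊖ :↑ 0ℚ :≋ :↑ ¼ :⊕ :↑ ¼ :⊗ (:↑ 1ℚ :⊖ w)) refl (w ∷ []))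
        (⊕-nonneg (↑-mono 0≤¼) (⊗-nonneg (↑-mono 0≤¼) (⊖-nonneg w≼1))))
      (≼-from (ringʳ 1 (λ w → :↑ 1ℚ :⊖ (:↑ ½ :⊖ :↑ ¼ :⊗ w) :≋ :↑ ½ :⊕ :↑ ¼ :⊗ w) refl (w ∷ []))
        (⊕-nonneg (↑-mono 0≤½) (⊗-nonneg (↑-mono 0≤¼) 0≼w)))
    plus = unit-interval (↑ ½ ⊕ ↑ ¼ ⊗ w)
      (⊕-nonneg (↑-mono 0≤½) (⊗-nonneg (↑-mono 0≤¼) 0≼w))
      (≼-from (ringʳ 1 (λ w → :↑ 1ℚ :⊖ (:↑ ½ :⊕ :↑ ¼ :⊗ w) :≋ :↑ ¼ :⊕ :↑ ¼ :⊗ (:↑ 1ℚ :⊖ w)) refl (w ∷ []))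
        (⊕-nonneg (↑-mono 0≤¼) (⊗-nonneg (↑-mono 0≤¼) (⊖-nonneg w≼1))))

    middle : UnitInterval
    middle = unit-interval (↑ ½) (↑-mono 0≤½) (↑-mono ½≤1)

  opaque
    -- For every scale the centroid is `(½ , ½)`, where the three affine functions vanish and all
    -- coordinates are one third; `w ≤ 1` keeps the vertices between `¼` and `¾`. The vertices are
    -- polynomial in `w` and the coordinates in `y`, so no division occurs and the identities hold
    -- modulo `y w = 1`.
    triangle : Shape
    triangle = (minus , minus) , (plus , middle) , (middle , plus)

    triangle-frame : Frame triangle
    triangle-frame = record
      { f₀ = coordinate (-ℚ c4) (-ℚ c4) c4 y
      ; f₁ = coordinate c8 (-ℚ c4) (-ℚ (ι 2)) y
      ; f₂ = coordinate (-ℚ c4) c8 (-ℚ (ι 2)) y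
      ; sum = λ x → ringʳ 3 (λ y p q →
          F (-ℚ c4) (-ℚ c4) c4 y p q :⊕ F c8 (-ℚ c4) (-ℚ (ι 2)) y p q :⊕ F (-ℚ c4) c8 (-ℚ (ι 2)) y p q :≋ :↑ 1ℚ)
          refl (y ∷ c₁ x ∷ c₂ x ∷ [])
      ; at₁ = λ x → ≋-sym (≋-trans (ringʳ 4 (λ y w p q →
          F (-ℚ c4) (-ℚ c4) c4 y p q :⊗ (:↑ ½ :⊖ :↑ ¼ :⊗ w) :⊕
          F c8 (-ℚ c4) (-ℚ (ι 2)) y p q :⊗ (:↑ ½ :⊕ :↑ ¼ :⊗ w) :⊕
          F (-ℚ c4) c8 (-ℚ (ι 2)) y p q :⊗ :↑ ½ :≋
          p :⊕ (y :⊗ w :⊖ :↑ 1ℚ) :⊗ (p :⊖ :↑ ½)) refl (y ∷ w ∷ c₁ x ∷ c₂ x ∷ []))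
          (vanishes (c₁ x ⊖ ↑ ½) unit-residue))
      ; at₂ = λ x → ≋-sym (≋-trans (ringʳ 4 (λ y w p q →
          F (-ℚ c4) (-ℚ c4) c4 y p q :⊗ (:↑ ½ :⊖ :↑ ¼ :⊗ w) :⊕
          F c8 (-ℚ c4) (-ℚ (ι 2)) y p q :⊗ :↑ ½ :⊕
          F (-ℚ c4) c8 (-ℚ (ι 2)) y p q :⊗ (:↑ ½ :⊕ :↑ ¼ :⊗ w) :≋
          q :⊕ (y :⊗ w :⊖ :↑ 1ℚ) :⊗ (q :⊖ :↑ ½)) refl (y ∷ w ∷ c₁ x ∷ c₂ x ∷ []))
          (vanishes (c₂ x ⊖ ↑ ½) unit-residue))
      ; unique = λ {x} {r} {s} {t} β →
          at-r {x} r s t (Bary.sum β) (Bary.at₁ β) (Bary.at₂ β) ,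
          at-s {x} r s t (Bary.sum β) (Bary.at₁ β) (Bary.at₂ β) ,
          at-t {x} r s t (Bary.sum β) (Bary.at₁ β) (Bary.at₂ β)
      ; lip₀ = lipschitz-coordinate small-4 small-4
      ; lip₁ = lipschitz-coordinate small8 small-4
      ; lip₂ = lipschitz-coordinate small-4 small8 }
      where
      F : ∀ {n} → ℚ → ℚ → ℚ → R.Polynomial n → R.Polynomial n → R.Polynomial n → R.Polynomial n
      F α β γ y p q = :↑ ⅓ :⊗ (:↑ 1ℚ :⊕ y :⊗ (:↑ α :⊗ p :⊕ :↑ β :⊗ q :⊕ :↑ γ))
      P Q : ∀ {n} → R.Polynomial n → R.Polynomial n → R.Polynomial n → R.Polynomial n → R.Polynomial n
      P w r s t = r :⊗ (:↑ ½ :⊖ :↑ ¼ :⊗ w) :⊕ s :⊗ (:↑ ½ :⊕ :↑ ¼ :⊗ w) :⊕ t :⊗ :↑ ½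
      Q w r s t = r :⊗ (:↑ ½ :⊖ :↑ ¼ :⊗ w) :⊕ s :⊗ :↑ ½ :⊕ t :⊗ (:↑ ½ :⊕ :↑ ¼ :⊗ w)
      place : ∀ {α β γ p p′ q q′} → p ≋ p′ → q ≋ q′ →
        ↑ ⅓ ⊗ (↑ 1ℚ ⊕ y ⊗ (↑ α ⊗ p ⊕ ↑ β ⊗ q ⊕ ↑ γ)) ≋ ↑ ⅓ ⊗ (↑ 1ℚ ⊕ y ⊗ (↑ α ⊗ p′ ⊕ ↑ β ⊗ q′ ⊕ ↑ γ))
      place e f = ⊗-cong ≋-refl (⊕-cong ≋-refl (⊗-cong ≋-refl
        (⊕-cong (⊕-cong (⊗-cong ≋-refl e) (⊗-cong ≋-refl f)) ≋-refl)))
      m₁ m₂ : ℝ → ℝ → ℝ → ℝ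
      m₁ r s t = mixture r s t (↑ ½ ⊖ ↑ ¼ ⊗ w) (↑ ½ ⊕ ↑ ¼ ⊗ w) (↑ ½)
      m₂ r s t = mixture r s t (↑ ½ ⊖ ↑ ¼ ⊗ w) (↑ ½) (↑ ½ ⊕ ↑ ¼ ⊗ w)
      -- The identities for uniqueness hold modulo `r + s + t = 1` and `y w = 1`; `b` and `c` are
      -- the cofactors of these two relations.
      finish : ∀ a b c r s t → r ⊕ s ⊕ t ≋ ↑ 1ℚ →
        a ⊕ (r ⊕ s ⊕ t ⊖ ↑ 1ℚ) ⊗ b ⊕ (y ⊗ w ⊖ ↑ 1ℚ) ⊗ c ≋ a
      finish a b c r s t e = ≋-trans (vanishes c unit-residue) (vanishes b (⊖-zero e))
      at-r : ∀ {x} r s t → r ⊕ s ⊕ t ≋ ↑ 1ℚ → c₁ x ≋ m₁ r s t → c₂ x ≋ m₂ r s t →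
             coordinate (-ℚ c4) (-ℚ c4) c4 y x ≋ r
      at-r r s t e p q = ≋-trans (place p q) (≋-trans
        (ringʳ 5 (λ y w r s t → F (-ℚ c4) (-ℚ c4) c4 y (P w r s t) (Q w r s t) :≋
          r :⊕ (r :⊕ s :⊕ t :⊖ :↑ 1ℚ) :⊗ (:↑ ⅓ :⊗ (:⊝ :↑ 1ℚ :⊖ :↑ c4 :⊗ y)) :⊕
          (y :⊗ w :⊖ :↑ 1ℚ) :⊗ (:↑ ⅓ :⊗ (:↑ (ι 3) :⊗ r :⊖ (r :⊕ s :⊕ t)))) refl (y ∷ w ∷ r ∷ s ∷ t ∷ []))
        (finish r (↑ ⅓ ⊗ (⊝ ↑ 1ℚ ⊖ ↑ c4 ⊗ y)) (↑ ⅓ ⊗ (↑ (ι 3) ⊗ r ⊖ (r ⊕ s ⊕ t))) r s t e))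
      at-s : ∀ {x} r s t → r ⊕ s ⊕ t ≋ ↑ 1ℚ → c₁ x ≋ m₁ r s t → c₂ x ≋ m₂ r s t →
             coordinate c8 (-ℚ c4) (-ℚ (ι 2)) y x ≋ s
      at-s r s t e p q = ≋-trans (place p q) (≋-trans
        (ringʳ 5 (λ y w r s t → F c8 (-ℚ c4) (-ℚ (ι 2)) y (P w r s t) (Q w r s t) :≋
          s :⊕ (r :⊕ s :⊕ t :⊖ :↑ 1ℚ) :⊗ (:↑ ⅓ :⊗ (:⊝ :↑ 1ℚ :⊕ :↑ (ι 2) :⊗ y)) :⊕
          (y :⊗ w :⊖ :↑ 1ℚ) :⊗ (:↑ ⅓ :⊗ (:↑ (ι 3) :⊗ s :⊖ (r :⊕ s :⊕ t)))) refl (y ∷ w ∷ r ∷ s ∷ t ∷ []))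
        (finish s (↑ ⅓ ⊗ (⊝ ↑ 1ℚ ⊕ ↑ (ι 2) ⊗ y)) (↑ ⅓ ⊗ (↑ (ι 3) ⊗ s ⊖ (r ⊕ s ⊕ t))) r s t e))
      at-t : ∀ {x} r s t → r ⊕ s ⊕ t ≋ ↑ 1ℚ → c₁ x ≋ m₁ r s t → c₂ x ≋ m₂ r s t →
             coordinate (-ℚ c4) c8 (-ℚ (ι 2)) y x ≋ t
      at-t r s t e p q = ≋-trans (place p q) (≋-trans
        (ringʳ 5 (λ y w r s t → F (-ℚ c4) c8 (-ℚ (ι 2)) y (P w r s t) (Q w r s t) :≋
          t :⊕ (r :⊕ s :⊕ t :⊖ :↑ 1ℚ) :⊗ (:↑ ⅓ :⊗ (:⊝ :↑ 1ℚ :⊕ :↑ (ι 2) :⊗ y)) :⊕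
          (y :⊗ w :⊖ :↑ 1ℚ) :⊗ (:↑ ⅓ :⊗ (:↑ (ι 3) :⊗ t :⊖ (r :⊕ s :⊕ t)))) refl (y ∷ w ∷ r ∷ s ∷ t ∷ []))
        (finish t (↑ ⅓ ⊗ (⊝ ↑ 1ℚ ⊕ ↑ (ι 2) ⊗ y)) (↑ ⅓ ⊗ (↑ (ι 3) ⊗ t ⊖ (r ⊕ s ⊕ t))) r s t e))

-- The coordinates for the scale y are those for y′ scaled by y w′ towards the centre.
rescale-deep : ∀ (σ σ′ : Scale) {δ α β γ x} → let open Scale in
  y σ ⊗ w σ′ ≼ ↑ 1ℚ ⊖ ↑ (ι 3) ⊗ ↑ δ →
  ↑ 0ℚ ≼ coordinate α β γ (y σ′) x → ↑ δ ≼ coordinate α β γ (y σ) x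
rescale-deep σ σ′ {δ} {α} {β} {γ} {x} ρ≼ 0≼f = ≼-from
  (≋-trans (≋-sym (vanishes (↑ ⅓ ⊗ (y σ ⊗ affine α β γ x)) (unit-residue σ′)))
    (ringʳ 5 (λ y y′ w′ D d →
      (:↑ ⅓ :⊗ (:↑ 1ℚ :⊕ y :⊗ D) :⊖ d) :⊕ (y′ :⊗ w′ :⊖ :↑ 1ℚ) :⊗ (:↑ ⅓ :⊗ (y :⊗ D)) :≋
      (y :⊗ w′) :⊗ (:↑ ⅓ :⊗ (:↑ 1ℚ :⊕ y′ :⊗ D)) :⊕ :↑ ⅓ :⊗ ((:↑ 1ℚ :⊖ :↑ (ι 3) :⊗ d) :⊖ y :⊗ w′)) refl
      (y σ ∷ y σ′ ∷ w σ′ ∷ affine α β γ x ∷ ↑ δ ∷ [])))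
  (⊕-nonneg (⊗-nonneg (⊗-nonneg (0≼y σ) (0≼w σ′)) 0≼f) (⊗-nonneg (↑-mono 0≤⅓) (⊖-nonneg ρ≼)))
  where open Scale

vary-scale : ∀ {α β γ y y′ e} → Small α → Small β → Small γ → ∀ x → Close y y′ e →
  Close (coordinate α β γ y x) (coordinate α β γ y′ x) (1ℚ *ℚ (0ℚ +ℚ ((c8 *ℚ 1ℚ +ℚ c8 *ℚ 1ℚ) +ℚ c8) *ℚ e))
vary-scale {α} {β} {γ} {y} {y′} {e} A B C x h = close-scale 1ℚ
    (≼-trans (≼-trans (≋⇒≽ (↑-⊝ 1ℚ)) (↑-mono { -ℚ 1ℚ} {0ℚ} (toWitness {a? = -ℚ 1ℚ ℚ.≤? 0ℚ} tt))) (↑-mono 0≤⅓))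
    (↑-mono (toWitness {a? = ⅓ ℚ.≤? 1ℚ} tt))
    (close-⊕ (close-refl ℚ.≤-refl) (flip (close-scale bound low high h)))
  where
  D = affine α β γ x
  bound = (c8 *ℚ 1ℚ +ℚ c8 *ℚ 1ℚ) +ℚ c8
  near0 = affine-bounded {α} {β} {γ} A B C x
  low : ⊝ ↑ bound ≼ D
  low =
    linear (close-≽ near0) (ringʳ 2 (λ D e → D :⊖ (:⊝ e) :≋ (D :⊕ e) :⊖ :↑ 0ℚ) refl (D ∷ ↑ bound ∷ []))
  high : D ≼ ↑ bound
  high = ≼-trans (close-≼ near0) (≋⇒≼ (⊕-identityˡ (↑ bound)))
  flip : ∀ {e} → Close (D ⊗ y) (D ⊗ y′) e → Close (y ⊗ D) (y′ ⊗ D) e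
  flip (mkClose p q) = mkClose
    (≼-resp (⊗-comm D y) (⊕-cong (⊗-comm D y′) ≋-refl) p)
    (≼-resp (⊗-comm D y′) (⊕-cong (⊗-comm D y) ≋-refl) q)

opaque
  unfolding triangle-frame

  -- With `ρ = y w′`, a coordinate for `σ` is `ρ` times the one for `σ′` plus `(1 - ρ) / 3`. The
  -- first summand is nonnegative on the smaller triangle and the second is at least `δ`.
  triangle-deep : ∀ (σ σ′ : Scale) {δ x} → let open Scale in
    y σ ⊗ w σ′ ≼ ↑ 1ℚ ⊖ ↑ (ι 3) ⊗ ↑ δ → In (triangle σ′) x → Frame.Deep (triangle-frame σ) δ x
  triangle-deep σ σ′ {δ} {x} h x∈ =
    let (p , q , r) = Frame.in⇒deep (triangle-frame σ′) x∈
    in rescale-deep σ σ′ {δ} { -ℚ c4} { -ℚ c4} {c4} {x} h p ,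
       rescale-deep σ σ′ {δ} {c8} { -ℚ c4} { -ℚ (ι 2)} {x} h q ,
       rescale-deep σ σ′ {δ} { -ℚ c4} {c8} { -ℚ (ι 2)} {x} h r

  -- The stages show triangles of different scales, so closedness of a single triangle is not
  -- enough: the change of the coordinates with the scale is estimated together with their change
  -- with the point.
  triangle-limit : ∀ (σ : Scale) (σs : ℕ → Scale) x → let open Scale in
    (∀ n → Close (y σ) (y (σs n)) (spread n)) →
    (∀ n → ∃[ z ] (In (triangle (σs n)) z × Near (spread n) x z)) → In (triangle σ) x
  triangle-limit σ σs x near-y near = Frame.deep⇒in (triangle-frame σ)
    ( limit { -ℚ c4} { -ℚ c4} {c4} small-4 small-4 small4 (λ n z z∈ → proj₁ (Frame.in⇒deep (triangle-frame (σs n)) z∈))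
    , limit {c8} { -ℚ c4} { -ℚ (ι 2)} small8 small-4 small-2 (λ n z z∈ → proj₁ (proj₂ (Frame.in⇒deep (triangle-frame (σs n)) z∈)))
    , limit { -ℚ c4} {c8} { -ℚ (ι 2)} small-4 small8 small-2 (λ n z z∈ → proj₂ (proj₂ (Frame.in⇒deep (triangle-frame (σs n)) z∈))) )
    where
    open Scale
    limit : ∀ {α β γ} → Small α → Small β → Small γ →
      (∀ n z → In (triangle (σs n)) z → ↑ 0ℚ ≼ coordinate α β γ (y (σs n)) z) →
      ↑ 0ℚ ≼ coordinate α β γ (y σ) x
    limit {α} {β} {γ} A B C nonneg = ≼-archimedean↑ ((bound +ℚ L) +ℚ (bound +ℚ L)) λ n →
      let (z , z∈ , c) = near n
      in ≼-trans (nonneg n z z∈) (≼-trans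
           (close-≽ (close-trans
             (Lipschitz.near lip {x} {z} (0≤spread n) c) (vary-scale {α} {β} {γ} A B C z (near-y n))))
           (⊕-mono ≼-refl (≋⇒≼ (↑-cong (collect L (2⁻ n))))))
      where
      bound : ℚ
      bound = (c8 *ℚ 1ℚ +ℚ c8 *ℚ 1ℚ) +ℚ c8
      lip : Lipschitz (coordinate α β γ (y σ))
      lip = lipschitz-coordinate σ {α} {β} {γ} A B
      L : ℚ
      L = Lipschitz.L lip
      collect : ∀ L h →
          L *ℚ (h +ℚ h) +ℚ 1ℚ *ℚ (0ℚ +ℚ bound *ℚ (h +ℚ h)) ≡ ((bound +ℚ L) +ℚ (bound +ℚ L)) *ℚ h
      collect L h = ring 2 (λ L h → L :* (h :+ h) :+ con 1ℚ :* (con 0ℚ :+ con bound :* (h :+ h)) :=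
        ((con bound :+ L) :+ (con bound :+ L)) :* h) refl (L ∷ h ∷ [])

-- The generic triangle

2ℚ : ℚ
2ℚ = 1ℚ +ℚ 1ℚ

record Ratio : Set where
  field
    q   : ℚ
    1≤q : 1ℚ ≤ℚ q
    q≤2 : q ≤ℚ 2ℚ

  0<q : 0ℚ <ℚ q
  0<q = ℚ.<-≤-trans (ℚ.positive⁻¹ 1ℚ) 1≤q

  inv : ℚ
  inv = proj₁ (inverseℚ q 0<q)

  0<inv : 0ℚ <ℚ inv
  0<inv = proj₁ (proj₂ (inverseℚ q 0<q))

  q*inv : q *ℚ inv ≡ 1ℚ
  q*inv = proj₂ (proj₂ (inverseℚ q 0<q))

  scale : Scale
  scale = record
    { y = ↑ q ; w = ↑ inv ; 1≼y = ↑-mono 1≤q ; y≼2 = ↑-mono q≤2 ; 0≼w = ↑-mono (ℚ.<⇒≤ 0<inv)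
    ; y⊗w = ≋-trans (≋-sym (↑-* q inv)) (↑-cong q*inv) }

△ : Ratio → Shape
△ s = triangle (Ratio.scale s)

-- The exponent `suc k` gives `κ ≤ ½` already for `k = 0`.
weights : ℕ → Weight
weights k = weight (2⁻ (suc k)) (0<2⁻ (suc k)) (half≤ (2⁻ k) (2⁻-antitone {0} {k} ℕ.z≤n))
  where
  half≤ : ∀ h → h ≤ℚ 1ℚ → ½ *ℚ h ≤ℚ ½
  half≤ h h≤1 = subst (½ *ℚ h ≤ℚ_) (ℚ.*-identityʳ ½) (*-monoʳ-≤ℚ {h} {1ℚ} {½} 0≤½ h≤1)

-- A Baire category construction: each of the open conditions `Hit k` is either met after finitely
-- many shapes or made unattainable for plays near the limit whose triangle is not much smaller.
module Generic (em : ExcludedMiddle 0ℓ) (Hit : ℕ → Play → Set)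
  (hit-open : ∀ k π → Hit k π → ∃[ N ] (∀ π′ → Agree N (Play.S π) (Play.S π′) → Hit k π′)) where
  open Plays em

  -- The limit triangle will lie strictly between those of s and t; from
  -- stage m on the play shows the triangle of s.
  record State (k : ℕ) : Set where
    field
      play  : Play
      m     : ℕ
      k≤m   : k ℕ.≤ m
      s     : Ratio
      t     : ℚ
      s<t   : Ratio.q s <ℚ t
      t≤2   : t ≤ℚ 2ℚ
      gap   : t -ℚ Ratio.q s ≤ℚ 2⁻ k
      T≡△   : Play.T play ≡ △ s
      tail  : ∀ n → m ℕ.≤ n → Play.S play n ⊆ △ s

  constant-play : ∀ T → Closed T → Play
  constant-play T closed = record
    { S = const T ; T = T ; T⊆S = λ _ _ h → h ; converges = closed }

  △-closed : ∀ s → Closed (△ s)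
  △-closed s = frame-closed (triangle-frame (Ratio.scale s))

  one : Ratio
  one = record { q = 1ℚ ; 1≤q = ℚ.≤-refl ; q≤2 = toWitness {a? = 1ℚ ℚ.≤? 2ℚ} tt }

  start : State 0
  start = record
    { play = constant-play (△ one) (△-closed one) ; m = 0 ; k≤m = ℕ.z≤n ; s = one ; t = 2ℚ
    ; s<t = toWitness {a? = 1ℚ ℚ.<? 2ℚ} tt ; t≤2 = ℚ.≤-refl
    ; gap = toWitness {a? = (2ℚ -ℚ 1ℚ) ℚ.≤? 1ℚ} tt
    ; T≡△ = refl ; tail = λ _ _ _ h → h }

  record Arithmetic (s t h : ℚ) : Set where
    field
      u t₁ t₂ : ℚ
      s<u     : s <ℚ u
      u<t     : u <ℚ t
      s<t₁    : s <ℚ t₁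
      t₁<u    : t₁ <ℚ u
      u<t₂    : u <ℚ t₂
      t₂<t    : t₂ <ℚ t
      gap₁    : t₁ -ℚ s ≤ℚ ½ *ℚ h
      gap₂    : t₂ -ℚ u ≤ℚ ½ *ℚ h

  -- The two outcomes of a decision confine the limit to `[s , t₁]` or to `[u , t₂]`. In the first
  -- case `t₁ < u` leaves room between the limit triangle and the triangle of `u`.
  quarters : ∀ s t h → s <ℚ t → t -ℚ s ≤ℚ h → Arithmetic s t h
  quarters s t h s<t gap = record
    { u = s +ℚ ½ *ℚ g ; t₁ = s +ℚ ¼ *ℚ g ; t₂ = s +ℚ ¾ *ℚ g
    ; s<u  = subst₂ _<ℚ_ (ℚ.+-identityʳ s) refl (lt s 0<½g)
    ; u<t  = subst₂ _<ℚ_ (ℚ.+-identityʳ (s +ℚ ½ *ℚ g))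
        (ring 2 (λ s t → (s :+ con ½ :* (t :- s)) :+ con ½ :* (t :- s) := t) refl (s ∷ t ∷ []))
        (lt (s +ℚ ½ *ℚ g) 0<½g)
    ; s<t₁ = subst₂ _<ℚ_ (ℚ.+-identityʳ s) refl (lt s 0<¼g)
    ; t₁<u = step-up (s +ℚ ¼ *ℚ g) (ring 2 (λ s g → (s :+ con ¼ :* g) :+ con ¼ :* g := s :+ con ½ :* g) refl (s ∷ g ∷ []))
    ; u<t₂ = step-up (s +ℚ ½ *ℚ g) (ring 2 (λ s g → (s :+ con ½ :* g) :+ con ¼ :* g := s :+ con ¾ :* g) refl (s ∷ g ∷ []))
    ; t₂<t = step-up (s +ℚ ¾ *ℚ g) (ring 2 (λ s t → (s :+ con ¾ :* (t :- s)) :+ con ¼ :* (t :- s) := t) refl (s ∷ t ∷ []))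
    ; gap₁ = rearrangeℚ (ℚ.+-mono-≤ quarter-gap 0≤¼g)
        (ring 3 (λ s g h → con ½ :* h :- ((s :+ con ¼ :* g) :- s) :=
          (con ½ :* h :+ con ¼ :* g) :- (con ½ :* g :+ con 0ℚ)) refl (s ∷ g ∷ h ∷ []))
    ; gap₂ = rearrangeℚ (ℚ.+-mono-≤ quarter-gap 0≤¼g)
        (ring 3 (λ s g h → con ½ :* h :- ((s :+ con ¾ :* g) :- (s :+ con ½ :* g)) :=
          (con ½ :* h :+ con ¼ :* g) :- (con ½ :* g :+ con 0ℚ)) refl (s ∷ g ∷ h ∷ [])) }
    where
    g : ℚ
    g = t -ℚ s
    0<g : 0ℚ <ℚ g
    0<g = subst (_<ℚ g) (ℚ.+-inverseʳ s) (ℚ.+-monoˡ-< (-ℚ s) s<t)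
    0<½g : 0ℚ <ℚ ½ *ℚ g
    0<½g = 0<½* 0<g
    0<¼g : 0ℚ <ℚ ¼ *ℚ g
    0<¼g = ℚ.positive⁻¹ _ {{ℚ.pos*pos⇒pos ¼ g {{positive 0<g}}}}
    0≤¼g : 0ℚ ≤ℚ ¼ *ℚ g
    0≤¼g = ℚ.<⇒≤ 0<¼g
    lt : ∀ a {e} → 0ℚ <ℚ e → a +ℚ 0ℚ <ℚ a +ℚ e
    lt a = ℚ.+-monoʳ-< a
    step-up : ∀ a {b} → a +ℚ ¼ *ℚ g ≡ b → a <ℚ b
    step-up a e = subst₂ _<ℚ_ (ℚ.+-identityʳ a) e (lt a 0<¼g)
    quarter-gap : ½ *ℚ g ≤ℚ ½ *ℚ h
    quarter-gap = *-monoʳ-≤ℚ {g} {h} {½} 0≤½ gap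

  ratio : ∀ {s} u → Ratio.q s ≤ℚ u → u ≤ℚ 2ℚ → Ratio
  ratio {s} u s≤u u≤2 = record { q = u ; 1≤q = ℚ.≤-trans (Ratio.1≤q s) s≤u ; q≤2 = u≤2 }

  record Division (s : Ratio) (t : ℚ) (k : ℕ) : Set where
    field
      middle : Ratio
      t₁ t₂  : ℚ
      s<u    : Ratio.q s <ℚ Ratio.q middle
      s<t₁   : Ratio.q s <ℚ t₁
      t₁<u   : t₁ <ℚ Ratio.q middle
      u<t₂   : Ratio.q middle <ℚ t₂
      t₁<t   : t₁ <ℚ t
      t₂<t   : t₂ <ℚ t
      gap₁   : t₁ -ℚ Ratio.q s ≤ℚ 2⁻ (suc k)
      gap₂   : t₂ -ℚ Ratio.q middle ≤ℚ 2⁻ (suc k)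

  divide : ∀ s t k → Ratio.q s <ℚ t → t ≤ℚ 2ℚ → t -ℚ Ratio.q s ≤ℚ 2⁻ k → Division s t k
  divide s t k s<t t≤2 gap = build (quarters (Ratio.q s) t (2⁻ k) s<t gap)
    where
    build : Arithmetic (Ratio.q s) t (2⁻ k) → Division s t k
    build A = record
      { middle = ratio {s} (Arithmetic.u A) (ℚ.<⇒≤ (Arithmetic.s<u A)) (ℚ.≤-trans (ℚ.<⇒≤ (Arithmetic.u<t A)) t≤2)
      ; t₁ = Arithmetic.t₁ A ; t₂ = Arithmetic.t₂ A
      ; s<u = Arithmetic.s<u A ; s<t₁ = Arithmetic.s<t₁ A ; t₁<u = Arithmetic.t₁<u A ; u<t₂ = Arithmetic.u<t₂ A
      ; t₁<t = ℚ.<-trans (Arithmetic.t₁<u A) (Arithmetic.u<t A) ; t₂<t = Arithmetic.t₂<t A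
      ; gap₁ = Arithmetic.gap₁ A ; gap₂ = Arithmetic.gap₂ A }

  module Step {k} (σ : State k) where
    open State σ

    opaque
      division : Division s t k
      division = divide s t k s<t t≤2 gap

    open Division division public

    -- Keeping `suc m` shapes preserves shape `m`, which lies in `△ s`; these shapes make the limit
    -- play converge to the limit triangle. The inclusion allows `π` to be continued by `△ middle`.
    Reachable : Set
    Reachable = ∃[ π ] (Agree (suc m) (Play.S play) (Play.S π) × △ middle ⊆ Play.T π × Hit k π)

    record Next : Set where
      field
        next      : State (suc k)
        agrees    : Agree (suc m) (Play.S play) (Play.S (State.play next))
        m≤        : m ℕ.≤ State.m next
        s≤        : Ratio.q s ≤ℚ Ratio.q (State.s next)
        ≤t        : State.t next ≤ℚ t
        decided   : (∀ π → Agree (suc (State.m next)) (Play.S (State.play next)) (Play.S π) → Hit k π) ⊎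
                    (¬ Reachable × State.t next <ℚ Ratio.q middle)

    decide : Dec Reachable → Next
    decide (yes (π , a , h , hit)) = record
      { next = record
          -- Follow `π` until the hit is irrevocable, then show `△ middle`.
          { play = extend π m′ (△ middle) h (△-closed middle)
          ; m = m′ ; k≤m = ℕ.≤-trans (ℕ.s≤s k≤m) (ℕ.m≤m⊔n (suc m) N)
          ; s = middle ; t = t₂ ; s<t = u<t₂ ; t≤2 = ℚ.≤-trans (ℚ.<⇒≤ t₂<t) t≤2
          ; gap = gap₂ ; T≡△ = refl
          ; tail = λ n m′≤n x → switch-elim (λ U → In U x → In (△ middle) x) m′ (Play.S π) (const (△ middle)) n
              (λ n<m′ → contradiction n<m′ (ℕ.≤⇒≯ m′≤n)) (λ _ x∈ → x∈) }
      ; agrees = agree-trans a (agree-≤ (ℕ.m≤m⊔n (suc m) N) (extend-agree π m′ (△ middle) h (△-closed middle)))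
      ; m≤ = ℕ.≤-trans (ℕ.n≤1+n m) (ℕ.m≤m⊔n (suc m) N) ; s≤ = ℚ.<⇒≤ s<u ; ≤t = ℚ.<⇒≤ t₂<t
      ; decided = inj₁ λ π′ b → proj₂ (hit-open k π hit) π′
          (agree-trans (agree-≤ (ℕ.m≤n⊔m (suc m) N) (extend-agree π m′ (△ middle) h (△-closed middle)))
            (agree-≤ (ℕ.≤-trans (ℕ.m≤n⊔m (suc m) N) (ℕ.n≤1+n m′)) b)) }
      where
      N m′ : ℕ
      N  = proj₁ (hit-open k π hit)
      m′ = suc m ⊔ N
    -- The play stays, but `t` drops below `middle`, so that the limit triangle will contain
    -- `△ middle` with a margin.
    decide (no unreachable) = record
      { next = record
          { play = play ; m = suc m ; k≤m = ℕ.s≤s k≤m ; s = s ; t = t₁ ; s<t = s<t₁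
          ; t≤2 = ℚ.≤-trans (ℚ.<⇒≤ t₁<t) t≤2
          ; gap = gap₁ ; T≡△ = T≡△ ; tail = λ n m<n → tail n (ℕ.<⇒≤ m<n) }
      ; agrees = agree-refl ; m≤ = ℕ.n≤1+n m ; s≤ = ℚ.≤-refl ; ≤t = ℚ.<⇒≤ t₁<t
      ; decided = inj₂ (unreachable , t₁<u) }

  opaque
    advance : ∀ {k} (σ : State k) → Step.Next σ
    advance σ = Step.decide σ em

  state : ∀ k → State k
  state zero    = start
  state (suc k) = Step.Next.next (advance (state k))

  module st k = State (state k)
  module step k = Step.Next (advance (state k))

  s-at : ℕ → ℚ
  s-at k = Ratio.q (st.s k)

  mono : ∀ (P : ℕ → ℕ → Set) → (∀ k → P k k) → (∀ {j k} → j ℕ.≤ k → P j k → P j (suc k)) →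
         ∀ {j k} → j ℕ.≤ k → P j k
  mono P base up {j} {k} j≤k with ℕ.m≤n⇒m<n∨m≡n j≤k
  ... | inj₂ refl = base j
  mono P base up {j} {suc k} _ | inj₁ (ℕ.s≤s j≤k) = up j≤k (mono P base up j≤k)

  s-mono : ∀ {j k} → j ℕ.≤ k → s-at j ≤ℚ s-at k
  s-mono =
    mono (λ j k → s-at j ≤ℚ s-at k) (λ _ → ℚ.≤-refl) (λ {_} {k} _ h → ℚ.≤-trans h (step.s≤ k))

  t-anti : ∀ {j k} → j ℕ.≤ k → st.t k ≤ℚ st.t j
  t-anti =
    mono (λ j k → st.t k ≤ℚ st.t j) (λ _ → ℚ.≤-refl) (λ {_} {k} _ h → ℚ.≤-trans (step.≤t k) h)

  m-mono : ∀ {j k} → j ℕ.≤ k →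
      st.m j ℕ.≤ st.m k × Agree (suc (st.m j)) (Play.S (st.play j)) (Play.S (st.play k))
  m-mono = mono (λ j k → st.m j ℕ.≤ st.m k × Agree (suc (st.m j)) (Play.S (st.play j)) (Play.S (st.play k)))
    (λ _ → ℕ.≤-refl , agree-refl) (λ {_} {k} _ (h , a) → ℕ.≤-trans h (step.m≤ k) , agree-trans a (agree-≤ (ℕ.s≤s h) (step.agrees k)))

  s<t-at : ∀ j k → s-at j <ℚ st.t k
  s<t-at j k with ℕ.≤-total j k
  ... | inj₁ j≤k = ℚ.≤-<-trans (s-mono j≤k) (st.s<t k)
  ... | inj₂ k≤j = ℚ.<-≤-trans (st.s<t j) (t-anti k≤j)

  t≤s+ : ∀ k → st.t k ≤ℚ s-at k +ℚ 2⁻ k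
  t≤s+ k =
    rearrangeℚ (st.gap k) (ring 3 (λ s t h → (s :+ h) :- t := h :- (t :- s)) refl (s-at k ∷ st.t k ∷ 2⁻ k ∷ []))

  s-close : ∀ m n → s-at m ≤ℚ s-at n +ℚ (2⁻ m +ℚ 2⁻ n)
  s-close m n = ℚ.≤-trans (ℚ.<⇒≤ (s<t-at m n)) (ℚ.≤-trans (t≤s+ n)
    (rearrangeℚ (0≤2⁻ m) (ring 3 (λ s g h → (s :+ (g :+ h)) :- (s :+ h) := g :- con 0ℚ) refl
      (s-at n ∷ 2⁻ m ∷ 2⁻ n ∷ []))))

  opaque
    y* : ℝ
    y* = real s-at (dyadic-sequence s-at s-close)

    y*-close : ∀ k → Close y* (↑ (s-at k)) (spread k)
    y*-close k = mkClose
      (limit-≼ y* (s-at k) (spread k) λ n → above (s-at k) (2⁻ k) (2⁻ n) (s-close n k) (0≤2⁻ k))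
      (limit-≽ y* (s-at k) (spread k) λ n → above (s-at n) (2⁻ k) (2⁻ n) (swap {s-at k} {s-at n} {2⁻ k} {2⁻ n} (s-close k n)) (0≤2⁻ k))
      where
      swap : ∀ {a b g h} → a ≤ℚ b +ℚ (g +ℚ h) → a ≤ℚ b +ℚ (h +ℚ g)
      swap {a} {b} {g} {h} = subst (λ e → a ≤ℚ b +ℚ e) (ℚ.+-comm g h)
      above : ∀ {a} b g h → a ≤ℚ b +ℚ (h +ℚ g) → 0ℚ ≤ℚ g → a ≤ℚ (b +ℚ (g +ℚ g)) +ℚ h
      above {a} b g h p q = rearrangeℚ (ℚ.+-mono-≤ p q)
        (ring 4 (λ a b g h → ((b :+ (g :+ g)) :+ h) :- a := ((b :+ (h :+ g)) :+ g) :- (a :+ con 0ℚ)) refl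
          (a ∷ b ∷ g ∷ h ∷ []))

    y*≼t : ∀ k → y* ≼ ↑ (st.t k)
    y*≼t k = ≼-trans (limit-≼ y* (st.t k) 0ℚ λ n → pad (ℚ.<⇒≤ (s<t-at n k)) (0≤2⁻ n)) (≋⇒≼ (⊕-identityʳ _))
      where
      pad : ∀ {a b h} → a ≤ℚ b → 0ℚ ≤ℚ h → a ≤ℚ (b +ℚ 0ℚ) +ℚ h
      pad {a} {b} {h} p q = rearrangeℚ (ℚ.+-mono-≤ p q)
        (ring 3 (λ a b h → ((b :+ con 0ℚ) :+ h) :- a := (b :+ h) :- (a :+ con 0ℚ)) refl (a ∷ b ∷ h ∷ []))

    s≼y* : ∀ k → ↑ (s-at k) ≼ y*
    s≼y* k = ≼-trans (limit-≽ y* (s-at k) 0ℚ λ n → pad {s-at k} {s-at n} {2⁻ n} (ℚ.≤-trans (ℚ.<⇒≤ (s<t-at k n)) (t≤s+ n)))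
                     (≋⇒≼ (⊕-identityʳ y*))
      where
      pad : ∀ {a b h} → a ≤ℚ b +ℚ h → a ≤ℚ (b +ℚ 0ℚ) +ℚ h
      pad {a} {b} {h} p = subst (λ e → a ≤ℚ e +ℚ h) (sym (ℚ.+-identityʳ b)) p

  opaque
    limit-scale : Scale
    limit-scale =
      let (w , 0≼w , y⊗w) = inverse y* (ℚ.positive⁻¹ 1ℚ) (s≼y* 0)
      in record { y = y* ; w = w ; 1≼y = s≼y* 0 ; y≼2 = y*≼t 0 ; 0≼w = 0≼w ; y⊗w = y⊗w }

    limit-y : Scale.y limit-scale ≡ y*
    limit-y = refl

  Δ* : Shape
  Δ* = triangle limit-scale

  Δ*-frame : Frame Δ*
  Δ*-frame = triangle-frame limit-scale

  Δ*-⊆ : ∀ k → Δ* ⊆ △ (st.s k)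
  Δ*-⊆ k x x∈ = Frame.deep⇒in (triangle-frame (Ratio.scale (st.s k))) {x}
    (triangle-deep (Ratio.scale (st.s k)) limit-scale {0ℚ} {x}
      (≼-trans (≋⇒≼ (⊗-comm (↑ (s-at k)) w)) (≼-trans (⊗-monoʳ 0≼w (subst (↑ (s-at k) ≼_) (sym limit-y) (s≼y* k)))
        (≼-trans (≋⇒≼ (≋-trans (⊗-comm w y) y⊗w))
          (≋⇒≼ (ringʳ 0 (:↑ 1ℚ :≋ :↑ 1ℚ :⊖ :↑ (ι 3) :⊗ :↑ 0ℚ) refl []))))) x∈)
    where open Scale limit-scale

  shapes : ℕ → Shape
  shapes n = Play.S (st.play n) n

  shapes-agree : ∀ k → Agree (suc (st.m k)) (Play.S (st.play k)) shapes
  shapes-agree k j j< with ℕ.≤-total j k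
  ... | inj₁ j≤k = sym (proj₂ (m-mono j≤k) j (ℕ.s≤s (st.k≤m j)))
  ... | inj₂ k≤j = proj₂ (m-mono k≤j) j j<

  opaque
    generic : Play
    generic = record
      { S = shapes ; T = Δ*
      ; T⊆S = λ n x x∈ → Play.T⊆S (st.play n) n x
          (subst (λ U → In U x) (sym (st.T≡△ n)) (Δ*-⊆ n x x∈))
      ; converges = λ x near → triangle-limit limit-scale (λ n → Ratio.scale (st.s n)) x
          (λ n → subst (λ y → Close y (↑ (s-at n)) (spread n)) (sym limit-y) (y*-close n))
          λ n → let (z , z∈ , c) = near (st.m n)
                in z , st.tail n (st.m n) ℕ.≤-refl z (subst (λ U → In U z) (sym (shapes-agree n (st.m n) ℕ.≤-refl)) z∈) ,
                   near-mono {x = x} {z} (spread-antitone (st.k≤m n)) c }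

    generic-T : Play.T generic ≡ Δ*
    generic-T = refl

    generic-agree : ∀ k → Agree (suc (st.m k)) (Play.S (st.play k)) (Play.S generic)
    generic-agree = shapes-agree

  family : ℕ → ℕ → Shape
  family k = Chain.chain (weights k) Δ*

  -- Points of `△ u` have depth `δ = (1 - t / u) / 3` in the limit triangle. Each of the at most
  -- five moves costs depth `κ`, and `κ` is at most an eighth of `δ` from `K` on.
  family-contains : ∀ (u : Ratio) {t} → y* ≼ ↑ t → t <ℚ Ratio.q u →
    ∃[ K ] (∀ k j → K ℕ.≤ k → j ℕ.≤ 5 → △ u ⊆ family k j)
  family-contains u {t} y*≼t t<u = K , λ k j K≤k j≤5 x x∈ →
    let module C = Chain (weights k)
        h≤ = ℚ.≤-trans (2⁻-antitone {K} {suc k} (ℕ.≤-trans K≤k (ℕ.n≤1+n k))) small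
    in C.chain-antitone Δ* j≤5 x (Frame.deep⇒in (C.chain-frame Δ*-frame 5) {x}
         (C.deep-chain {x = x} Δ*-frame 5 0 (weaken {x = x} (depth≤ (2⁻ (suc k)) (0≤2⁻ (suc k)) h≤) (deep x∈))))
    where
    open Ratio u
    δ : ℚ
    δ = ⅓ *ℚ (1ℚ -ℚ t *ℚ inv)
    0<1-t : 0ℚ <ℚ 1ℚ -ℚ t *ℚ inv
    0<1-t = subst₂ _<ℚ_ (ℚ.+-inverseʳ (t *ℚ inv)) (cong (_-ℚ t *ℚ inv) q*inv)
      (ℚ.+-monoˡ-< (-ℚ (t *ℚ inv)) (ℚ.*-monoˡ-<-pos inv {{positive 0<inv}} t<u))
    0<δ : 0ℚ <ℚ δ
    0<δ = ℚ.positive⁻¹ δ {{ℚ.pos*pos⇒pos ⅓ (1ℚ -ℚ t *ℚ inv) {{positive 0<1-t}}}}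
    ⅛ : ℚ
    ⅛ = ½ *ℚ ¼
    0<⅛δ : 0ℚ <ℚ ⅛ *ℚ δ
    0<⅛δ = ℚ.positive⁻¹ (⅛ *ℚ δ) {{ℚ.pos*pos⇒pos ⅛ δ {{positive 0<δ}}}}
    K : ℕ
    K = proj₁ (2⁻-small (⅛ *ℚ δ) 0<⅛δ)
    small : 2⁻ K ≤ℚ ⅛ *ℚ δ
    small = proj₂ (2⁻-small (⅛ *ℚ δ) 0<⅛δ)
    depth≤ : ∀ h → 0ℚ ≤ℚ h → h ≤ℚ ⅛ *ℚ δ → 0ℚ +ℚ h +ℚ h +ℚ h +ℚ h +ℚ h ≤ℚ δ
    depth≤ h 0≤h h≤ = bound h δ 0≤h h≤
      where
      bound : ∀ h d → 0ℚ ≤ℚ h → h ≤ℚ ⅛ *ℚ d → 0ℚ +ℚ h +ℚ h +ℚ h +ℚ h +ℚ h ≤ℚ d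
      bound h d p q = rearrangeℚ (ℚ.+-mono-≤ (*-monoʳ-≤ℚ {h} {⅛ *ℚ d} {ι 8} (0≤ι 8) q) (*-nonnegℚ {ι 3} {h} (0≤ι 3) p))
        (ring 2 (λ h d → d :- (con 0ℚ :+ h :+ h :+ h :+ h :+ h) :=
          (con (ι 8) :* (con ⅛ :* d) :+ con (ι 3) :* h) :- (con (ι 8) :* h :+ con 0ℚ)) refl (h ∷ d ∷ []))
    weaken : ∀ {e e′ x} → e ≤ℚ e′ → Frame.Deep Δ*-frame e′ x → Frame.Deep Δ*-frame e x
    weaken h (p , q , r) = ≼-trans (↑-mono h) p , ≼-trans (↑-mono h) q , ≼-trans (↑-mono h) r
    deep : ∀ {x} → In (△ u) x → Frame.Deep Δ*-frame δ x
    deep {x} = triangle-deep limit-scale scale {δ} {x} (subst (λ y → y ⊗ ↑ inv ≼ ↑ 1ℚ ⊖ ↑ (ι 3) ⊗ ↑ δ) (sym limit-y)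
      (≼-trans (≋⇒≼ (⊗-comm y* (↑ inv))) (≼-trans (⊗-monoʳ (↑-mono (ℚ.<⇒≤ 0<inv)) y*≼t)
        (≼-trans (≋⇒≽ (↑-* inv t)) (≼-trans (≋⇒≼ (↑-cong (value-δ t inv)))
          (≋⇒≼ (≋-trans (↑-+ 1ℚ (-ℚ (ι 3 *ℚ δ))) (⊕-cong ≋-refl
            (≋-trans (↑-⊝ (ι 3 *ℚ δ)) (⊝-cong (↑-* (ι 3) δ)))))))))))
      where
      value-δ : ∀ t v → v *ℚ t ≡ 1ℚ +ℚ -ℚ (ι 3 *ℚ (⅓ *ℚ (1ℚ -ℚ t *ℚ v)))
      value-δ t v =
        ring 2 (λ t v → v :* t := con 1ℚ :+ (:- (con (ι 3) :* (con ⅓ :* (con 1ℚ :- t :* v))))) refl (t ∷ v ∷ [])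

  -- In the unreachable case the late members of the chains contain `△ middle`, so a play as in the
  -- second alternative that is hit would have been reachable at stage `k`.
  forced : ∀ k → Hit k generic ⊎ (∃[ N ] ∃[ K ] (∀ k′ j π → K ℕ.≤ k′ → j ℕ.≤ 5 →
             Agree N (Play.S generic) (Play.S π) → family k′ j ⊆ Play.T π → ¬ Hit k π))
  forced k = go (step.decided k)
    where
    open Step (state k) using (middle; Reachable)
    go : (∀ π → Agree (suc (st.m (suc k))) (Play.S (st.play (suc k))) (Play.S π) → Hit k π) ⊎
         (¬ Reachable × st.t (suc k) <ℚ Ratio.q middle) → _
    go (inj₁ hits) = inj₁ (hits generic (generic-agree (suc k)))
    go (inj₂ (unreachable , t<u)) =
      let (K , h) = family-contains middle (y*≼t (suc k)) t<u
      in inj₂ (suc (st.m k) , K , λ k′ j π K≤ j≤5 a ⊆T hit → unreachable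
           (π , agree-trans (generic-agree k) a , (λ x x∈ → ⊆T x (h k′ j K≤ j≤5 x x∈)) , hit))

-- Order with a direction, density of the rationals, degenerate triangles

infix 4 _⊑[_]_
_⊑[_]_ : ℝ → Bool → ℝ → Set
x ⊑[ false ] y = x ≼ y
x ⊑[ true  ] y = y ≼ x

⊑-trans : ∀ d {x y z} → x ⊑[ d ] y → y ⊑[ d ] z → x ⊑[ d ] z
⊑-trans false p q = ≼-trans p q
⊑-trans true  p q = ≼-trans q p

rational-approximation : ∀ x ε → 0ℚ <ℚ ε → ∃[ r ] Close x (↑ r) ε
rational-approximation x ε 0<ε =
  let (N , h) = cauchy x ε 0<ε
      r = seq x N
  in r , mkClose
    (≼-trans {x} {fromℚ (r +ℚ ε)} (≤⇒≼ λ η 0<η → N , λ n N≤n →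
        pad {seq x n} {r +ℚ ε} (∣-∣-bound {seq x n} {r} (h n N N≤n ℕ.≤-refl)) (ℚ.<⇒≤ 0<η))
      (≋⇒≼ (≋-trans (fromℚ≋↑ (r +ℚ ε)) (↑-+ r ε))))
    (≼-trans (≋⇒≽ (fromℚ≋↑ r)) (≼-trans {fromℚ r} {x + fromℚ ε} (≤⇒≼ λ η 0<η → N , λ n N≤n →
        pad {r} {seq x n +ℚ ε} (∣-∣-bound {r} {seq x n} (h N n ℕ.≤-refl N≤n)) (ℚ.<⇒≤ 0<η))
      (≼-trans (+-mono-≼ {x} {x} {fromℚ ε} {↑ ε} ≼-refl (≋⇒≼ (fromℚ≋↑ ε))) (≋⇒≼ (+≋⊕ x (↑ ε))))))
  where
  pad : ∀ {a b η} → a ≤ℚ b → 0ℚ ≤ℚ η → a ≤ℚ b +ℚ η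
  pad {a} {b} {η} p q = rearrangeℚ (ℚ.+-mono-≤ p q)
    (ring 3 (λ a b η → (b :+ η) :- a := (b :+ η) :- (a :+ con 0ℚ)) refl (a ∷ b ∷ η ∷ []))

gap⇒¬≼ : ∀ {x y ε} → 0ℚ <ℚ ε → y ⊕ ↑ ε ≼ x → ¬ x ≼ y
gap⇒¬≼ {x} {y} {ε} 0<ε h x≼y = ≤⇒≯ℚ (↑-reflect {ε} {0ℚ} (linear (≼-trans h x≼y)
  (ringʳ 2 (λ y e → :↑ 0ℚ :⊖ e :≋ y :⊖ (y :⊕ e)) refl (y ∷ ↑ ε ∷ [])))) 0<ε

module Density (em : ExcludedMiddle 0ℓ) where
  open Classical em
  open Betweenness em

  ¬≼⇒≽ : ∀ {x y} → ¬ x ≼ y → y ≼ x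
  ¬≼⇒≽ {x} {y} = Order.⋠⇒≽ em

  rational-between : ∀ {x y} → ¬ y ≼ x → ∃[ q ] (¬ ↑ q ≼ x × ¬ y ≼ ↑ q)
  rational-between {x} {y} y⋠x =
    let (ε , 0<ε , h) = ¬≼⇒gap y⋠x
        0<¼ε = ℚ.positive⁻¹ (¼ *ℚ ε) {{ℚ.pos*pos⇒pos ¼ ε {{positive 0<ε}}}}
        (r , c) = rational-approximation x (¼ *ℚ ε) 0<¼ε
        ¼ε≋ = ↑-* ¼ ε
        ½ε≋ = ≋-trans (↑-+ r (½ *ℚ ε)) (⊕-cong ≋-refl (↑-* ½ ε))
    -- As `r` is within `¼ ε` of `x`, this number lies between `x + ¼ ε` and `x + ¾ ε`, while `y` is
    -- at least `x + ε`.
    in r +ℚ ½ *ℚ ε ,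
       gap⇒¬≼ 0<¼ε (≼-resp (⊕-cong ≋-refl ≋-refl) (≋-sym ½ε≋)
         (linear (≼-trans (close-≼ c) (⊕-mono ≼-refl (≋⇒≼ ¼ε≋)))
           (≋-trans (⊕-cong ≋-refl (⊝-cong (⊕-cong ≋-refl ¼ε≋)))
             (ringʳ 3 (λ x r e → (r :⊕ :↑ ½ :⊗ e) :⊖ (x :⊕ :↑ ¼ :⊗ e) :≋ (r :⊕ :↑ ¼ :⊗ e) :⊖ x) refl
               (x ∷ ↑ r ∷ ↑ ε ∷ []))))) ,
       gap⇒¬≼ 0<¼ε (≼-trans (≋⇒≼ (⊕-cong ½ε≋ ¼ε≋)) (≼-trans
         (linear (≼-trans (close-≽ c) (⊕-mono ≼-refl (≋⇒≼ ¼ε≋)))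
           (ringʳ 3 (λ x r e → (x :⊕ e) :⊖ (r :⊕ :↑ ½ :⊗ e :⊕ :↑ ¼ :⊗ e) :≋ (x :⊕ :↑ ¼ :⊗ e) :⊖ r) refl
             (x ∷ ↑ r ∷ ↑ ε ∷ []))) h))

  ¬⊑⇒⊒ : ∀ d {x y} → ¬ x ⊑[ d ] y → y ⊑[ d ] x
  ¬⊑⇒⊒ false = ¬≼⇒≽
  ¬⊑⇒⊒ true  = ¬≼⇒≽

  between-⊑ : ∀ d {x y} → ¬ y ⊑[ d ] x → ∃[ q ] (¬ ↑ q ⊑[ d ] x × ¬ y ⊑[ d ] ↑ q)
  between-⊑ false h = rational-between h
  between-⊑ true  h = let (q , p , r) = rational-between h in q , r , p

tight-close : ∀ {ζ ξ x y} j → Agree (suc j) ζ ξ → Tight ζ x → Tight ξ y →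
              Close x y (¾ *ℚ 2⁻ j +ℚ ¾ *ℚ 2⁻ j)
tight-close {ζ} {ξ} {x} {y} j a =
  approx-close {λ n → ¾ *ℚ 2⁻ n} {λ n → ¾ *ℚ 2⁻ n} {ζ} {ξ} {x} {y} j (a j ℕ.≤-refl)

double-¾ : ∀ h → ¾ *ℚ h +ℚ ¾ *ℚ h ≡ (¾ +ℚ ¾) *ℚ h
double-¾ h = ring 1 (λ h → con ¾ :* h :+ con ¾ :* h := con (¾ +ℚ ¾) :* h) refl (h ∷ [])

limit-below : ∀ {w c} → (∀ j → ∃[ x ] (Close w x (¾ *ℚ 2⁻ j +ℚ ¾ *ℚ 2⁻ j) × x ≼ c)) → w ≼ c
limit-below h = ≼-archimedean↑ (¾ +ℚ ¾) λ j → let (x , c , x≼) = h j in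
  ≼-trans (close-≼ c) (⊕-mono x≼ (≋⇒≼ (↑-cong (double-¾ (2⁻ j)))))

limit-above : ∀ {w c} → (∀ j → ∃[ x ] (Close w x (¾ *ℚ 2⁻ j +ℚ ¾ *ℚ 2⁻ j) × c ≼ x)) → c ≼ w
limit-above h = ≼-archimedean↑ (¾ +ℚ ¾) λ j → let (x , c , ≼x) = h j in
  ≼-trans ≼x (≼-trans (close-≽ c) (⊕-mono ≼-refl (≋⇒≼ (↑-cong (double-¾ (2⁻ j))))))

limit-⊑ : ∀ d {w c} → (∀ j → ∃[ x ] (Close w x (¾ *ℚ 2⁻ j +ℚ ¾ *ℚ 2⁻ j) × x ⊑[ d ] c)) → w ⊑[ d ] c
limit-⊑ false = limit-below
limit-⊑ true  = limit-above

limit-⊒ : ∀ d {w c} → (∀ j → ∃[ x ] (Close w x (¾ *ℚ 2⁻ j +ℚ ¾ *ℚ 2⁻ j) × c ⊑[ d ] x)) → c ⊑[ d ] w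
limit-⊒ false = limit-above
limit-⊒ true  = limit-below

-- The degenerate triangle that leaves `K` no choice: once a play has shrunk to it, every point of
-- the rectangle is mapped to `x`.
singleton : Square → Shape
singleton x = x , x , x

singleton-in : ∀ {x y} → In (singleton x) y → c₁ y ≋ c₁ x × c₂ y ≋ c₂ x
singleton-in {x} {y} y∈ =
  let (r , s , t , β) = in⇒bary {singleton x} {y} y∈
      at : ∀ {c a} → c ≋ mixture r s t a a a → c ≋ a
      at {c} {a} e = ≋-trans e (≋-trans
        (ringʳ 4 (λ r s t a → r :⊗ a :⊕ s :⊗ a :⊕ t :⊗ a :≋ (r :⊕ s :⊕ t) :⊗ a) refl (r ∷ s ∷ t ∷ a ∷ []))
        (≋-trans (⊗-cong (Bary.sum β) ≋-refl) (⊗-identityˡ a)))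
  in at {c₁ y} {c₁ x} (Bary.at₁ β) , at {c₂ y} {c₂ x} (Bary.at₂ β)

close⇒≋ : ∀ {x y} → (∀ n → Close x y (spread n)) → x ≋ y
close⇒≋ {x} {y} h = le h & le (close-sym ∘ h)
  where
  le : ∀ {x y} → (∀ n → Close x y (spread n)) → x ≼ y
  le h = ≼-archimedean↑ (1ℚ +ℚ 1ℚ) λ n → ≼-trans (close-≼ (h n)) (⊕-mono ≼-refl
    (≋⇒≼ (↑-cong (ring 1 (λ h → h :+ h := (con 1ℚ :+ con 1ℚ) :* h) refl (2⁻ n ∷ [])))))

close-≋ : ∀ {x y z e} → y ≋ z → Close x y e → Close x z e
close-≋ (p & q) (mkClose r s) = mkClose (≼-trans r (⊕-mono p ≼-refl)) (≼-trans q s)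

singleton-closed : ∀ x → Closed (singleton x)
singleton-closed x y near = in-resp {singleton x} {x} {y}
  (≋-sym (close⇒≋ λ n → let (z , z∈ , (c , _)) = near n in close-≋ (proj₁ (singleton-in {x} {z} z∈)) c))
  (≋-sym (close⇒≋ λ n → let (z , z∈ , (_ , c)) = near n in close-≋ (proj₂ (singleton-in {x} {z} z∈)) c))
  (first-vertex {singleton x})

singleton-⊆ : ∀ {x S} → In S x → singleton x ⊆ S
singleton-⊆ {x} {S} x∈ y y∈ =
  let (e , f) = singleton-in {x} {y} y∈ in in-resp {S} {x} {y} (≋-sym e) (≋-sym f) x∈

fraction : ℕ → ℕ → ℚ
fraction a b = + a ℚ./ suc b

nonneg-fraction : ∀ q → 0ℚ ≤ℚ q → ∃[ a ] ∃[ b ] fraction a b ≡ q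
nonneg-fraction q@(ℚ.mkℚ (+ a) b _)     _ = a , b , ℚ.↥p/↧p≡p q
nonneg-fraction (ℚ.mkℚ (-[1+ a ]) b _) (ℚ.*≤* ())

unique-length : ∀ {n} (xs : List (Fin n)) → Unique xs → length xs ℕ.≤ n
unique-length {n} xs unique with length xs ℕ.≤? n
... | yes h = h
... | no ¬h = let (i , j , i<j , e) = Fin.pigeonhole (ℕ.≰⇒> ¬h) (lookup xs)
              in contradiction e (distinct unique i j i<j)
  where
  at : ∀ {P : Fin n → Set} {xs} → All P xs → ∀ i → P (lookup xs i)
  at (p ∷ _)  zero    = p
  at (_ ∷ ps) (suc i) = at ps i
  distinct : ∀ {xs : List (Fin n)} → Unique xs → ∀ i j → i Fin.< j → lookup xs i ≢ lookup xs j
  distinct (p ∷ _)  zero    (suc j) _   = at p j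
  distinct (_ ∷ ps) (suc i) (suc j) i<j = distinct ps i j (ℕ.s≤s⁻¹ i<j)

-- Losing the sides of the rectangle

-- Sides 0 and 1 are the lower and upper end of the first interval, 2 and 3 those of the second. The
-- direction `false` belongs to lower ends, so that both kinds can be treated at once.
Side : Set
Side = Fin 4

axis : Side → Axis
axis zero                = zero
axis (suc zero)          = zero
axis (suc (suc _))       = suc zero

dir : Side → Bool
dir zero                   = false
dir (suc zero)             = true
dir (suc (suc zero))       = false
dir (suc (suc (suc zero))) = true

common-bound : ∀ {m} {P : Fin m → ℕ → Set} → (∀ {s M N} → M ℕ.≤ N → P s M → P s N) →
               (∀ s → ∃[ N ] P s N) → ∃[ N ] (∀ s → P s N)
common-bound {zero}  mono f = 0 , λ ()
common-bound {suc m} {P} mono f =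
  let (N , p) = f zero
      (M , q) = common-bound {m} {λ s → P (suc s)} mono (λ s → f (suc s))
  in N ⊔ M , λ { zero → mono (ℕ.m≤m⊔n N M) p ; (suc s) → mono (ℕ.m≤n⊔m N M) (q s) }

opaque
  unit-name : ∀ q → Dec (0ℚ ≤ℚ q) → Dec (q ≤ℚ 1ℚ) → Baire
  unit-name q (yes 0≤q) (yes q≤1) =
    proj₁ (interval-name (unit-interval (↑ q) (↑-mono 0≤q) (↑-mono q≤1)))
  unit-name q _         _         = const 0

  unit-name-approx : ∀ q (d : Dec (0ℚ ≤ℚ q)) (d′ : Dec (q ≤ℚ 1ℚ)) → 0ℚ ≤ℚ q → q ≤ℚ 1ℚ →
                     Approx 2⁻_ (unit-name q d d′) (↑ q)
  unit-name-approx q (yes 0≤q) (yes q≤1) _ _ =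
    proj₂ (interval-name (unit-interval (↑ q) (↑-mono 0≤q) (↑-mono q≤1)))
  unit-name-approx q (no ¬0≤q) _         p _ = contradiction p ¬0≤q
  unit-name-approx q (yes _)   (no ¬q≤1) _ p = contradiction p ¬q≤1

-- One fixed name per rational makes exclusion a property of the play alone. Outside the unit
-- interval the value is filler.
rational-name : ℚ → Baire
rational-name q = unit-name q (0ℚ ℚ.≤? q) (q ℚ.≤? 1ℚ)

rational-name-approx : ∀ q → 0ℚ ≤ℚ q → q ≤ℚ 1ℚ → Approx 2⁻_ (rational-name q) (↑ q)
rational-name-approx q = unit-name-approx q (0ℚ ℚ.≤? q) (q ℚ.≤? 1ℚ)

module Separation (em : ExcludedMiddle 0ℓ) (H K : PartialFunction) (H-comp : Computable H) (K-comp : Computable K)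
                  (red : ∀ G → G ⊢ XC 1 ×ᵐ XC 1 → wrap H G K ⊢ XC₂∣𝔗) where
  open Classical em
  open Plays em
  open Betweenness em
  open Density em
  open Game em H K H-comp K-comp red

  test-of : List ℕ → Axis × ℚ
  test-of (zero  ∷ a ∷ b ∷ _) = zero , fraction a b
  test-of (suc _ ∷ a ∷ b ∷ _) = suc zero , fraction a b
  test-of _                   = zero , 0ℚ

  test : ℕ → Axis × ℚ
  test k = test-of (decode k)

  test-surjective : ∀ i q → 0ℚ ≤ℚ q → ∃[ k ] test k ≡ (i , q)
  test-surjective i q 0≤q =
    let (a , b , e) = nonneg-fraction q 0≤q
    in code i a b , trans (cong test-of (decode-encode (tag i ∷ a ∷ b ∷ []))) (trans (tagged i a b) (cong (i ,_) e))
    where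
    tag : Axis → ℕ
    tag zero    = 0
    tag (suc _) = 1
    code : Axis → ℕ → ℕ → ℕ
    code i a b = encode (tag i ∷ a ∷ b ∷ [])
    tagged : ∀ i a b → test-of (tag i ∷ a ∷ b ∷ []) ≡ (i , fraction a b)
    tagged zero       a b = refl
    tagged (suc zero) a b = refl

  Excludes : Axis × ℚ → Play → Set
  Excludes (i , q) π = Rejects (bounds π i) (rational-name q)

  excludes-open : ∀ t π → Excludes t π →
      ∃[ N ] (∀ π′ → Agree N (Play.S π) (Play.S π′) → Excludes t π′)
  excludes-open (i , q) π rej =
    let (N , f) = rejects-persists {i} {π} rej in N , λ π′ a → f π′ (rational-name q) a agree-refl

  open Generic em (λ k → Excludes (test k)) (λ k → excludes-open (test k)) public

  -- Apply `forced` to the test of this point: a hit at the generic play would contradict `x∈`, so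
  -- the other alternative protects the point.
  survives : ∀ i q (0≤q : 0ℚ ≤ℚ q) (q≤1 : q ≤ℚ 1ℚ) → let x = unit-interval (↑ q) (↑-mono 0≤q) (↑-mono q≤1) in
    x ∈[ i , generic ] → ∃[ N ] (∀ k j π → N ℕ.≤ k → j ℕ.≤ 5 →
      Agree N (Play.S generic) (Play.S π) → family k j ⊆ Play.T π → x ∈[ i , π ])
  survives i q 0≤q q≤1 x∈ = go (test-surjective i q 0≤q)
    where
    x : UnitInterval
    x = unit-interval (↑ q) (↑-mono 0≤q) (↑-mono q≤1)
    approx : Approx 2⁻_ (rational-name q) (value x)
    approx = rational-name-approx q 0≤q q≤1
    Conclusion : Set
    Conclusion = ∃[ N ] (∀ k j π → N ℕ.≤ k → j ℕ.≤ 5 →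
      Agree N (Play.S generic) (Play.S π) → family k j ⊆ Play.T π → x ∈[ i , π ])
    go : ∃[ k ] test k ≡ (i , q) → Conclusion
    go (k , e) = conclude (forced k)
      where
      conclude : Excludes (test k) generic ⊎ (∃[ N ] ∃[ K ] (∀ k′ j π → K ℕ.≤ k′ → j ℕ.≤ 5 →
             Agree N (Play.S generic) (Play.S π) → family k′ j ⊆ Play.T π → ¬ Excludes (test k) π)) → Conclusion
      conclude (inj₁ hit) = contradiction (subst (λ t → Excludes t generic) e hit)
        (∈-¬rejects {i} {generic} {rational-name q} {x} approx x∈)
      conclude (inj₂ (N , K , h)) = N ⊔ K , λ k′ j π N≤k′ j≤5 a ⊆T →
        ¬rejects-∈ {i} {π} {rational-name q} {x} approx λ rej →
          h k′ j π (ℕ.≤-trans (ℕ.m≤n⊔m N K) N≤k′) j≤5 (agree-≤ (ℕ.m≤m⊔n N K) a) ⊆T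
            (subst (λ t → Excludes t π) (sym e) rej)

  -- The interval of π has moved inwards on the side s, up to e …
  Killed : Side × ℚ → Play → Set
  Killed (s , e) π = ∀ x → x ∈[ axis s , π ] → ↑ e ⊑[ dir s ] value x

  -- … and e lies strictly inside the side s of the generic interval.
  Inner : Side × ℚ → Set
  Inner (s , e) = ∃[ y ] (y ∈[ axis s , generic ] × ¬ ↑ e ⊑[ dir s ] value y)

  other-point : ∀ i π → TightPoint i π
  other-point i π = proj₁ (tight-point {i} {π} {proj₁ (nonempty i π)} (proj₂ (nonempty i π)))

  limit-on-axis : ∀ i {π} (πs : ℕ → Play) → (∀ n → Agree n (Play.S π) (Play.S (πs n))) →
    (z : ∀ n → TightPoint i (πs n)) →
    Σ[ w ∈ TightPoint i π ] (∀ j → ∃[ n ] Close (value (TightPoint.x w)) (value (TightPoint.x (z n))) (¾ *ℚ 2⁻ j +ℚ ¾ *ℚ 2⁻ j))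
  limit-on-axis zero {π} πs a z =
    let (w , _ , h) = limit-points {π} πs a z (λ n → other-point (suc zero) (πs n))
    in w , λ j → let (n , _ , b , _) = h (suc j) 0 in n , tight-close {TightPoint.ζ w} {TightPoint.ζ (z n)} j b (TightPoint.tight w) (TightPoint.tight (z n))
  limit-on-axis (suc zero) {π} πs a z =
    let (_ , w , h) = limit-points {π} πs a (λ n → other-point zero (πs n)) z
    in w , λ j → let (n , _ , _ , b) = h (suc j) 0 in n , tight-close {TightPoint.ζ w} {TightPoint.ζ (z n)} j b (TightPoint.tight w) (TightPoint.tight (z n))

  -- Otherwise plays arbitrarily close to `π` keep points not beyond `e′`; by compactness these
  -- cluster at a point of the interval of `π` that is still not strictly beyond `e′`, although `π`
  -- is cut at `e`. The limit only preserves weak inequalities, hence the retreat from `e` to `e′`.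
  killed-persists : ∀ {s e e′ π} → ¬ ↑ e ⊑[ dir s ] ↑ e′ → Killed (s , e) π →
    ∃[ N ] (∀ π′ → Agree N (Play.S π) (Play.S π′) → Killed (s , e′) π′)
  killed-persists {s} {e} {e′} {π} e⋢e′ killed = by-contradiction λ ¬h →
    let survivor : ∀ n → ∃[ π′ ] (Agree n (Play.S π) (Play.S π′) ×
                           ∃[ x ] (x ∈[ axis s , π′ ] × ¬ ↑ e′ ⊑[ dir s ] value x))
        survivor n = by-contradiction λ ¬s → ¬h (n , λ π′ a x x∈ →
          by-contradiction λ ¬⊑ → ¬s (π′ , a , x , x∈ , ¬⊑))
        πs = λ n → proj₁ (survivor n)
        z : ∀ n → TightPoint (axis s) (πs n)
        z n = proj₁ (tight-point {axis s} {πs n} (proj₁ (proj₂ (proj₂ (proj₂ (survivor n))))))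
        z⊑ : ∀ n → value (TightPoint.x (z n)) ⊑[ dir s ] ↑ e′
        z⊑ n = ¬⊑⇒⊒ (dir s) (proj₂ (proj₂ (proj₂ (proj₂ (survivor n)))))
        (w , near) = limit-on-axis (axis s) {π} πs (λ n → proj₁ (proj₂ (survivor n))) z
    in e⋢e′ (⊑-trans (dir s) (killed (TightPoint.x w) (TightPoint.inside w))
         (limit-⊑ (dir s) λ j → let (n , c) = near j in value (TightPoint.x (z n)) , c , z⊑ n))

  -- The weaker cuts are chosen from the `Inner` witnesses alone, before any play is given, because
  -- one list has to serve the plays for all `N`.
  killed-all-persist : ∀ E → All Inner E → ∃[ E′ ] (map proj₁ E′ ≡ map proj₁ E × All Inner E′ ×
    (∀ π → All (λ k → Killed k π) E →
      ∃[ N ] (∀ π′ → Agree N (Play.S π) (Play.S π′) → All (λ k → Killed k π′) E′)))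
  killed-all-persist []            []              = [] , refl , [] , λ π _ → 0 , λ _ _ → []
  killed-all-persist ((s , e) ∷ E) ((y , y∈ , e⋢y) ∷ inner) =
    let (E′ , same , inner′ , persist) = killed-all-persist E inner
        (e′ , e′⋢y , e⋢e′) = between-⊑ (dir s) e⋢y
    in (s , e′) ∷ E′ , cong (s ∷_) same , (y , y∈ , e′⋢y) ∷ inner′ , λ { π (k ∷ ks) →
         let (N , f) = killed-persists {s} {e} {e′} {π} e⋢e′ k
             (M , g) = persist π ks
         in N ⊔ M , λ π′ a → f π′ (agree-≤ (ℕ.m≤m⊔n N M) a) ∷ g π′ (agree-≤ (ℕ.m≤n⊔m N M) a) }

  -- The cuts `E` come before `N`: the sides give way by a definite amount however long the play has
  -- followed the generic one.
  Lost : ℕ → List Side → ℕ → Set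
  Lost j A k = ∃[ E ] (map proj₁ E ≡ A × All Inner E × (∀ N → ∃[ π ]
    (Agree N (Play.S generic) (Play.S π) × family k j ⊆ Play.T π × All (λ s → Killed s π) E)))

  family-frame : ∀ k j → Frame (family k j)
  family-frame k = Chain.chain-frame (weights k) Δ*-frame

  target : ℕ → Square
  target = corner Δ*

  target-in : ∀ k j → j ℕ.≤ 4 → In (family k j) (target j)
  target-in k = Chain.corner-in (weights k) Δ*-frame

  target-out : ∀ k j → j ℕ.≤ 4 → ¬ In (family k (suc j)) (target j)
  target-out k = Chain.corner-out (weights k) Δ*-frame

  -- The generic interval has a point strictly nearer to the side `s`, so `w` does not lie on that
  -- side.
  Off : (Axis → UnitInterval) → Side → Set
  Off w s = ∃[ y ] (y ∈[ axis s , generic ] × ¬ value (w (axis s)) ⊑[ dir s ] value y)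

  Witness : Square → List Side → Set
  Witness x A = Σ[ w ∈ Preimage generic x ] All (Off (Preimage.at w)) A

  Reaching : List Side → Shape → Set
  Reaching A U = ∃[ E ] (map proj₁ E ≡ A × All Inner E × (∀ N → ∃[ π ]
    (Agree N (Play.S generic) (Play.S π) × Play.T π ≡ U × All (λ s → Killed s π) E)))

  extended : ∀ π N U → U ⊆ Play.T π → Closed U →
      ∃[ π′ ] (Agree N (Play.S π) (Play.S π′) × Play.T π′ ≡ U)
  extended π N U U⊆T closed = extend π N U U⊆T closed , extend-agree π N U U⊆T closed , refl

  -- Each play is followed until the loss of its sides is irrevocable, up to slightly weaker cuts,
  -- and shrunk to `U` afterwards.
  shrink-to : ∀ {j A k} → Lost j A k → ∀ U → Closed U → U ⊆ family k j → Reaching A U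
  shrink-to {j} {A} {k} (E , same , inner , plays) U closed U⊆ = go (killed-all-persist E inner)
    where
    go : ∃[ E′ ] (map proj₁ E′ ≡ map proj₁ E × All Inner E′ × (∀ π → All (λ s → Killed s π) E →
           ∃[ N ] (∀ π′ → Agree N (Play.S π) (Play.S π′) → All (λ s → Killed s π′) E′))) → Reaching A U
    go (E′ , same′ , inner′ , persist) = E′ , trans same′ same , inner′ , λ N → continue N (plays N)
      where
      continue : ∀ N →
          ∃[ π ] (Agree N (Play.S generic) (Play.S π) × family k j ⊆ Play.T π × All (λ s → Killed s π) E) →
        ∃[ π ] (Agree N (Play.S generic) (Play.S π) × Play.T π ≡ U × All (λ s → Killed s π) E′)
      continue N (π , a , ⊆T , killed) = finish (persist π killed)
        where
        finish : ∃[ M ] (∀ π′ → Agree M (Play.S π) (Play.S π′) → All (λ s → Killed s π′) E′) →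
          ∃[ π ] (Agree N (Play.S generic) (Play.S π) × Play.T π ≡ U × All (λ s → Killed s π) E′)
        finish (M , h) =
          let (π′ , b , e) = extended π (N ⊔ M) U (λ x x∈ → ⊆T x (U⊆ x x∈)) closed
          in π′ , agree-trans a (agree-≤ (ℕ.m≤m⊔n N M) b) , e , h π′ (agree-≤ (ℕ.m≤n⊔m N M) b)

  module _ (x : Square) (πs : ℕ → Play) (agree : ∀ n → Agree n (Play.S generic) (Play.S (πs n)))
           (at-x : ∀ n → Play.T (πs n) ≡ singleton x) where

    private
      z : ∀ i n → TightPoint i (πs n)
      z i n = other-point i (πs n)

    Limits : Set
    Limits = Σ[ w₁ ∈ TightPoint zero generic ] Σ[ w₂ ∈ TightPoint (suc zero) generic ] (∀ j → Often (λ n →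
      Agree j (TightPoint.ζ w₁) (TightPoint.ζ (z zero n)) × Agree j (TightPoint.ζ w₂) (TightPoint.ζ (z (suc zero) n))))

    -- Points of the rectangles of `πs n` are all mapped to `x` and cluster at a point of the
    -- generic rectangle; continuity of `K` carries the value over. They lie beyond the fixed cuts,
    -- hence so does the limit, and `Inner` provides generic points strictly before the cuts.
    limit-witness : ∀ E → All Inner E → (∀ n → All (λ s → Killed s (πs n)) E) → Limits →
        Witness x (map proj₁ E)
    limit-witness E inner killed (w₁ , w₂ , h) =
      preimage , off-list E inner killed
      where
      out : Output generic (TightPoint.ζ w₁) (TightPoint.ζ w₂)
      out = output (TightPoint.point w₁) (TightPoint.point w₂)
      at-precision : ∀ l → Close (c₁ x) (↑ (dyadic (Output.r₁ out l) l)) (2⁻ l) ×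
                           Close (c₂ x) (↑ (dyadic (Output.r₂ out l) l)) (2⁻ l)
      at-precision l =
        let (N , f) = output-continuous out (suc l)
            (n , N≤n , a , b) = h N N
            o = output (TightPoint.point (z zero n)) (TightPoint.point (z (suc zero) n))
            (e₁ , e₂) = f o (agree-≤ N≤n (agree n)) a b
            (f₁ , f₂) =
              singleton-in {x} {Output.y o} (subst (λ U → In U (Output.y o)) (at-x n) (Output.y∈T o))
        in subst (λ r → Close (c₁ x) (↑ (dyadic r l)) (2⁻ l)) (sym (e₁ l ℕ.≤-refl))
             (close-sym (close-≋ f₁ (close-sym (Output.r₁y o l)))) ,
           subst (λ r → Close (c₂ x) (↑ (dyadic r l)) (2⁻ l)) (sym (e₂ l ℕ.≤-refl))
             (close-sym (close-≋ f₂ (close-sym (Output.r₂y o l))))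
      preimage : Preimage generic x
      preimage = record { w₁ = w₁ ; w₂ = w₂ ; out = out
                        ; r₁x = λ l → proj₁ (at-precision l) ; r₂x = λ l → proj₂ (at-precision l) }
      at : Axis → UnitInterval
      at = Preimage.at preimage
      near : ∀ i j →
          ∃[ n ] Close (value (at i)) (value (TightPoint.x (z i n))) (¾ *ℚ 2⁻ j +ℚ ¾ *ℚ 2⁻ j)
      near zero j =
        let (n , _ , a , _) = h (suc j) 0
        in n , tight-close {TightPoint.ζ w₁} {TightPoint.ζ (z zero n)} j a (TightPoint.tight w₁) (TightPoint.tight (z zero n))
      near (suc zero) j =
        let (n , _ , _ , b) = h (suc j) 0
        in n , tight-close {TightPoint.ζ w₂} {TightPoint.ζ (z (suc zero) n)} j b (TightPoint.tight w₂) (TightPoint.tight (z (suc zero) n))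
      off-list : ∀ E → All Inner E → (∀ n → All (λ s → Killed s (πs n)) E) →
          All (Off at) (map proj₁ E)
      off-list []            []                        _      = []
      off-list ((s , e) ∷ E) ((y , y∈ , e⋢y) ∷ inner) killed =
        (y , y∈ , λ w⊑y → e⋢y (⊑-trans (dir s) e⊑w w⊑y)) ∷ off-list E inner (λ n → All.tail (killed n))
        where
        e⊑w : ↑ e ⊑[ dir s ] value (at (axis s))
        e⊑w = limit-⊒ (dir s) λ j →
          let (n , c) = near (axis s) j
          in value (TightPoint.x (z (axis s) n)) , c ,
             All.head (killed n) (TightPoint.x (z (axis s) n)) (TightPoint.inside (z (axis s) n))

  witness : ∀ {j A k} → j ℕ.≤ 4 → Lost j A k → Witness (target j) A
  witness {j} {A} {k} j≤4 lost = go (shrink-to {j} {A} {k} lost (singleton (target j)) (singleton-closed (target j))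
                                 (singleton-⊆ {target j} {family k j} (target-in k j j≤4)))
    where
    go : Reaching A (singleton (target j)) → Witness (target j) A
    go (E , refl , inner , plays) =
      let πs = λ n → proj₁ (plays n)
          agree = λ n → proj₁ (proj₂ (plays n))
          at-x = λ n → proj₁ (proj₂ (proj₂ (plays n)))
      in limit-witness (target j) πs agree at-x E inner (λ n → proj₂ (proj₂ (proj₂ (plays n))))
           (limit-points {generic} πs agree (λ n → other-point zero (πs n)) (λ n → other-point (suc zero) (πs n)))

  module Advance {x : Square} {A : List Side} (W : Witness x A) where
    open Preimage (proj₁ W)

    -- If the preimage is off `s`, shrinking along the chain after stage `N` cannot move `s` past
    -- it.
    Guarded : Side → ℕ → Set
    Guarded s N = Off at s → ∀ k j π → N ℕ.≤ k → j ℕ.≤ 5 → Agree N (Play.S generic) (Play.S π) →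
      family k j ⊆ Play.T π → ∀ e → ¬ ↑ e ⊑[ dir s ] value (at (axis s)) → ¬ Killed (s , e) π

    at-inside : ∀ i → at i ∈[ i , generic ]
    at-inside zero       = TightPoint.inside w₁
    at-inside (suc zero) = TightPoint.inside w₂

    unit-between : ∀ d {x y : UnitInterval} {q} → value x ⊑[ d ] ↑ q → ↑ q ⊑[ d ] value y →
        0ℚ ≤ℚ q × q ≤ℚ 1ℚ
    unit-between false {x} {y} {q} p r =
      ↑-reflect {0ℚ} {q} (≼-trans (0≼value x) p) , ↑-reflect {q} {1ℚ} (≼-trans r (value≼1 y))
    unit-between true  {x} {y} {q} p r =
      ↑-reflect {0ℚ} {q} (≼-trans (0≼value y) r) , ↑-reflect {q} {1ℚ} (≼-trans p (value≼1 x))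

    between-dir : ∀ d {i π x y z} → x ∈[ i , π ] → y ∈[ i , π ] → value x ⊑[ d ] value z →
        value z ⊑[ d ] value y → z ∈[ i , π ]
    between-dir false {i} {π} {x} {y} {z} x∈ y∈ p q = between-∈ {i} {π} {x} {y} {z} x∈ y∈ p q
    between-dir true  {i} {π} {x} {y} {z} x∈ y∈ p q = between-∈ {i} {π} {y} {x} {z} y∈ x∈ q p

    -- By convexity the generic interval contains a rational `q` strictly between the point `y` and
    -- the preimage. It survives, so a cut that is killed has to come before `q`, and hence before
    -- the preimage.
    guard : ∀ s → ∃[ N ] Guarded s N
    guard s = decide em
      where
      d : Bool
      d = dir s
      decide : Dec (Off at s) → ∃[ N ] Guarded s N
      decide (no ¬off) = 0 , λ off → contradiction off ¬off
      decide (yes (y , y∈ , w⋢y)) = build (between-⊑ d w⋢y)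
        where
        build : ∃[ q ] (¬ ↑ q ⊑[ d ] value y × ¬ value (at (axis s)) ⊑[ d ] ↑ q) →
            ∃[ N ] Guarded s N
        build (q , q⋢y , w⋢q) =
          let y⊑q = ¬⊑⇒⊒ d q⋢y
              q⊑w = ¬⊑⇒⊒ d w⋢q
              (0≤q , q≤1) = unit-between d {y} {at (axis s)} {q} y⊑q q⊑w
              v = unit-interval (↑ q) (↑-mono 0≤q) (↑-mono q≤1)
              (N , h) = survives (axis s) q 0≤q q≤1
                (between-dir d {axis s} {generic} {y} {at (axis s)} {v} y∈ (at-inside (axis s)) y⊑q q⊑w)
          in N , λ _ k j π N≤k j≤5 a ⊆T e e⋢w killed →
               e⋢w (⊑-trans d (killed v (h k j π N≤k j≤5 a ⊆T)) q⊑w)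

    guarded-mono : ∀ {s M N} → M ℕ.≤ N → Guarded s M → Guarded s N
    guarded-mono M≤N g off k j π N≤k j≤5 a = g off k j π (ℕ.≤-trans M≤N N≤k) j≤5 (agree-≤ M≤N a)

    guards : ∃[ N ] (∀ s → Guarded s N)
    guards = common-bound {4} {Guarded} (λ {s} → guarded-mono {s}) guard

    -- The rectangle misses a box around the preimage. The radius is the slack of tight names: all
    -- points of the box have names that share `N` entries with those of the preimage.
    Distant : ℕ → Play → Set
    Distant N π = ∀ y₁ y₂ → y₁ ∈[ zero , π ] → y₂ ∈[ suc zero , π ] →
      Close (value (at zero)) (value y₁) (¼ *ℚ 2⁻ N) → ¬ Close (value (at (suc zero))) (value y₂) (¼ *ℚ 2⁻ N)

    module _ (U : Shape) (l N : ℕ) (far : ¬ (∃[ y ] (In U y × Near (spread l) x y)))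
             (f : ∀ {π ζ₁ ζ₂} (o : Output π ζ₁ ζ₂) → Agree N (Play.S generic) (Play.S π) →
                  Agree N (TightPoint.ζ w₁) ζ₁ → Agree N (TightPoint.ζ w₂) ζ₂ →
                  Agree (suc l) (Output.r₁ out) (Output.r₁ o) × Agree (suc l) (Output.r₂ out) (Output.r₂ o)) where

      no-output : ∀ {π ζ₁ ζ₂} → Output π ζ₁ ζ₂ → Play.T π ≡ U →
          Agree N (Play.S generic) (Play.S π) →
                  Agree N (TightPoint.ζ w₁) ζ₁ → ¬ Agree N (TightPoint.ζ w₂) ζ₂
      no-output {π} o e a b₁ b₂ =
        let (e₁ , e₂) = f o a b₁ b₂
        in far (Output.y o , subst (λ V → In V (Output.y o)) e (Output.y∈T o) ,
             approx-close {2⁻_} {2⁻_} {Output.r₁ out} {Output.r₁ o} {c₁ x} {c₁ (Output.y o)} l (e₁ l ℕ.≤-refl) r₁x (Output.r₁y o) ,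
             approx-close {2⁻_} {2⁻_} {Output.r₂ out} {Output.r₂ o} {c₂ x} {c₂ (Output.y o)} l (e₂ l ℕ.≤-refl) r₂x (Output.r₂y o))

      distant : ∀ {π} → Play.T π ≡ U → Agree N (Play.S generic) (Play.S π) → Distant N π
      distant {π} e a y₁ y₂ y₁∈ y₂∈ d₁ d₂ =
        let (ξ₁ , b₁ , ξ₁y) = tight-neighbourhood {TightPoint.ζ w₁} y₁ N (TightPoint.tight w₁) d₁
            (ξ₂ , b₂ , ξ₂y) = tight-neighbourhood {TightPoint.ζ w₂} y₂ N (TightPoint.tight w₂) d₂
        in no-output {π} {ξ₁} {ξ₂} (output {π} {ξ₁} {ξ₂}
             (y₁ , ξ₁y , ∈-¬rejects {zero} {π} {ξ₁} {y₁} ξ₁y y₁∈)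
             (y₂ , ξ₂y , ∈-¬rejects {suc zero} {π} {ξ₂} {y₂} ξ₂y y₂∈)) e a b₁ b₂

    -- As `U` is closed, it keeps a distance from `x`. A point of the rectangle near the preimage
    -- would by continuity of `K` be mapped near `x`, but its image has to lie in `U`.
    repelled : ∀ U → Closed U → ¬ In U x →
      ∃[ N ] (∀ π → Play.T π ≡ U → Agree N (Play.S generic) (Play.S π) → Distant N π)
    repelled U closed x∉U =
      let (l , far) = ¬∀⇒∃¬ (λ h → x∉U (closed x h))
          (N , f) = output-continuous out (suc l)
      in N , λ π e a → distant U l N far f {π} e a

    module _ (N : ℕ) where
      private
        η : ℚ
        η = ¼ *ℚ 2⁻ N

      0<η : 0ℚ <ℚ ¼ *ℚ 2⁻ N
      0<η = ℚ.positive⁻¹ (¼ *ℚ 2⁻ N) {{ℚ.pos*pos⇒pos ¼ (2⁻ N) {{positive (0<2⁻ N)}}}}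

      Beyond : Bool → Axis → UnitInterval → Set
      Beyond false i x = value (at i) ⊕ ↑ η ≼ value x
      Beyond true  i x = value x ⊕ ↑ η ≼ value (at i)

      beyond-⊑ : ∀ d {i x} → Beyond d i x → value (at i) ⊑[ d ] value x
      beyond-⊑ false h = ≼-trans (close-≼ (close-refl (ℚ.<⇒≤ 0<η))) h
      beyond-⊑ true  h = ≼-trans (close-≼ (close-refl (ℚ.<⇒≤ 0<η))) h

      -- `Beyond` leaves a gap of width `η` next to the preimage, and a rational is chosen in it. It
      -- depends on the direction and the axis but not on the play, as the uniform cuts in `Lost`
      -- require.
      cut : ∀ d i → ∃[ e ] (¬ ↑ e ⊑[ d ] value (at i) × (∀ x → Beyond d i x → ↑ e ⊑[ d ] value x))
      cut false i =
        let w = value (at i)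
            (q , p , r) = rational-between {w} {w ⊕ ↑ η} (gap⇒¬≼ {w ⊕ ↑ η} {w} 0<η ≼-refl)
        in q , p , λ x h → ≼-trans (¬≼⇒≽ r) h
      cut true i =
        let w = value (at i)
            (q , p , r) = rational-between {w ⊖ ↑ η} {w} (gap⇒¬≼ {w} {w ⊖ ↑ η} 0<η
              (≋⇒≼ (ringʳ 2 (λ w e → (w :⊖ e) :⊕ e :≋ w) refl (w ∷ ↑ η ∷ []))))
        in q , r , λ x h → ≼-trans (linear h
             (ringʳ 3 (λ w e x → (w :⊖ e) :⊖ x :≋ w :⊖ (x :⊕ e)) refl (w ∷ ↑ η ∷ value x ∷ []))) (¬≼⇒≽ p)

      apart : ∀ {i x} → ¬ Close (value (at i)) (value x) η → ∃[ d ] Beyond d i x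
      apart {i} {x} h = decide em
        where
        decide : Dec (value (at i) ≼ value x ⊕ ↑ η) → ∃[ d ] Beyond d i x
        decide (yes p) = false , ¬≼⇒≽ (λ q → h (mkClose p q))
        decide (no ¬p) = true , ¬≼⇒≽ ¬p

      -- With points on both sides, convexity would put the coordinate `at i` itself into the
      -- interval.
      one-sided : ∀ i {π} → (∀ x → x ∈[ i , π ] → ¬ Close (value (at i)) (value x) η) →
                  ∃[ d ] (∀ x → x ∈[ i , π ] → Beyond d i x)
      one-sided i {π} far = go (apart {i} {x₀} (far x₀ x₀∈))
        where
        x₀ : UnitInterval
        x₀ = proj₁ (nonempty i π)
        x₀∈ : x₀ ∈[ i , π ]
        x₀∈ = proj₂ (nonempty i π)
        impossible : ∀ {x y} → x ∈[ i , π ] → y ∈[ i , π ] → Beyond true i x → ¬ Beyond false i y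
        impossible {x} {y} x∈ y∈ p q = far (at i)
          (between-∈ {i} {π} {x} {y} {at i} x∈ y∈ (beyond-⊑ true {i} {x} p) (beyond-⊑ false {i} {y} q))
          (close-refl (ℚ.<⇒≤ 0<η))
        same : ∀ d → Beyond d i x₀ → ∀ x → x ∈[ i , π ] → ∃[ d′ ] Beyond d′ i x → Beyond d i x
        same false p x x∈ (false , q) = q
        same false p x x∈ (true  , q) = contradiction p (impossible {x} {x₀} x∈ x₀∈ q)
        same true  p x x∈ (false , q) = contradiction q (impossible {x₀} {x} x₀∈ x∈ p)
        same true  p x x∈ (true  , q) = q
        go : ∃[ d ] Beyond d i x₀ → ∃[ d ] (∀ x → x ∈[ i , π ] → Beyond d i x)
        go (d , p) = d , λ x x∈ → same d p x x∈ (apart {i} {x} (far x x∈))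

      as-side : ∀ i d {π} → (∀ x → x ∈[ i , π ] → Beyond d i x) →
                ∃[ s ] (∀ x → x ∈[ axis s , π ] → Beyond (dir s) (axis s) x)
      as-side zero       false h = zero , h
      as-side zero       true  h = suc zero , h
      as-side (suc zero) false h = suc (suc zero) , h
      as-side (suc zero) true  h = suc (suc (suc zero)) , h

      cut-at : Side → ℚ
      cut-at s = proj₁ (cut (dir s) (axis s))

      beside : ∀ s → ¬ ↑ (cut-at s) ⊑[ dir s ] value (at (axis s))
      beside s = proj₁ (proj₂ (cut (dir s) (axis s)))

      -- A rectangle that misses a box has a factor that misses the corresponding factor of the box,
      -- and this factor lies on one side of it.
      some-side : ∀ {π} → Distant N π → ∃[ s ] Killed (s , cut-at s) π
      some-side {π} distant = finish (decide em)
        where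
        Far : Axis → Set
        Far i = ∀ x → x ∈[ i , π ] → ¬ Close (value (at i)) (value x) η
        decide : Dec (∃[ y ] (y ∈[ zero , π ] × Close (value (at zero)) (value y) η)) → ∃[ i ] Far i
        decide (yes (y , y∈ , c)) = suc zero , λ x x∈ → distant y x y∈ x∈ c
        decide (no ¬h)            = zero , λ x x∈ c → ¬h (x , x∈ , c)
        finish : ∃[ i ] Far i → ∃[ s ] Killed (s , cut-at s) π
        finish (i , far) =
          let (d , h) = one-sided i {π} far
              (s , g) = as-side i d {π} h
          in s , λ x x∈ → proj₂ (proj₂ (cut (dir s) (axis s))) x (g x x∈)

    module _ {j k} (j≤4 : j ℕ.≤ 4) (k-large : proj₁ guards ℕ.≤ k) where
      private
        U : Shape
        U = family k (suc j)

      -- Plays that follow the generic one ever longer may give up different sides; the pigeonhole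
      -- principle picks one that is given up for arbitrarily long agreement.
      lose : ∃[ N ] (∀ π → Play.T π ≡ U → Agree N (Play.S generic) (Play.S π) → Distant N π) →
             Reaching A U → ∃[ s ] (¬ Off at s × Lost (suc j) (s ∷ A) k)
      lose (N , repel) (E , same , inner , plays) = collect (often-Fin choices)
        where
        Choice : Side → ℕ → Set
        Choice s n = ¬ Off at s × ∃[ π ] (Agree n (Play.S generic) (Play.S π) × U ⊆ Play.T π ×
                       All (λ s → Killed s π) ((s , cut-at N s) ∷ E))
        G : ℕ
        G = proj₁ guards
        choose : ∀ n →
            ∃[ π ] (Agree (n ⊔ (N ⊔ G)) (Play.S generic) (Play.S π) × Play.T π ≡ U × All (λ s → Killed s π) E) →
                 ∃[ s ] Choice s n
        choose n (π , a , e , killed) =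
          -- Agreement up to `n` is what `Choice` asks for, up to `N` keeps the rectangle away from
          -- the preimage, and up to `G` activates the guards.
          let n≤ = ℕ.m≤m⊔n n (N ⊔ G)
              N≤ = ℕ.≤-trans (ℕ.m≤m⊔n N G) (ℕ.m≤n⊔m n (N ⊔ G))
              G≤ = ℕ.≤-trans (ℕ.m≤n⊔m N G) (ℕ.m≤n⊔m n (N ⊔ G))
              U⊆ : U ⊆ Play.T π
              U⊆ x x∈ = subst (λ V → In V x) (sym e) x∈
              (s , ks) = some-side N {π} (repel π e (agree-≤ N≤ a))
          in s , (λ off → proj₂ guards s off k (suc j) π k-large (ℕ.s≤s j≤4) (agree-≤ G≤ a) U⊆
                            (cut-at N s) (beside N s) ks) ,
             π , agree-≤ n≤ a , U⊆ , ks ∷ killed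
        choices : Often (λ n → ∃[ s ] Choice s n)
        choices n = n , ℕ.≤-refl , choose n (plays (n ⊔ (N ⊔ G)))
        collect : ∃[ s ] Often (Choice s) → ∃[ s ] (¬ Off at s × Lost (suc j) (s ∷ A) k)
        collect (s , often) = s , proj₁ (proj₂ (proj₂ (often 0))) ,
          (s , cut-at N s) ∷ E , cong (s ∷_) same ,
          (at (axis s) , at-inside (axis s) , beside N s) ∷ inner ,
          λ n → let (m , n≤m , _ , π , a , U⊆ , ks) = often n in π , agree-≤ n≤m a , U⊆ , ks

  -- The witness is fixed before `k`, so its guards hold for all large `k`, and a second use of the
  -- pigeonhole principle makes the new side the same for infinitely many of these.
  lose-side : ∀ {j A} → j ℕ.≤ 4 → Often (Lost j A) → (W : Witness (target j) A) →
              ∃[ s ] (¬ Off (Preimage.at (proj₁ W)) s × Often (Lost (suc j) (s ∷ A)))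
  lose-side {j} {A} j≤4 often W = collect (often-Fin (often-map next (often-≥ (proj₁ guards) often)))
    where
    open Advance W
    next : ∀ k → proj₁ guards ℕ.≤ k × Lost j A k →
        ∃[ s ] (¬ Off (Preimage.at (proj₁ W)) s × Lost (suc j) (s ∷ A) k)
    next k (G≤k , lost) =
      let U = family k (suc j)
          closed = frame-closed (family-frame k (suc j))
      in lose {j} {k} j≤4 G≤k (repelled U closed (target-out k j j≤4))
           (shrink-to {j} {A} {k} lost U closed (Chain.chain-⊆ (weights k) Δ* j))
    collect : ∃[ s ] Often (λ k → ¬ Off (Preimage.at (proj₁ W)) s × Lost (suc j) (s ∷ A) k) →
              ∃[ s ] (¬ Off (Preimage.at (proj₁ W)) s × Often (Lost (suc j) (s ∷ A)))
    collect (s , o) = s , proj₁ (proj₂ (proj₂ (o 0))) , often-map (λ _ → proj₂) o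

  lost-sides : ∀ j → j ℕ.≤ 5 → ∃[ A ] (Unique A × length A ≡ j × Often (Lost j A))
  lost-sides zero    _ = [] , [] , refl , λ k → k , ℕ.≤-refl , [] , refl , [] , λ N →
    generic , agree-refl , (λ x x∈ → subst (λ V → In V x) (sym generic-T) x∈) , []
  lost-sides (suc j) (ℕ.s≤s j≤4) = go (lost-sides j (ℕ.≤-trans j≤4 (ℕ.n≤1+n 4)))
    where
    go : ∃[ A ] (Unique A × length A ≡ j × Often (Lost j A)) →
         ∃[ A ] (Unique A × length A ≡ suc j × Often (Lost (suc j) A))
    go (A , unique , len , often) =
      let W = witness {j} {A} {proj₁ (often 0)} j≤4 (proj₂ (proj₂ (often 0)))
          (s , on , often′) = lose-side j≤4 often W
      -- The side is new because the witness is off every side in `A` but not off `s`.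
      in s ∷ A , All.map (λ off e → on (subst (Off (Preimage.at (proj₁ W))) (sym e) off)) (proj₂ W) ∷ unique ,
         cong suc len , often′

  impossible : ∀ {P : Set} → P
  impossible =
    let (A , unique , len , _) = lost-sides 5 ℕ.≤-refl
    in contradiction (subst (ℕ._≤ 4) len (unique-length A unique)) (ℕ.<⇒≱ (ℕ.n<1+n 4))

theorem28 : ExcludedMiddle 0ℓ → ¬ (XC₂∣𝔗 ≤W XC 1 ×ᵐ XC 1)
theorem28 em (H , K , H-comp , K-comp , red) = Separation.impossible em H K H-comp K-comp red
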